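{- Let $\mathcal{G}=(H,\sigma,\alpha,h_0)$ be a rooted combinatorial map whose underlying graph $G=(V,E)$ has at least one edge, let $v_0$ be the root-vertex and $T_G(x,y)$ the Tutte polynomial of $G$. Then: 1. The $v_0$-connected orientations are in bijection with the connected subgraphs, counted by $T_G(1,2)$. 2. The strongly connected orientations are in bijection with the external subgraphs, counted by $T_G(0,2)$. 3. The outdegree sequences are in bijection with the minimal orientations, which are in bijection with the forests, counted by $T_G(2,1)$. 4. The acyclic orientations are in bijection with the internal forests, counted by $T_G(2,0)$. 5. The $v_0$-connected outdegree sequences are in bijection with the $v_0$-connected minimal orientations, which are in bijection with the spanning trees, counted by $T_G(1,1)$. 6. The strongly connected outdegree sequences are in bijection with the strongly connected minimal orientations, which are in bijection with the external spanning trees, counted by $T_G(0,1)$. 7. The $v_0$-connected acyclic orientations are in bijection with the internal spanning trees, counted by $T_G(1,0)$.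
   Context: Tutte polynomial: $T_G(x,y)=\sum_{S\subseteq E}(x-1)^{c(S)-1}(y-1)^{|S|+c(S)-|V|}$, $c(S)$ the number of components of $(V,S)$. A rooted combinatorial map is $\mathcal{G}=(H,\sigma,\alpha,h_0)$ with $H$ a finite set of half-edges, $\sigma$ a permutation, $\alpha$ a fixed-point-free involution, $\langle\sigma,\alpha\rangle$ transitive on $H$, root $h_0$; its underlying graph $G=(V,E)$ has the cycles of $\sigma$ as vertices and pairs $\{h,\alpha(h)\}$ as edges; $v_0$ is the vertex containing $h_0$. Subgraphs are spanning, identified with edge sets. An orientation assigns to each edge $\{h,h'\}$ an ordered pair $(h,h')$ (tail $h$, head $h'$); it is $v_0$-connected if all vertices are reachable from $v_0$ by directed paths, strongly connected if all vertices are mutually reachable, acyclic if it has no directed cycle. The outdegree sequence maps each vertex to its number of incident tails; reachability depends only on the outdegree sequence, so an outdegree sequence is called $v_0$-connected (resp. strongly connected) if its orientations are. For a spanning tree $T$: edges in $T$ are internal, others external; the motion function $t(h)=\sigma\alpha(h)$ if the edge of $h$ is internal, $\sigma(h)$ otherwise, is a cyclic permutation of $H$; the $(\mathcal{G},T)$-order on $H$ is $h_0<t(h_0)<\dots<t^{|H|-1}(h_0)$, edges compared via their smaller half-edge. Fundamental cycle of external $e$: the set of $e'$ with $T-e'+e$ a spanning tree; fundamental cocycle of internal $e$: the set of $e'$ with $T-e+e'$ a spanning tree; an edge is $(\mathcal{G},T)$-active if minimal in its fundamental cycle/cocycle. $T$ is internal (resp. external) if it has no external (resp. internal) active edge. $[T^-,T^+]$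 is the set of subgraphs obtained from $T$ by removing some internal active edges and adding some external active edges; every subgraph lies in exactly one tree-interval, and $S\in[T^-,T^+]$ is called internal (resp. external) if $T$ is. $\Phi(S)$ for $S\in[T^-,T^+]$: for $e=\{h_1,h_2\}$ with $h_1<h_2$, $\Phi(S)(e)=(h_1,h_2)$ if either ($e\in T$ and its fundamental cocycle contains no edge of $S\triangle T$) or ($e\notin T$ and its fundamental cycle contains some edge of $S\triangle T$); otherwise $(h_2,h_1)$; $\Phi$ is a bijection from subgraphs to orientations. An orientation $\mathcal{O}$ is minimal if, with $T$ the tree such that $\Phi^{ -1}(\mathcal{O})\in[T^-,T^+]$, no $\mathcal{O}$-directed cycle has as smallest half-edge (in $(\mathcal{G},T)$-order) a tail. -}

module Defs where

open import Data.Nat using (ℕ; zero; suc; _+_; _∸_; _≤_; _<_; _≤ᵇ_; _<ᵇ_; _⊓_)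
open import Data.Integer as ℤ using (ℤ; +_)
open import Data.Bool using (Bool; true; false; _∧_; _∨_; _xor_; not; if_then_else_)
import Data.Bool as B
open import Data.Fin using (Fin; toℕ; zero; suc; _≟_)
open import Data.Fin.Permutation using (Permutation′; _⟨$⟩ʳ_; _⟨$⟩ˡ_)
open import Data.Vec using (Vec; []; _∷_; lookup; tabulate; _[_]≔_)
open import Data.List using (List; []; _∷_; _++_; map; foldr; allFin)
open import Data.Product using (Σ; _×_; _,_; ∃)
open import Data.Sum using (_⊎_)
open import Data.Unit using (⊤)
open import Relation.Nullary using (¬_; does)
open import Relation.Binary.PropositionalEquality using (_≡_; _≢_)

-- "P-elements of A are in bijection with Q-elements of B": the sets
-- {a | P a} and {b | Q b} are in bijection, elements being identified by
-- their underlying value (so proofs of P / Q are irrelevant).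
record _⟷_ {A B : Set} (P : A → Set) (Q : B → Set) : Set where
  field
    to        : ∀ {a} → P a → B
    to-ok     : ∀ {a} (p : P a) → Q (to p)
    to-irr    : ∀ {a} (p p′ : P a) → to p ≡ to p′
    from      : ∀ {b} → Q b → A
    from-ok   : ∀ {b} (q : Q b) → P (from q)
    from-irr  : ∀ {b} (q q′ : Q b) → from q ≡ from q′
    from∘to   : ∀ {a} (p : P a) → from (to-ok p) ≡ a
    to∘from   : ∀ {b} (q : Q b) → to (from-ok q) ≡ b

infix 4 _⟷_

CountedBy : {A : Set} → (A → Set) → ℤ → Set
CountedBy P z = Σ ℕ λ k → (P ⟷ (λ (_ : Fin k) → ⊤)) × (z ≡ + k)

iter : {A : Set} → ℕ → (A → A) → A → A
iter zero    f x = x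
iter (suc k) f x = f (iter k f x)

anyBelow : ℕ → (ℕ → Bool) → Bool
anyBelow zero    p = false
anyBelow (suc k) p = anyBelow k p ∨ p k

allBelow : ℕ → (ℕ → Bool) → Bool
allBelow k p = not (anyBelow k (λ i → not (p i)))

-- least i < k with p i, or k if there is none
firstBelow : ℕ → (ℕ → Bool) → ℕ
firstBelow zero    p = zero
firstBelow (suc k) p = if anyBelow k p then firstBelow k p else (if p k then k else suc k)

anyF : ∀ {n} → (Fin n → Bool) → Bool
anyF {n} p = foldr (λ i b → p i ∨ b) false (allFin n)

allF : ∀ {n} → (Fin n → Bool) → Bool
allF {n} p = foldr (λ i b → p i ∧ b) true (allFin n)

countF : ∀ {n} → (Fin n → Bool) → ℕ
countF {n} p = foldr (λ i c → (if p i then 1 else 0) + c) 0 (allFin n)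

_==_ : ∀ {n} → Fin n → Fin n → Bool
i == j = does (i ≟ j)

allSubsets : ∀ n → List (Vec Bool n)
allSubsets zero    = [] ∷ []
allSubsets (suc n) = map (false ∷_) (allSubsets n) ++ map (true ∷_) (allSubsets n)

sumℤ : List ℤ → ℤ
sumℤ = foldr ℤ._+_ (+ 0)

next : ∀ {k} → Fin (suc k) → Fin (suc k)
next {zero}  _       = zero
next {suc k} zero    = suc zero
next {suc k} (suc i) with next {k} i
... | zero  = zero
... | suc j = suc (suc j)

data Reach {n : ℕ} (σ α : Permutation′ n) (h : Fin n) : Fin n → Set where
  here  : Reach σ α h h
  viaσ  : ∀ {h′} → Reach σ α h h′ → Reach σ α h (σ ⟨$⟩ʳ h′)
  viaσ⁻ : ∀ {h′} → Reach σ α h h′ → Reach σ α h (σ ⟨$⟩ˡ h′)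
  viaα  : ∀ {h′} → Reach σ α h h′ → Reach σ α h (α ⟨$⟩ʳ h′)

record RootedMap : Set where
  field
    n          : ℕ
    σ          : Permutation′ n
    α          : Permutation′ n
    α-invol    : ∀ h → α ⟨$⟩ʳ (α ⟨$⟩ʳ h) ≡ h
    α-fpf      : ∀ h → α ⟨$⟩ʳ h ≢ h
    h₀         : Fin n
    transitive : ∀ h → Reach σ α h₀ h

module _ (M : RootedMap) where
  open RootedMap M

  HSet : Set
  HSet = Vec Bool n

  σ· σ⁻ α· : Fin n → Fin n
  σ· h = σ ⟨$⟩ʳ h
  σ⁻ h = σ ⟨$⟩ˡ h
  α· h = α ⟨$⟩ʳ h

  -- vertices = cycles of σ
  sameV : Fin n → Fin n → Bool
  sameV h h′ = anyBelow n (λ k → iter k σ· h == h′)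

  -- h represents its vertex if it is the smallest half-edge of its σ-cycle
  isVertexRep : Fin n → Bool
  isVertexRep h = allBelow n (λ k → toℕ h ≤ᵇ toℕ (iter k σ· h))

  numV : ℕ
  numV = countF isVertexRep

  -- h represents its edge {h, α h} if h < α h
  isEdgeRep : Fin n → Bool
  isEdgeRep h = toℕ h <ᵇ toℕ (α· h)

  numE : ℕ
  numE = countF isEdgeRep

  -- subgraphs (spanning; edge sets): α-closed sets of half-edges
  IsSubgraph : HSet → Set
  IsSubgraph S = ∀ h → lookup S h ≡ lookup S (α· h)

  isSubgraphB : HSet → Bool
  isSubgraphB S = allF (λ h → not (lookup S h xor lookup S (α· h)))

  size : HSet → ℕ
  size S = countF (λ h → lookup S h ∧ isEdgeRep h)

  -- orientations: the set O of tails; each edge has exactly one tail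
  IsOrientation : HSet → Set
  IsOrientation O = ∀ h → lookup O h ≡ not (lookup O (α· h))

  singleton : Fin n → HSet
  singleton h = tabulate (λ h′ → h == h′)

  -- one closure step: stay at the same vertex (σ, σ⁻¹), or cross the edge
  -- from half-edge α h to h when `move (α h)` holds
  closeStep : (Fin n → Bool) → HSet → HSet
  closeStep move R = tabulate (λ h →
    lookup R h ∨ lookup R (σ⁻ h) ∨ lookup R (σ· h) ∨ (lookup R (α· h) ∧ move (α· h)))

  reachSet : (Fin n → Bool) → Fin n → HSet
  reachSet move h = iter n (closeStep move) (singleton h)

  -- undirected connectivity in subgraph S (between the vertices of h, h′)
  conn : HSet → Fin n → Fin n → Bool
  conn S h h′ = lookup (reachSet (lookup S) h) h′

  -- directed reachability in orientation O (edges traversed tail → head)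
  dirReach : HSet → Fin n → Fin n → Bool
  dirReach O h h′ = lookup (reachSet (lookup O) h) h′

  numComp : HSet → ℕ
  numComp S = countF (λ h → allF (λ h′ → not (conn S h h′) ∨ (toℕ h ≤ᵇ toℕ h′)))

  tutte : ℤ → ℤ → ℤ
  tutte x y = sumℤ (map term (filterSub (allSubsets n)))
    where
    term : HSet → ℤ
    term S = ((x ℤ.- + 1) ℤ.^ (numComp S ∸ 1))
             ℤ.* ((y ℤ.- + 1) ℤ.^ (size S + numComp S ∸ numV))
    filterSub : List HSet → List HSet
    filterSub []       = []
    filterSub (S ∷ Ss) = if isSubgraphB S then S ∷ filterSub Ss else filterSub Ss

  removeEdge addEdge : HSet → Fin n → HSet
  removeEdge S h = (S [ h ]≔ false) [ α· h ]≔ false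
  addEdge    S h = (S [ h ]≔ true)  [ α· h ]≔ true

  connectedB : HSet → Bool
  connectedB S = allF (λ h → allF (λ h′ → conn S h h′))

  -- forest: no cycle, i.e. no edge of S whose endpoints remain connected in S - e
  forestB : HSet → Bool
  forestB S = allF (λ h → not (lookup S h) ∨ not (conn (removeEdge S h) h (α· h)))

  spanningTreeB : HSet → Bool
  spanningTreeB S = isSubgraphB S ∧ forestB S ∧ connectedB S

  IsConnected : HSet → Set
  IsConnected S = IsSubgraph S × (∀ h h′ → conn S h h′ ≡ true)

  IsForest : HSet → Set
  IsForest S = IsSubgraph S × forestB S ≡ true

  IsSpanningTree : HSet → Set
  IsSpanningTree S = spanningTreeB S ≡ true

  motion : HSet → Fin n → Fin n
  motion T h = if lookup T h then σ· (α· h) else σ· h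

  pos : HSet → Fin n → ℕ
  pos T h = firstBelow n (λ k → iter k (motion T) h₀ == h)

  edgeKey : HSet → Fin n → ℕ
  edgeKey T h = pos T h ⊓ pos T (α· h)

  -- e′ (given by a half-edge) is in the fundamental cocycle of internal e
  inCocycle : HSet → Fin n → Fin n → Bool
  inCocycle T e e′ = spanningTreeB (addEdge (removeEdge T e) e′)

  -- e′ is in the fundamental cycle of external e
  inCycle : HSet → Fin n → Fin n → Bool
  inCycle T e e′ = spanningTreeB (removeEdge (addEdge T e) e′)

  activeB : HSet → Fin n → Bool
  activeB T e =
    if lookup T e
    then allF (λ e′ → not (inCocycle T e e′) ∨ (edgeKey T e ≤ᵇ edgeKey T e′))
    else allF (λ e′ → not (inCycle T e e′) ∨ (edgeKey T e ≤ᵇ edgeKey T e′))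

  internalTreeB : HSet → Bool
  internalTreeB T = allF (λ e → lookup T e ∨ not (activeB T e))

  externalTreeB : HSet → Bool
  externalTreeB T = allF (λ e → not (lookup T e) ∨ not (activeB T e))

  InInterval : HSet → HSet → Set
  InInterval T S = IsSpanningTree T × IsSubgraph S
                   × (∀ e → lookup S e ≢ lookup T e → activeB T e ≡ true)

  IsInternal IsExternal : HSet → Set
  IsInternal S = ∃ λ T → InInterval T S × internalTreeB T ≡ true
  IsExternal S = ∃ λ T → InInterval T S × externalTreeB T ≡ true

  -- Φ(S) for S ∈ [T⁻,T⁺], given as its set of tails
  phi : HSet → HSet → HSet
  phi T S = tabulate (λ h → if pos T h <ᵇ pos T (α· h) then cond h else not (cond h))
    where
    inDiff : Fin n → Bool
    inDiff e′ = lookup S e′ xor lookup T e′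
    cond : Fin n → Bool
    cond e = if lookup T e
             then not (anyF (λ e′ → inDiff e′ ∧ inCocycle T e e′))
             else anyF (λ e′ → inDiff e′ ∧ inCycle T e e′)

  -- directed cycles of an orientation O: tails t₀,…,t_k of its edges,
  -- head of tᵢ at the vertex of tᵢ₊₁ (cyclically), vertices pairwise distinct
  record DirCycle (O : HSet) : Set where
    field
      len    : ℕ
      t      : Fin (suc len) → Fin n
      tails  : ∀ i → lookup O (t i) ≡ true
      link   : ∀ i → sameV (α· (t i)) (t (next i)) ≡ true
      simple : ∀ i j → sameV (t i) (t j) ≡ true → i ≡ j

  IsSmallestHalfEdge : HSet → {O : HSet} → DirCycle O → Fin n → Set
  IsSmallestHalfEdge T C h =
    (∃ λ i → h ≡ t i ⊎ h ≡ α· (t i))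
    × (∀ j → pos T h ≤ pos T (t j) × pos T h ≤ pos T (α· (t j)))
    where open DirCycle C

  V0Connected StronglyConnected Acyclic Minimal : HSet → Set
  V0Connected O = ∀ h → dirReach O h₀ h ≡ true
  StronglyConnected O = ∀ h h′ → dirReach O h h′ ≡ true
  Acyclic O = ¬ DirCycle O
  Minimal O = ∀ S T → InInterval T S → phi T S ≡ O →
              ∀ (C : DirCycle O) h → IsSmallestHalfEdge T C h → lookup O h ≡ false

  -- outdegree sequences, indexed by half-edges (constant on each vertex)
  outdeg : HSet → Vec ℕ n
  outdeg O = tabulate (λ h → countF (λ h′ → sameV h h′ ∧ lookup O h′))

  IsOutdegSeq V0ConnectedSeq StronglyConnectedSeq : Vec ℕ n → Set
  IsOutdegSeq d = ∃ λ O → IsOrientation O × outdeg O ≡ d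
  V0ConnectedSeq d = IsOutdegSeq d × (∀ O → IsOrientation O → outdeg O ≡ d → V0Connected O)
  StronglyConnectedSeq d = IsOutdegSeq d × (∀ O → IsOrientation O → outdeg O ≡ d → StronglyConnected O)

{-# OPTIONS --safe #-}
module Submission where

open import Defs
import Algebra.Properties.CommutativeMonoid.Sum
open import Data.Bool using (Bool; true; false; _∧_; _∨_; not; if_then_else_; _xor_; T)
import Data.Bool.Properties as 𝔹
open import Data.Empty using (⊥; ⊥-elim)
open import Data.Fin as F using (Fin; zero; suc; toℕ; _≟_)
open import Data.Fin.Permutation as Perm using (Permutation′; _⟨$⟩ʳ_)
import Data.Fin.Properties as FP
open import Data.List as L using (List; []; _∷_; foldr; allFin)
import Data.List.Properties as LP
open import Data.List.Relation.Unary.All using (All; []; _∷_)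
open import Data.Nat hiding (_≟_)
open import Data.Nat.DivMod using (_%_; _/_; m≡m%n+[m/n]*n; m%n<n)
open import Data.Nat.Induction using (<-rec)
open import Data.Nat.Properties hiding (_≟_)
open import Data.Product using (Σ; ∃; _×_; _,_; proj₁; proj₂)
open import Data.Sum using (_⊎_; inj₁; inj₂; [_,_]′)
open import Data.Vec using (Vec; []; _∷_; lookup; tabulate; _[_]≔_)
import Data.Vec.Properties as VP
open import Function using (_∘_; id; Injective; case_of_; Equivalence)
open import Relation.Binary.Definitions using (tri<; tri≈; tri>)
open import Relation.Binary.PropositionalEquality
open import Relation.Nullary using (¬_; Dec; yes; no)
open import Relation.Nullary.Decidable using (dec-true; dec-false)

-- The tour of a spanning tree T visits the half-edges below an internal edge consecutively, so
-- membership in fundamental cycles and cocycles becomes a crossing condition on positions.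
-- For S in the interval of T, the fundamental cycles of the edges of S ∖ T and the fundamental
-- cocycles of the edges of T ∖ S are directed in Φ(S). Looking at the first edge of a cut met by
-- the tour, or at the smallest edge of a cycle, one finds that Φ(S) is v₀-connected iff T ⊆ S iff
-- S is connected, minimal iff S ⊆ T iff S is a forest, strongly connected iff T has no internal
-- active edge, and acyclic iff T has no external active edge.
--
-- Orientations with equal outdegrees have the same directed cuts and the same reachability,
-- also outside a part on which they agree. Hence, running their tours in parallel, their trees
-- cannot differ before the orientations do. This makes Φ injective on the pairs (T, S), and the
-- minimal orientation with given outdegrees unique; it exists because reversing the fundamental
-- cycle of an edge of S ∖ T lowers the sequence of tails read along the tour. A tree maximizing
-- |T ∩ S| and then, lexicographically along its own tour, T △ S has S in its interval. As there
-- are as many orientations as subgraphs, Φ is a bijection and the intervals are disjoint.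
--
-- Toggling the first internal (external) active edge changes the sign of (−1)^(c(S)−1)
-- (of (−1)^(|S|+c(S)−|V|)), which evaluates the Tutte polynomial at x = 0 (at y = 0).

-- Tree paths are never built. A set of vertices is a σ-invariant set of half-edges, and that `y`
-- can be reached from `x` is proved by supposing that the set reachable from `x` misses `y` and
-- examining an edge across its border; `path-entry` supplies such an edge on the tree path.
--
-- Hence everything up to that point concerns an arbitrary pair `Interval T S`, injectivity is
-- proved for pairs, and a tree is chosen only afterwards.
--
-- An internal and an external edge can cross in the tour in two ways, according to which is
-- smaller, and activity of the edges of S △ T excludes one of them. So an edge whose direction in
-- Φ(S) is not the one it has in Φ(T) lies either on the directed fundamental cycle of an added edge
-- or in the directed fundamental cocycle of a removed one. No edge is on a directed cycle and in a
-- directed cut at once, and most case distinctions end in this clash.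

module Σℕ = Algebra.Properties.CommutativeMonoid.Sum +-0-commutativeMonoid
open Σℕ using (sum)

-- Booleans and comparisons

clash : ∀ {ℓ} {A : Set ℓ} {b} → b ≡ true → b ≡ false → A
clash refl ()

bool-cases : ∀ b → b ≡ true ⊎ b ≡ false
bool-cases true  = inj₁ refl
bool-cases false = inj₂ refl

≢true⇒false : ∀ {b} → ¬ (b ≡ true) → b ≡ false
≢true⇒false {true}  ne = ⊥-elim (ne refl)
≢true⇒false {false} ne = refl

≢false⇒true : ∀ {b} → ¬ (b ≡ false) → b ≡ true
≢false⇒true {true}  ne = refl
≢false⇒true {false} ne = ⊥-elim (ne refl)

bool-ext : ∀ {a b} → (a ≡ true → b ≡ true) → (b ≡ true → a ≡ true) → a ≡ b
bool-ext {true}  {b}     f g = sym (f refl)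
bool-ext {false} {true}  f g = g refl
bool-ext {false} {false} f g = refl

∧-true⁻ : ∀ {a b} → a ∧ b ≡ true → a ≡ true × b ≡ true
∧-true⁻ {true} {true} refl = refl , refl

∧-true⁺ : ∀ {a b} → a ≡ true → b ≡ true → a ∧ b ≡ true
∧-true⁺ refl refl = refl

∨-true⁻ : ∀ {a b} → a ∨ b ≡ true → a ≡ true ⊎ b ≡ true
∨-true⁻ {true}  e = inj₁ refl
∨-true⁻ {false} e = inj₂ e

∨-trueˡ : ∀ {a b} → a ≡ true → a ∨ b ≡ true
∨-trueˡ refl = refl

∨-trueʳ : ∀ {a b} → b ≡ true → a ∨ b ≡ true
∨-trueʳ {true}  e = refl
∨-trueʳ {false} e = e

not-true⁻ : ∀ {b} → not b ≡ true → b ≡ false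
not-true⁻ {false} e = refl

not-true⁺ : ∀ {b} → b ≡ false → not b ≡ true
not-true⁺ refl = refl

xor-false⇒≡ : ∀ {a b} → a xor b ≡ false → a ≡ b
xor-false⇒≡ {true}  {true}  e = refl
xor-false⇒≡ {false} {false} e = refl

xor-true⇒≢ : ∀ {a b} → a xor b ≡ true → a ≢ b
xor-true⇒≢ {true}  {false} e ()
xor-true⇒≢ {false} {true}  e ()

<ᵇ⁺ : ∀ {m n} → m < n → (m <ᵇ n) ≡ true
<ᵇ⁺ m<n = 𝔹.T-≡ .Equivalence.to (<⇒<ᵇ m<n)

<ᵇ⁻ : ∀ {m n} → (m <ᵇ n) ≡ true → m < n
<ᵇ⁻ {m} {n} e = <ᵇ⇒< m n (subst T (sym e) _)

≤ᵇ⁺ : ∀ {m n} → m ≤ n → (m ≤ᵇ n) ≡ true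
≤ᵇ⁺ m≤n = 𝔹.T-≡ .Equivalence.to (≤⇒≤ᵇ m≤n)

≤ᵇ⁻ : ∀ {m n} → (m ≤ᵇ n) ≡ true → m ≤ n
≤ᵇ⁻ {m} {n} e = ≤ᵇ⇒≤ m n (subst T (sym e) _)

==-refl : ∀ {n} (i : Fin n) → (i == i) ≡ true
==-refl i = dec-true (i ≟ i) refl

==⁻ : ∀ {n} (i j : Fin n) → (i == j) ≡ true → i ≡ j
==⁻ i j e with i ≟ j
... | yes p = p

==⁺ : ∀ {n} {i j : Fin n} → i ≡ j → (i == j) ≡ true
==⁺ {i = i} refl = ==-refl i

==-false : ∀ {n} (i j : Fin n) → i ≢ j → (i == j) ≡ false
==-false i j ne = dec-false (i ≟ j) ne

-- Finite quantifiers and counting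

ind : Bool → ℕ
ind b = if b then 1 else 0

foldr-allFin : ∀ {n} {B : Set} (f : Fin (suc n) → B → B) (e : B) →
               foldr f e (allFin (suc n)) ≡ f zero (foldr (λ i → f (suc i)) e (allFin n))
foldr-allFin {n} f e = cong (f zero) (trans
  (cong (foldr f e) (sym (LP.map-tabulate {n = n} id suc)))
  (LP.foldr-map f suc e (allFin n)))

countF≡sum : ∀ {n} (p : Fin n → Bool) → countF p ≡ sum (ind ∘ p)
countF≡sum {zero}  p = refl
countF≡sum {suc n} p = trans (foldr-allFin (λ i c → ind (p i) + c) 0)
                             (cong (ind (p zero) +_) (countF≡sum (p ∘ suc)))

allF⁻ : ∀ {n} (p : Fin n → Bool) → allF p ≡ true → ∀ i → p i ≡ true
allF⁻ {suc n} p e i with ∧-true⁻ {p zero} (trans (sym (foldr-allFin (λ i b → p i ∧ b) true)) e)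
allF⁻ {suc n} p e zero    | a , b = a
allF⁻ {suc n} p e (suc i) | a , b = allF⁻ (p ∘ suc) b i

allF⁺ : ∀ {n} (p : Fin n → Bool) → (∀ i → p i ≡ true) → allF p ≡ true
allF⁺ {zero}  p f = refl
allF⁺ {suc n} p f = trans (foldr-allFin (λ i b → p i ∧ b) true)
                          (∧-true⁺ (f zero) (allF⁺ (p ∘ suc) (f ∘ suc)))

anyF⁻ : ∀ {n} (p : Fin n → Bool) → anyF p ≡ true → ∃ λ i → p i ≡ true
anyF⁻ {suc n} p e with ∨-true⁻ {p zero} (trans (sym (foldr-allFin (λ i b → p i ∨ b) false)) e)
... | inj₁ a = zero , a
... | inj₂ b with anyF⁻ (p ∘ suc) b
...   | i , q = suc i , q

anyF⁺ : ∀ {n} (p : Fin n → Bool) i → p i ≡ true → anyF p ≡ true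
anyF⁺ {suc n} p i e = trans (foldr-allFin (λ i b → p i ∨ b) false) (helper i e)
  where
  helper : ∀ i → p i ≡ true → p zero ∨ anyF (p ∘ suc) ≡ true
  helper zero    e = ∨-trueˡ e
  helper (suc i) e = ∨-trueʳ (anyF⁺ (p ∘ suc) i e)

search : ∀ {n} (p : Fin n → Bool) → (∃ λ i → p i ≡ true) ⊎ (∀ i → p i ≡ false)
search p with bool-cases (anyF p)
... | inj₁ t = inj₁ (anyF⁻ p t)
... | inj₂ f = inj₂ λ i → ≢true⇒false λ q → clash (anyF⁺ p i q) f

allF-false : ∀ {n} (p : Fin n → Bool) → allF p ≡ false → ∃ λ i → p i ≡ false
allF-false p e with search (not ∘ p)
... | inj₁ (i , q) = i , not-true⁻ q
... | inj₂ none    = clash (allF⁺ p (λ i → ≢false⇒true λ q → clash (not-true⁺ q) (none i))) e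

countF-cong : ∀ {n} {p q : Fin n → Bool} → (∀ i → p i ≡ q i) → countF p ≡ countF q
countF-cong {p = p} {q} eq = trans (countF≡sum p)
  (trans (Σℕ.sum-cong-≗ (λ i → cong ind (eq i))) (sym (countF≡sum q)))

sum-mono : ∀ {n} {f g : Fin n → ℕ} → (∀ i → f i ≤ g i) → sum f ≤ sum g
sum-mono {zero}  le = z≤n
sum-mono {suc n} le = +-mono-≤ (le zero) (sum-mono (le ∘ suc))

ind-mono : ∀ {a b} → (a ≡ true → b ≡ true) → ind a ≤ ind b
ind-mono {false} f = z≤n
ind-mono {true} {b} f rewrite f refl = ≤-refl

countF-mono : ∀ {n} {p q : Fin n → Bool} → (∀ i → p i ≡ true → q i ≡ true) → countF p ≤ countF q
countF-mono {p = p} {q} sub = subst₂ _≤_ (sym (countF≡sum p)) (sym (countF≡sum q))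
  (sum-mono (λ i → ind-mono (sub i)))

countF-split : ∀ {n} (p q : Fin n → Bool) →
               countF p ≡ countF (λ i → p i ∧ q i) + countF (λ i → p i ∧ not (q i))
countF-split p q = trans (countF≡sum p) (trans (Σℕ.sum-cong-≗ (λ i → pt (p i) (q i)))
  (trans (Σℕ.∑-distrib-+ (λ i → ind (p i ∧ q i)) (λ i → ind (p i ∧ not (q i))))
         (sym (cong₂ _+_ (countF≡sum (λ i → p i ∧ q i)) (countF≡sum (λ i → p i ∧ not (q i)))))))
  where
  pt : ∀ a b → ind a ≡ ind (a ∧ b) + ind (a ∧ not b)
  pt true  true  = refl
  pt true  false = refl
  pt false b     = refl

countF-none : ∀ {n} {p : Fin n → Bool} → (∀ i → p i ≡ false) → countF p ≡ 0
countF-none {n} {p} none = trans (countF≡sum p)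
  (trans (Σℕ.sum-cong-≗ (λ i → cong ind (none i))) (Σℕ.sum-replicate-zero n))

countF-single : ∀ {n} (x : Fin n) → countF (x ==_) ≡ 1
countF-single {suc n} x = trans (countF≡sum (x ==_)) (trans (Σℕ.sum-remove {i = x} (ind ∘ (x ==_)))
  (cong₂ _+_ (cong ind (==-refl x)) (trans (Σℕ.sum-cong-≗ {n} (λ i → cong ind
    (==-false x _ (FP.punchInᵢ≢i x i ∘ sym)))) (Σℕ.sum-replicate-zero n))))

countF-drop : ∀ {n} {p q : Fin n → Bool} x → p x ≡ true → q x ≡ false →
              (∀ i → i ≢ x → p i ≡ q i) → countF p ≡ suc (countF q)
countF-drop {p = p} {q} x px qx agree = trans (countF-split p (x ==_))
  (cong₂ _+_ (trans (countF-cong at) (countF-single x)) (countF-cong off))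
  where
  at : ∀ i → p i ∧ (x == i) ≡ (x == i)
  at i with x ≟ i
  ... | yes refl = cong (_∧ true) px
  ... | no _     = 𝔹.∧-zeroʳ (p i)
  off : ∀ i → p i ∧ not (x == i) ≡ q i
  off i with x ≟ i
  ... | yes refl = trans (𝔹.∧-zeroʳ (p i)) (sym qx)
  ... | no ne    = trans (𝔹.∧-identityʳ (p i)) (agree i (ne ∘ sym))

countF-strict : ∀ {n} {p q : Fin n → Bool} x → p x ≡ false → q x ≡ true →
                (∀ i → p i ≡ true → q i ≡ true) → countF p < countF q
countF-strict {p = p} {q} x px qx sub = ≤-trans (s≤s (countF-mono below)) (≤-reflexive (sym drop))
  where
  q′ : _ → Bool
  q′ i = q i ∧ not (x == i)
  drop : countF q ≡ suc (countF q′)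
  drop = countF-drop x qx (trans (cong (λ b → q x ∧ not b) (==-refl x)) (𝔹.∧-zeroʳ (q x)))
    λ i ne → trans (sym (𝔹.∧-identityʳ (q i))) (cong (λ b → q i ∧ not b) (sym (==-false x i (ne ∘ sym))))
  below : ∀ i → p i ≡ true → q′ i ≡ true
  below i pi = ∧-true⁺ (sub i pi) (not-true⁺ (==-false x i λ { refl → clash pi px }))

countF-all : ∀ n → countF {n} (λ _ → true) ≡ n
countF-all zero    = refl
countF-all (suc n) = trans (foldr-allFin (λ (i : Fin (suc n)) c → 1 + c) 0) (cong suc (countF-all n))

countF≤n : ∀ {n} (p : Fin n → Bool) → countF p ≤ n
countF≤n {n} p = ≤-trans (countF-mono {p = p} {λ _ → true} (λ _ _ → refl)) (≤-reflexive (countF-all n))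

countF≡0⇒none : ∀ {n} {p : Fin n → Bool} → countF p ≡ 0 → ∀ i → p i ≡ false
countF≡0⇒none {p = p} e i = ≢true⇒false λ pi →
  case subst (1 ≤_) e (≤-trans (≤-reflexive (sym (countF-single i)))
    (countF-mono {p = i ==_} {p} λ j q → subst (λ k → p k ≡ true) (==⁻ i j q) pi)) of λ ()

countF-permute : ∀ {n} (π : Permutation′ n) (p : Fin n → Bool) → countF p ≡ countF (λ i → p (π ⟨$⟩ʳ i))
countF-permute π p = trans (countF≡sum p)
  (trans (Σℕ.sum-permute (ind ∘ p) π) (sym (countF≡sum (λ i → p (π ⟨$⟩ʳ i)))))

sum-ind-zero : ∀ {n} {p : Fin n → Bool} → (∀ i → p i ≡ false) → sum (ind ∘ p) ≡ 0
sum-ind-zero {n} {p} none = trans (sym (countF≡sum p)) (countF-none none)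

-- Both sides count the pairs `(h , i)` with `t i ≡ h` and `v h`; by injectivity each `h` in the
-- image occurs in a single pair.
countF-image : ∀ {m n} (t : Fin m → Fin n) → Injective _≡_ _≡_ t → (v : Fin n → Bool) →
               countF (λ h → anyF (λ i → t i == h) ∧ v h) ≡ countF (v ∘ t)
countF-image {m} {n} t inj v = begin
  countF (λ h → anyF (λ i → t i == h) ∧ v h)            ≡⟨ countF≡sum (λ h → anyF (λ i → t i == h) ∧ v h) ⟩
  sum (λ h → ind (anyF (λ i → t i == h) ∧ v h))         ≡⟨ Σℕ.sum-cong-≗ col ⟩
  sum (λ h → sum (λ i → ind ((t i == h) ∧ v h)))        ≡⟨ Σℕ.∑-comm (λ h i → ind ((t i == h) ∧ v h)) ⟩
  sum (λ i → sum (λ h → ind ((t i == h) ∧ v h)))        ≡⟨ Σℕ.sum-cong-≗ row ⟩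
  sum (λ i → ind (v (t i)))                             ≡⟨ countF≡sum (v ∘ t) ⟨
  countF (v ∘ t)                                        ∎
  where
  open ≡-Reasoning
  row : ∀ i → sum (λ h → ind ((t i == h) ∧ v h)) ≡ ind (v (t i))
  row i with bool-cases (v (t i))
  ... | inj₁ e = trans (Σℕ.sum-cong-≗ (λ h → cong ind (pt h)))
                   (trans (trans (sym (countF≡sum (t i ==_))) (countF-single (t i))) (sym (cong ind e)))
    where
    pt : ∀ h → (t i == h) ∧ v h ≡ (t i == h)
    pt h with t i ≟ h
    ... | yes refl = e
    ... | no _ = refl
  ... | inj₂ e = trans (sum-ind-zero pt) (sym (cong ind e))
    where
    pt : ∀ h → (t i == h) ∧ v h ≡ false
    pt h with t i ≟ h
    ... | yes refl = e
    ... | no _ = refl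
  col : ∀ h → ind (anyF (λ i → t i == h) ∧ v h) ≡ sum (λ i → ind ((t i == h) ∧ v h))
  col h with search (λ i → t i == h)
  ... | inj₂ none = trans (cong (λ b → ind (b ∧ v h)) (≢true⇒false λ a → let i , e = anyF⁻ (λ i → t i == h) a in clash e (none i)))
                     (sym (sum-ind-zero (λ i → cong (_∧ v h) (none i))))
  ... | inj₁ (i , e) with ==⁻ (t i) h e
  ...   | refl = trans (cong (λ b → ind (b ∧ v h)) (anyF⁺ (λ j → t j == t i) i e))
      (trans only (sym (trans (sym (countF≡sum (λ j → (t j == t i) ∧ v h)))
                              (countF-cong (λ j → cong (_∧ v h) (bool-ext
                                 (λ q → ==⁺ (sym (inj (==⁻ (t j) (t i) q)))) (λ q → ==⁺ (cong t (sym (==⁻ i j q))))))))))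
    where
    only : ind (v h) ≡ countF (λ j → (i == j) ∧ v h)
    only with v h
    ... | true  = sym (trans (countF-cong (λ j → 𝔹.∧-identityʳ (i == j))) (countF-single i))
    ... | false = sym (countF-none (λ j → 𝔹.∧-zeroʳ (i == j)))

anyBelow⁻ : ∀ k {p} → anyBelow k p ≡ true → ∃ λ i → i < k × p i ≡ true
anyBelow⁻ (suc k) {p} e with ∨-true⁻ {anyBelow k p} e
... | inj₁ a = let i , l , q = anyBelow⁻ k a in i , m<n⇒m<1+n l , q
... | inj₂ b = k , n<1+n k , b

anyBelow⁺ : ∀ k {p} i → i < k → p i ≡ true → anyBelow k p ≡ true
anyBelow⁺ (suc k) {p} i (s≤s i≤k) e with m≤n⇒m<n∨m≡n i≤k
... | inj₁ i<k  = ∨-trueˡ (anyBelow⁺ k i i<k e)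
... | inj₂ refl = ∨-trueʳ e

allBelow⁻ : ∀ k {p} → allBelow k p ≡ true → ∀ i → i < k → p i ≡ true
allBelow⁻ k {p} e i i<k = ≢false⇒true λ q → clash (anyBelow⁺ k i i<k (not-true⁺ q)) (not-true⁻ e)

allBelow⁺ : ∀ k {p} → (∀ i → i < k → p i ≡ true) → allBelow k p ≡ true
allBelow⁺ k {p} f = not-true⁺ (≢true⇒false λ e →
  let i , l , q = anyBelow⁻ k e in clash (f i l) (not-true⁻ q))

firstBelow-spec : ∀ k {p} i → i < k → p i ≡ true →
                  firstBelow k p ≤ i × p (firstBelow k p) ≡ true
firstBelow-spec (suc k) {p} i (s≤s i≤k) pi with anyBelow k p in eq
... | true = let j , j<k , pj = anyBelow⁻ k eq in case m≤n⇒m<n∨m≡n i≤k of λ where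
        (inj₁ i<k)  → firstBelow-spec k i i<k pi
        (inj₂ refl) → let le , q = firstBelow-spec k j j<k pj in ≤-trans le (<⇒≤ j<k) , q
... | false with m≤n⇒m<n∨m≡n i≤k
...   | inj₁ i<k  = clash (anyBelow⁺ k i i<k pi) eq
...   | inj₂ refl rewrite pi = ≤-refl , pi

least : ∀ (p : ℕ → Bool) k → p k ≡ true → ∃ λ i → i ≤ k × p i ≡ true × (∀ j → j < i → p j ≡ false)
least p k pk = firstBelow (suc k) p , proj₁ s , proj₂ s ,
    λ j j<i → ≢true⇒false λ pj → <⇒≱ j<i (proj₁ (firstBelow-spec (suc k) j (≤-trans j<i (≤-trans (proj₁ s) (n≤1+n k))) pj))
  where s = firstBelow-spec (suc k) {p} k (n<1+n k) pk

-- Iteration of injective self-maps of Fin n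

iter-+ : ∀ {A : Set} m k (f : A → A) x → iter (m + k) f x ≡ iter m f (iter k f x)
iter-+ zero    k f x = refl
iter-+ (suc m) k f x = cong f (iter-+ m k f x)

iter-suc : ∀ {A : Set} k (f : A → A) x → iter (suc k) f x ≡ iter k f (f x)
iter-suc k f x = trans (cong (λ j → iter j f x) (+-comm 1 k)) (iter-+ k 1 f x)

iter-injective : ∀ {A : Set} {f : A → A} → Injective _≡_ _≡_ f → ∀ k {x y} → iter k f x ≡ iter k f y → x ≡ y
iter-injective inj zero    e = e
iter-injective inj (suc k) e = iter-injective inj k (inj e)

module _ {n : ℕ} {f : Fin n → Fin n} (inj : Injective _≡_ _≡_ f) where

  period : ∀ x → ∃ λ p → p < n × iter (suc p) f x ≡ x
  period x with FP.pigeonhole {n} {suc n} (n<1+n n) (λ i → iter (toℕ i) f x)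
  ... | i , j , i<j , e = p , p<n , iter-injective inj (toℕ i)
        (trans (sym (iter-+ (toℕ i) (suc p) f x)) (trans (cong (λ k → iter k f x) i+p≡j) (sym e)))
    where
    p = toℕ j ∸ suc (toℕ i)
    i+p≡j : toℕ i + suc p ≡ toℕ j
    i+p≡j = trans (+-suc (toℕ i) p) (m+[n∸m]≡n i<j)
    p<n : p < n
    p<n = ≤-trans (m≤n+m (suc p) (toℕ i)) (≤-trans (≤-reflexive i+p≡j) (FP.toℕ≤pred[n] j))

  iter-period : ∀ {x p} → iter (suc p) f x ≡ x → ∀ q → iter (q * suc p) f x ≡ x
  iter-period         e zero    = refl
  iter-period {x} {p} e (suc q) = trans (iter-+ (suc p) (q * suc p) f x)
    (trans (cong (iter (suc p) f) (iter-period e q)) e)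

  iter-bound : ∀ x m {p} → iter (suc p) f x ≡ x → ∃ λ k → k ≤ p × iter k f x ≡ iter m f x
  iter-bound x m {p} e = m % suc p , ≤-pred (m%n<n m (suc p)) , sym (begin
    iter m f x                                          ≡⟨ cong (λ k → iter k f x) (m≡m%n+[m/n]*n m (suc p)) ⟩
    iter (m % suc p + m / suc p * suc p) f x            ≡⟨ iter-+ (m % suc p) _ f x ⟩
    iter (m % suc p) f (iter (m / suc p * suc p) f x)   ≡⟨ cong (iter (m % suc p) f) (iter-period e (m / suc p)) ⟩
    iter (m % suc p) f x                                ∎)
    where open ≡-Reasoning

  iter-<n : ∀ x m → ∃ λ k → k < n × iter k f x ≡ iter m f x
  iter-<n x m = let p , p<n , e = period x
                    k , k≤p , q = iter-bound x m e
                in k , ≤-<-trans k≤p p<n , q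

  iter-back : ∀ x m → ∃ λ k → iter k f (iter m f x) ≡ x
  iter-back x m = let p , _ , e = period x in
    m * p , trans (sym (iter-+ (m * p) m f x))
      (trans (cong (λ k → iter k f x) (trans (+-comm (m * p) m) (sym (*-suc m p)))) (iter-period e m))

  -- If `x` returned after `k + 1 < n` steps, its first `k + 1` iterates would already exhaust
  -- `Fin n`, against the pigeonhole principle. This makes positions in a tour well defined.
  full-period : ∀ {x} → (∀ y → ∃ λ m → iter m f x ≡ y) → ∀ k → suc k < n → iter (suc k) f x ≢ x
  full-period {x} full k k<n e =
    let i , j , i<j , q = FP.pigeonhole {suc k} {n} k<n code in
    FP.<⇒≢ i<j (trans (sym (hits i)) (trans (cong (λ c → iter (toℕ c) f x) q) (hits j)))
    where
    small : ∀ y → ∃ λ m → m ≤ k × iter m f x ≡ y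
    small y = let m , em = full y
                  m′ , le , e′ = iter-bound x m e
              in m′ , le , trans e′ em
    code : Fin n → Fin (suc k)
    code y = F.fromℕ< (s≤s (proj₁ (proj₂ (small y))))
    hits : ∀ y → iter (toℕ (code y)) f x ≡ y
    hits y = trans (cong (λ c → iter c f x) (FP.toℕ-fromℕ< (s≤s (proj₁ (proj₂ (small y)))))) (proj₂ (proj₂ (small y)))

-- Lexicographic comparison through binary numbers

bin : (ℕ → Bool) → ℕ → ℕ
bin b zero    = 0
bin b (suc k) = ind (b k) + 2 * bin b k

bin-cong : ∀ {b c} k → (∀ j → j < k → b j ≡ c j) → bin b k ≡ bin c k
bin-cong zero    eq = refl
bin-cong (suc k) eq = cong₂ (λ x y → ind x + 2 * y) (eq k (n<1+n k)) (bin-cong k (λ j l → eq j (m<n⇒m<1+n l)))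

ind≤1 : ∀ b → ind b ≤ 1
ind≤1 true  = ≤-refl
ind≤1 false = z≤n

-- Later entries are less significant digits, so the first difference outweighs everything after it.
bin-lex : ∀ {b c} n k → k < n → (∀ j → j < k → b j ≡ c j) → b k ≡ false → c k ≡ true → bin b n < bin c n
bin-lex {b} {c} (suc n) k (s≤s k≤n) eq bk ck with m≤n⇒m<n∨m≡n k≤n
... | inj₂ refl rewrite bk | ck | bin-cong {b} {c} n eq = ≤-refl
... | inj₁ k<n = begin
    suc (ind (b n) + 2 * bin b n)  ≤⟨ s≤s (+-monoˡ-≤ (2 * bin b n) (ind≤1 (b n))) ⟩
    2 + 2 * bin b n                ≡⟨ *-suc 2 (bin b n) ⟨
    2 * suc (bin b n)              ≤⟨ *-monoʳ-≤ 2 (bin-lex n k k<n eq bk ck) ⟩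
    2 * bin c n                    ≤⟨ m≤n+m (2 * bin c n) (ind (c n)) ⟩
    ind (c n) + 2 * bin c n        ∎
    where open ≤-Reasoning

bin< : ∀ b k → bin b k < 2 ^ k
bin< b zero    = ≤-refl
bin< b (suc k) = begin
    suc (ind (b k) + 2 * bin b k)  ≤⟨ s≤s (+-monoˡ-≤ (2 * bin b k) (ind≤1 (b k))) ⟩
    2 + 2 * bin b k                ≡⟨ *-suc 2 (bin b k) ⟨
    2 * suc (bin b k)              ≤⟨ *-monoʳ-≤ 2 (bin< b k) ⟩
    2 ^ suc k                      ∎
    where open ≤-Reasoning

vec-ext : ∀ {A : Set} {n} {u v : Vec A n} → (∀ i → lookup u i ≡ lookup v i) → u ≡ v
vec-ext {u = u} {v} eq = trans (sym (VP.tabulate∘lookup u)) (trans (VP.tabulate-cong eq) (VP.tabulate∘lookup v))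

-- Reachability and vertex sets

module Reachability (M : RootedMap) where
  open RootedMap M public renaming (σ to σᴾ; α to αᴾ)

  σ σ⁻¹ α : Fin n → Fin n
  σ  = σ· M
  σ⁻¹ = σ⁻ M
  α  = α· M

  σσ⁻ : ∀ h → σ (σ⁻¹ h) ≡ h
  σσ⁻ h = Perm.inverseʳ σᴾ

  σ⁻σ : ∀ h → σ⁻¹ (σ h) ≡ h
  σ⁻σ h = Perm.inverseˡ σᴾ

  σ-injective : Injective _≡_ _≡_ σ
  σ-injective {x} {y} e = trans (sym (σ⁻σ x)) (trans (cong σ⁻¹ e) (σ⁻σ y))

  αα : ∀ h → α (α h) ≡ h
  αα = α-invol

  α-injective : Injective _≡_ _≡_ α
  α-injective {x} {y} e = trans (sym (αα x)) (trans (cong α e) (αα y))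

  α-swap : ∀ {x y} → α x ≡ y → x ≡ α y
  α-swap {x} e = trans (sym (αα x)) (cong α e)

  HalfEdges : Set
  HalfEdges = Fin n → Bool

  -- A half-edge stands for its vertex, within which σ moves freely; `m` holds the half-edges from
  -- which their edge may be crossed. With a subgraph for `m` this is connectivity, with the tails
  -- of an orientation it is directed reachability.
  data Reaches (m : HalfEdges) (x : Fin n) : Fin n → Set where
    here  : Reaches m x x
    fwd   : ∀ {y} → Reaches m x y → Reaches m x (σ y)
    bwd   : ∀ {y} → Reaches m x y → Reaches m x (σ⁻¹ y)
    cross : ∀ {y} → m y ≡ true → Reaches m x y → Reaches m x (α y)

  reaches-trans : ∀ {m x y z} → Reaches m x y → Reaches m y z → Reaches m x z
  reaches-trans r here        = r
  reaches-trans r (fwd s)     = fwd (reaches-trans r s)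
  reaches-trans r (bwd s)     = bwd (reaches-trans r s)
  reaches-trans r (cross e s) = cross e (reaches-trans r s)

  reaches-mono : ∀ {m m′ x y} → (∀ z → m z ≡ true → m′ z ≡ true) → Reaches m x y → Reaches m′ x y
  reaches-mono f here        = here
  reaches-mono f (fwd r)     = fwd (reaches-mono f r)
  reaches-mono f (bwd r)     = bwd (reaches-mono f r)
  reaches-mono f (cross e r) = cross (f _ e) (reaches-mono f r)

  -- Sets of vertices are encoded as σ-invariant sets of half-edges.
  VertexSet : HalfEdges → Set
  VertexSet X = ∀ h → X (σ h) ≡ X h

  compl : HalfEdges → HalfEdges
  compl X h = not (X h)

  compl-VertexSet : ∀ {X} → VertexSet X → VertexSet (compl X)
  compl-VertexSet v h = cong not (v h)

  vset-σ⁻ : ∀ {X} → VertexSet X → ∀ h → X (σ⁻¹ h) ≡ X h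
  vset-σ⁻ {X} v h = trans (sym (v (σ⁻¹ h))) (cong X (σσ⁻ h))

  ClosedUnder : HalfEdges → HalfEdges → Set
  ClosedUnder m X = ∀ h → X h ≡ true → m h ≡ true → X (α h) ≡ true

  -- A walk from inside a vertex set to its outside splits at a border edge; this is the main use
  -- made of walks.
  exit : ∀ {m x y X} → VertexSet X → Reaches m x y → X x ≡ true → X y ≡ false →
         ∃ λ z → m z ≡ true × X z ≡ true × X (α z) ≡ false × Reaches m x z × Reaches m (α z) y
  exit vX here ex ey = clash ex ey
  exit {X = X} vX (fwd {y} r) ex ey =
    let z , mz , a , b , r₁ , r₂ = exit vX r ex (trans (sym (vX y)) ey) in z , mz , a , b , r₁ , fwd r₂
  exit {X = X} vX (bwd {y} r) ex ey =
    let z , mz , a , b , r₁ , r₂ = exit vX r ex (trans (sym (vset-σ⁻ vX y)) ey) in z , mz , a , b , r₁ , bwd r₂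
  exit {X = X} vX (cross {y} e r) ex ey with bool-cases (X y)
  ... | inj₁ t = y , e , t , ey , r , here
  ... | inj₂ f = let z , mz , a , b , r₁ , r₂ = exit vX r ex f in z , mz , a , b , r₁ , cross e r₂

  closed-reaches : ∀ {m x y X} → VertexSet X → ClosedUnder m X → Reaches m x y → X x ≡ true → X y ≡ true
  closed-reaches vX cl r ex = ≢false⇒true λ ey →
    let z , mz , a , b , _ = exit vX r ex ey in clash (cl z a mz) b

  closeStep⁻ : ∀ m (R : HSet M) h → lookup (closeStep M m R) h ≡ true →
               lookup R h ≡ true ⊎ lookup R (σ⁻¹ h) ≡ true ⊎ lookup R (σ h) ≡ true
               ⊎ (lookup R (α h) ≡ true × m (α h) ≡ true)
  closeStep⁻ m R h e with ∨-true⁻ {lookup R h} (trans (sym (VP.lookup∘tabulate _ h)) e)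
  ... | inj₁ a = inj₁ a
  ... | inj₂ e with ∨-true⁻ {lookup R (σ⁻¹ h)} e
  ...   | inj₁ a = inj₂ (inj₁ a)
  ...   | inj₂ e with ∨-true⁻ {lookup R (σ h)} e
  ...     | inj₁ a = inj₂ (inj₂ (inj₁ a))
  ...     | inj₂ e = inj₂ (inj₂ (inj₂ (∧-true⁻ e)))

  module _ (m : HalfEdges) where
    private
      stepB : HSet M → HalfEdges
      stepB R h = lookup R h ∨ lookup R (σ⁻¹ h) ∨ lookup R (σ h) ∨ (lookup R (α h) ∧ m (α h))

      step-eq : ∀ R h → lookup (closeStep M m R) h ≡ stepB R h
      step-eq R h = VP.lookup∘tabulate (stepB R) h

      step-inc : ∀ R h → lookup R h ≡ true → lookup (closeStep M m R) h ≡ true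
      step-inc R h e = trans (step-eq R h) (∨-trueˡ e)

      grows : ∀ R → closeStep M m R ≡ R ⊎ countF (lookup R) < countF (lookup (closeStep M m R))
      grows R with search (λ h → lookup (closeStep M m R) h ∧ not (lookup R h))
      ... | inj₁ (h , e) = let new , old = ∧-true⁻ e in
                           inj₂ (countF-strict h (not-true⁻ old) new (step-inc R))
      ... | inj₂ none    = inj₁ (vec-ext λ h → bool-ext
              (λ e → ≢false⇒true λ f → clash (∧-true⁺ e (not-true⁺ f)) (none h)) (step-inc R h))

      stage : Fin n → ℕ → HSet M
      stage x k = iter k (closeStep M m) (singleton M x)

      -- Until it is stable, the closure gains at least one half-edge per stage, so the `n` stages
      -- of `reachSet` end in a fixed point.
      stable-or-large : ∀ x k → closeStep M m (stage x k) ≡ stage x k ⊎ k < countF (lookup (stage x k))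
      stable-or-large x zero = inj₂ (≤-reflexive (sym (trans
        (countF-cong {p = lookup (singleton M x)} {x ==_} (VP.lookup∘tabulate (x ==_))) (countF-single x))))
      stable-or-large x (suc k) with stable-or-large x k
      ... | inj₁ st = inj₁ (cong (closeStep M m) st)
      ... | inj₂ k< with grows (stage x k)
      ...   | inj₁ st = inj₁ (cong (closeStep M m) st)
      ...   | inj₂ lt = inj₂ (≤-<-trans k< lt)

    reachSet-stable : ∀ x → closeStep M m (reachSet M m x) ≡ reachSet M m x
    reachSet-stable x with stable-or-large x n
    ... | inj₁ st = st
    ... | inj₂ n< = ⊥-elim (<⇒≱ n< (countF≤n (lookup (reachSet M m x))))

    private
      absorb : ∀ x h → stepB (reachSet M m x) h ≡ true → lookup (reachSet M m x) h ≡ true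
      absorb x h e = trans (cong (λ R → lookup R h) (sym (reachSet-stable x))) (trans (step-eq (reachSet M m x) h) e)

    reachSet-vertexSet : ∀ x → VertexSet (lookup (reachSet M m x))
    reachSet-vertexSet x h = bool-ext
      (λ e → absorb x h (∨-trueʳ {lookup R h} (∨-trueʳ {lookup R (σ⁻¹ h)} (∨-trueˡ e))))
      (λ e → absorb x (σ h) (∨-trueʳ {lookup R (σ h)} (∨-trueˡ (trans (cong (lookup R) (σ⁻σ h)) e))))
      where R = reachSet M m x

    reachSet-closed : ∀ x → ClosedUnder m (lookup (reachSet M m x))
    reachSet-closed x h e mh = absorb x (α h) (∨-trueʳ {lookup R (α h)} (∨-trueʳ {lookup R (σ⁻¹ (α h))} (∨-trueʳ {lookup R (σ (α h))}
      (∧-true⁺ (trans (cong (lookup R) (αα h)) e) (trans (cong m (αα h)) mh)))))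
      where R = reachSet M m x

    reachSet-start : ∀ x → lookup (reachSet M m x) x ≡ true
    reachSet-start x = grow n
      where
      grow : ∀ k → lookup (stage x k) x ≡ true
      grow zero    = trans (VP.lookup∘tabulate (x ==_) x) (==-refl x)
      grow (suc k) = step-inc (stage x k) x (grow k)

    reachSet⁺ : ∀ {x y} → Reaches m x y → lookup (reachSet M m x) y ≡ true
    reachSet⁺ {x} r = closed-reaches (reachSet-vertexSet x) (reachSet-closed x) r (reachSet-start x)

    reachSet⁻ : ∀ x y → lookup (reachSet M m x) y ≡ true → Reaches m x y
    reachSet⁻ x = sound n
      where
      sound : ∀ k y → lookup (stage x k) y ≡ true → Reaches m x y
      sound zero y e with ==⁻ x y (trans (sym (VP.lookup∘tabulate (x ==_) y)) e)
      ... | refl = here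
      sound (suc k) y e with closeStep⁻ m (stage x k) y e
      ... | inj₁ a = sound k y a
      ... | inj₂ (inj₁ a) = subst (Reaches m x) (σσ⁻ y) (fwd (sound k (σ⁻¹ y) a))
      ... | inj₂ (inj₂ (inj₁ a)) = subst (Reaches m x) (σ⁻σ y) (bwd (sound k (σ y) a))
      ... | inj₂ (inj₂ (inj₂ (a , b))) = subst (Reaches m x) (αα y) (cross b (sound k (α y) a))

    reaches? : ∀ x y → Dec (Reaches m x y)
    reaches? x y with bool-cases (lookup (reachSet M m x) y)
    ... | inj₁ t = yes (reachSet⁻ x y t)
    ... | inj₂ f = no λ r → clash (reachSet⁺ r) f

  sameV⁻ : ∀ x y → sameV M x y ≡ true → ∃ λ k → iter k σ x ≡ y
  sameV⁻ x y e = let k , _ , q = anyBelow⁻ n e in k , ==⁻ (iter k σ x) y q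

  sameV⁺ : ∀ {x y} k → iter k σ x ≡ y → sameV M x y ≡ true
  sameV⁺ {x} k e = let j , j<n , q = iter-<n σ-injective x k in anyBelow⁺ n j j<n (==⁺ (trans q e))

  sameV-refl : ∀ x → sameV M x x ≡ true
  sameV-refl x = sameV⁺ 0 refl

  sameV-sym : ∀ x y → sameV M x y ≡ true → sameV M y x ≡ true
  sameV-sym x y e with sameV⁻ x y e
  ... | k , refl = let j , q = iter-back σ-injective x k in sameV⁺ j q

  sameV-trans : ∀ x y z → sameV M x y ≡ true → sameV M y z ≡ true → sameV M x z ≡ true
  sameV-trans x y z e f with sameV⁻ x y e | sameV⁻ y z f
  ... | k , refl | j , refl = sameV⁺ (j + k) (iter-+ j k σ x)

  sameV-vertexSet : ∀ x → VertexSet (sameV M x)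
  sameV-vertexSet x h = bool-ext (λ e → sameV-trans x (σ h) h e (sameV-sym h (σ h) (sameV⁺ 1 refl)))
                                 (λ e → sameV-trans x h (σ h) e (sameV⁺ 1 refl))

  vset-sameV : ∀ {X} → VertexSet X → ∀ x y → sameV M x y ≡ true → X x ≡ X y
  vset-sameV {X} vX x y e with sameV⁻ x y e
  ... | k , refl = go k
    where
    go : ∀ k → X x ≡ X (iter k σ x)
    go zero    = refl
    go (suc k) = trans (go k) (sym (vX (iter k σ x)))

  sameV-reaches : ∀ {m} x y → sameV M x y ≡ true → Reaches m x y
  sameV-reaches {m} x y e with sameV⁻ x y e
  ... | k , refl = go k
    where
    go : ∀ k → Reaches m x (iter k σ x)
    go zero    = here
    go (suc k) = fwd (go k)

-- Subgraphs: single edges, components, forests and exchanges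

leastF : ∀ {n} (p : Fin n → Bool) x → p x ≡ true →
         ∃ λ i → p i ≡ true × (∀ j → p j ≡ true → toℕ i ≤ toℕ j)
leastF {suc n} p x px with bool-cases (p zero)
... | inj₁ t = zero , t , λ _ _ → z≤n
leastF {suc n} p zero    px | inj₂ f = clash px f
leastF {suc n} p (suc x) px | inj₂ f = let i , pi , min = leastF (p ∘ suc) x px in
  suc i , pi , λ { zero q → clash q f ; (suc j) q → s≤s (min j q) }

countF-two : ∀ {n} {p : Fin n → Bool} x y → x ≢ y → p x ≡ true → p y ≡ true → 2 ≤ countF p
countF-two {p = p} x y ne px py = ≤-<-trans
  (≤-trans (≤-reflexive (sym (countF-single x))) (countF-mono {q = x ==_} λ _ q → q))
  (countF-strict {p = x ==_} y (==-false x y ne) py λ i q → subst (λ j → p j ≡ true) (==⁻ x i q) px)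

countF-one : ∀ {n} {p : Fin n → Bool} x → p x ≡ true → (∀ y → p y ≡ true → x ≡ y) → countF p ≡ 1
countF-one {p = p} x px only = trans (countF-cong {q = x ==_} λ i → bool-ext
  (λ pi → ==⁺ (only i pi)) (λ q → subst (λ j → p j ≡ true) (==⁻ x i q) px)) (countF-single x)

module Subgraphs (M : RootedMap) where
  open Reachability M public

  _∈ₕ_ _∉ₕ_ : Fin n → HSet M → Set
  x ∈ₕ S = lookup S x ≡ true
  x ∉ₕ S = lookup S x ≡ false

  _⊆ₕ_ : HSet M → HSet M → Set
  S ⊆ₕ S′ = ∀ x → x ∈ₕ S → x ∈ₕ S′

  onEdge : Fin n → Fin n → Bool
  onEdge e x = (e == x) ∨ (α e == x)

  onEdge⁻ : ∀ e x → onEdge e x ≡ true → x ≡ e ⊎ x ≡ α e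
  onEdge⁻ e x q with ∨-true⁻ {e == x} q
  ... | inj₁ a = inj₁ (sym (==⁻ e x a))
  ... | inj₂ b = inj₂ (sym (==⁻ (α e) x b))

  onEdge⁺ : ∀ e x → x ≡ e ⊎ x ≡ α e → onEdge e x ≡ true
  onEdge⁺ e x (inj₁ refl) = ∨-trueˡ (==-refl e)
  onEdge⁺ e x (inj₂ refl) = ∨-trueʳ {e == α e} (==-refl (α e))

  onEdge-self : ∀ e → onEdge e e ≡ true
  onEdge-self e = onEdge⁺ e e (inj₁ refl)

  onEdge-swap : ∀ e x → x ≡ e ⊎ x ≡ α e → α x ≡ e ⊎ α x ≡ α e
  onEdge-swap e x (inj₁ refl) = inj₂ refl
  onEdge-swap e x (inj₂ refl) = inj₁ (αα e)

  onEdge-α : ∀ e x → onEdge e (α x) ≡ onEdge e x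
  onEdge-α e x = bool-ext
    (λ q → subst (λ y → onEdge e y ≡ true) (αα x) (onEdge⁺ e _ (onEdge-swap e (α x) (onEdge⁻ e (α x) q))))
    (λ q → onEdge⁺ e _ (onEdge-swap e x (onEdge⁻ e x q)))

  onEdge-sym : ∀ e f → onEdge e f ≡ true → onEdge f e ≡ true
  onEdge-sym e f q with onEdge⁻ e f q
  ... | inj₁ refl = onEdge-self e
  ... | inj₂ refl = onEdge⁺ (α e) e (inj₂ (sym (αα e)))

  lookup-set : ∀ (S : HSet M) e b x → lookup ((S [ e ]≔ b) [ α e ]≔ b) x ≡ (if onEdge e x then b else lookup S x)
  lookup-set S e b x with e ≟ x | α e ≟ x
  ... | yes refl | _        = trans (VP.lookup∘update′ (α-fpf e ∘ sym) (S [ e ]≔ b) b) (VP.lookup∘update e S b)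
  ... | no _     | yes refl = VP.lookup∘update (α e) (S [ e ]≔ b) b
  ... | no p     | no q     = trans (VP.lookup∘update′ (q ∘ sym) (S [ e ]≔ b) b) (VP.lookup∘update′ (p ∘ sym) S b)

  lookup-add : ∀ S e x → lookup (addEdge M S e) x ≡ onEdge e x ∨ lookup S x
  lookup-add S e x = trans (lookup-set S e true x) (if-∨ (onEdge e x))
    where
    if-∨ : ∀ b → (if b then true else lookup S x) ≡ b ∨ lookup S x
    if-∨ true  = refl
    if-∨ false = refl

  lookup-remove : ∀ S e x → lookup (removeEdge M S e) x ≡ not (onEdge e x) ∧ lookup S x
  lookup-remove S e x = trans (lookup-set S e false x) (if-∧ (onEdge e x))
    where
    if-∧ : ∀ b → (if b then false else lookup S x) ≡ not b ∧ lookup S x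
    if-∧ true  = refl
    if-∧ false = refl

  ∈-remove⁻ : ∀ S e x → x ∈ₕ removeEdge M S e → onEdge e x ≡ false × x ∈ₕ S
  ∈-remove⁻ S e x q = let a , b = ∧-true⁻ (trans (sym (lookup-remove S e x)) q) in not-true⁻ a , b

  remove-∉ : ∀ S e → e ∉ₕ removeEdge M S e
  remove-∉ S e = ≢true⇒false λ q → clash (onEdge-self e) (proj₁ (∈-remove⁻ S e e q))

  ∈-remove⁺ : ∀ S e x → onEdge e x ≡ false → x ∈ₕ S → x ∈ₕ removeEdge M S e
  ∈-remove⁺ S e x a b = trans (lookup-remove S e x) (∧-true⁺ (not-true⁺ a) b)

  ∈-add⁻ : ∀ S e x → x ∈ₕ addEdge M S e → onEdge e x ≡ true ⊎ x ∈ₕ S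
  ∈-add⁻ S e x q = ∨-true⁻ (trans (sym (lookup-add S e x)) q)

  ∈-add-self : ∀ S e x → onEdge e x ≡ true → x ∈ₕ addEdge M S e
  ∈-add-self S e x q = trans (lookup-add S e x) (∨-trueˡ q)

  ∈-add-old : ∀ S e x → x ∈ₕ S → x ∈ₕ addEdge M S e
  ∈-add-old S e x q = trans (lookup-add S e x) (∨-trueʳ {onEdge e x} q)

  remove-subgraph : ∀ {S} e → IsSubgraph M S → IsSubgraph M (removeEdge M S e)
  remove-subgraph {S} e sub h = trans (lookup-remove S e h)
    (trans (cong₂ (λ a b → not a ∧ b) (sym (onEdge-α e h)) (sub h)) (sym (lookup-remove S e (α h))))

  add-subgraph : ∀ {S} e → IsSubgraph M S → IsSubgraph M (addEdge M S e)
  add-subgraph {S} e sub h = trans (lookup-add S e h)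
    (trans (cong₂ _∨_ (sym (onEdge-α e h)) (sub h)) (sym (lookup-add S e (α h))))

  onEdge-∈ : ∀ {S e x} → IsSubgraph M S → onEdge e x ≡ true → lookup S x ≡ lookup S e
  onEdge-∈ {S} {e} {x} sub q with onEdge⁻ e x q
  ... | inj₁ refl = refl
  ... | inj₂ refl = sym (sub e)

  add-remove : ∀ {S e} → IsSubgraph M S → e ∈ₕ S → addEdge M (removeEdge M S e) e ≡ S
  add-remove {S} {e} sub eS = vec-ext λ x → trans (lookup-add (removeEdge M S e) e x)
    (trans (cong (onEdge e x ∨_) (lookup-remove S e x)) (pt x))
    where
    pt : ∀ x → onEdge e x ∨ (not (onEdge e x) ∧ lookup S x) ≡ lookup S x
    pt x with onEdge e x in q
    ... | true  = sym (trans (onEdge-∈ {S} sub q) eS)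
    ... | false = refl

  remove-add : ∀ {S e} → IsSubgraph M S → e ∉ₕ S → removeEdge M (addEdge M S e) e ≡ S
  remove-add {S} {e} sub eS = vec-ext λ x → trans (lookup-remove (addEdge M S e) e x)
    (trans (cong (not (onEdge e x) ∧_) (lookup-add S e x)) (pt x))
    where
    pt : ∀ x → not (onEdge e x) ∧ (onEdge e x ∨ lookup S x) ≡ lookup S x
    pt x with onEdge e x in q
    ... | true  = sym (trans (onEdge-∈ {S} sub q) eS)
    ... | false = refl

  add-comm-α : ∀ S e → addEdge M S (α e) ≡ addEdge M S e
  add-comm-α S e = vec-ext λ x → trans (lookup-add S (α e) x)
    (trans (cong (_∨ lookup S x) (trans (cong (λ y → (α e == x) ∨ (y == x)) (αα e)) (𝔹.∨-comm (α e == x) (e == x))))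
           (sym (lookup-add S e x)))

  -- Connectivity

  Conn : HSet M → Fin n → Fin n → Set
  Conn S = Reaches (lookup S)

  conn-sym : ∀ S → IsSubgraph M S → ∀ {x y} → Conn S x y → Conn S y x
  conn-sym S sub here = here
  conn-sym S sub (fwd {y} r) = reaches-trans (subst (Conn S (σ y)) (σ⁻σ y) (bwd here)) (conn-sym S sub r)
  conn-sym S sub (bwd {y} r) = reaches-trans (subst (Conn S (σ⁻¹ y)) (σσ⁻ y) (fwd here)) (conn-sym S sub r)
  conn-sym S sub (cross {y} e r) = reaches-trans
    (subst (Conn S (α y)) (αα y) (cross (trans (sym (sub y)) e) here)) (conn-sym S sub r)

  -- At most one crossing of the new edge has to be recorded: a further one in the same direction
  -- makes everything since the first a detour, and one in the opposite direction returns to where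
  -- the first part stopped.
  reaches-split : ∀ {m m′ e} → (∀ z → m′ z ≡ true → m z ≡ true ⊎ z ≡ e ⊎ z ≡ α e) → ∀ {a b} →
                  Reaches m′ a b → Reaches m a b ⊎ (Reaches m a e × Reaches m (α e) b)
                                   ⊎ (Reaches m a (α e) × Reaches m e b)
  reaches-split f here = inj₁ here
  reaches-split f (fwd r) with reaches-split f r
  ... | inj₁ q = inj₁ (fwd q)
  ... | inj₂ (inj₁ (q , s)) = inj₂ (inj₁ (q , fwd s))
  ... | inj₂ (inj₂ (q , s)) = inj₂ (inj₂ (q , fwd s))
  reaches-split f (bwd r) with reaches-split f r
  ... | inj₁ q = inj₁ (bwd q)
  ... | inj₂ (inj₁ (q , s)) = inj₂ (inj₁ (q , bwd s))
  ... | inj₂ (inj₂ (q , s)) = inj₂ (inj₂ (q , bwd s))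
  reaches-split {m} {m′} {e} f {a} (cross {y} my r) with reaches-split f r | f y my
  ... | inj₁ q | inj₁ z = inj₁ (cross z q)
  ... | inj₂ (inj₁ (q , s)) | inj₁ z = inj₂ (inj₁ (q , cross z s))
  ... | inj₂ (inj₂ (q , s)) | inj₁ z = inj₂ (inj₂ (q , cross z s))
  ... | inj₁ q | inj₂ (inj₁ refl) = inj₂ (inj₁ (q , here))
  ... | inj₂ (inj₁ (q , s)) | inj₂ (inj₁ refl) = inj₂ (inj₁ (q , here))
  ... | inj₂ (inj₂ (q , s)) | inj₂ (inj₁ refl) = inj₁ q
  ... | inj₁ q | inj₂ (inj₂ refl) = inj₂ (inj₂ (q , subst (Reaches m e) (sym (αα e)) here))
  ... | inj₂ (inj₁ (q , s)) | inj₂ (inj₂ refl) = inj₁ (subst (Reaches m a) (sym (αα e)) q)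
  ... | inj₂ (inj₂ (q , s)) | inj₂ (inj₂ refl) = inj₂ (inj₂ (q , subst (Reaches m e) (sym (αα e)) here))

  conn-add : ∀ {S e a b} → Conn (addEdge M S e) a b →
             Conn S a b ⊎ (Conn S a e × Conn S (α e) b) ⊎ (Conn S a (α e) × Conn S e b)
  conn-add {S} {e} = reaches-split λ z q → [ inj₂ ∘ onEdge⁻ e z , inj₁ ]′ (∈-add⁻ S e z q)

  conn-new : ∀ S e → Conn (addEdge M S e) e (α e)
  conn-new S e = cross (∈-add-self S e e (onEdge-self e)) here

  conn-add-absorb : ∀ {S e} → IsSubgraph M S → Conn S e (α e) → ∀ {a b} → Conn (addEdge M S e) a b → Conn S a b
  conn-add-absorb {S} {e} sub c r with conn-add {S} {e} r
  ... | inj₁ q = q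
  ... | inj₂ (inj₁ (q , s)) = reaches-trans q (reaches-trans c s)
  ... | inj₂ (inj₂ (q , s)) = reaches-trans q (reaches-trans (conn-sym S sub c) s)

  conn⁺ : ∀ S {x y} → Conn S x y → conn M S x y ≡ true
  conn⁺ S = reachSet⁺ (lookup S)

  conn⁻ : ∀ S x y → conn M S x y ≡ true → Conn S x y
  conn⁻ S = reachSet⁻ (lookup S)

  -- Forests and spanning trees

  Forest : HSet M → Set
  Forest S = ∀ h → h ∈ₕ S → ¬ Conn (removeEdge M S h) h (α h)

  Connected : HSet M → Set
  Connected S = ∀ x y → Conn S x y

  private
    forest-test : HSet M → Fin n → Bool
    forest-test S h = not (lookup S h) ∨ not (conn M (removeEdge M S h) h (α h))

  forestB⁻ : ∀ S → forestB M S ≡ true → Forest S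
  forestB⁻ S e h hS c with ∨-true⁻ {not (lookup S h)} (allF⁻ (forest-test S) e h)
  ... | inj₁ a = clash hS (not-true⁻ a)
  ... | inj₂ b = clash (conn⁺ (removeEdge M S h) c) (not-true⁻ b)

  forestB⁺ : ∀ S → Forest S → forestB M S ≡ true
  forestB⁺ S F = allF⁺ (forest-test S) λ h → ≢false⇒true λ e → case bool-cases (lookup S h) of λ where
    (inj₂ f) → clash (∨-trueˡ (not-true⁺ f)) e
    (inj₁ t) → clash (∨-trueʳ {not (lookup S h)} (not-true⁺ (≢true⇒false (F h t ∘ conn⁻ (removeEdge M S h) h (α h))))) e

  forestB-false : ∀ S → forestB M S ≡ false → ∃ λ h → h ∈ₕ S × Conn (removeEdge M S h) h (α h)
  forestB-false S e with allF-false (forest-test S) e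
  ... | h , q = h , ≢false⇒true (λ f → clash (∨-trueˡ (not-true⁺ f)) q)
                  , conn⁻ (removeEdge M S h) h (α h) (≢false⇒true λ f → clash (∨-trueʳ {not (lookup S h)} (not-true⁺ f)) q)

  connectedB⁻ : ∀ S → connectedB M S ≡ true → Connected S
  connectedB⁻ S e x y = conn⁻ S x y (allF⁻ (conn M S x) (allF⁻ (λ h → allF (conn M S h)) e x) y)

  connectedB⁺ : ∀ S → Connected S → connectedB M S ≡ true
  connectedB⁺ S c = allF⁺ (λ h → allF (conn M S h)) λ x → allF⁺ (conn M S x) λ y → conn⁺ S (c x y)

  connectedB-false : ∀ S → connectedB M S ≡ false → ∃ λ x → ∃ λ y → ¬ Conn S x y
  connectedB-false S e =
    let x , ex = allF-false (λ h → allF (conn M S h)) e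
        y , ey = allF-false (conn M S x) ex
    in x , y , λ c → clash (conn⁺ S c) ey

  subgraphB⁻ : ∀ S → isSubgraphB M S ≡ true → IsSubgraph M S
  subgraphB⁻ S e h = xor-false⇒≡ (not-true⁻ (allF⁻ (λ h → not (lookup S h xor lookup S (α h))) e h))

  subgraphB⁺ : ∀ S → IsSubgraph M S → isSubgraphB M S ≡ true
  subgraphB⁺ S sub = allF⁺ (λ h → not (lookup S h xor lookup S (α h))) λ h →
    not-true⁺ (trans (cong (lookup S h xor_) (sym (sub h))) (𝔹.xor-same (lookup S h)))

  record SpanningTree (T : HSet M) : Set where
    constructor mkTree
    field
      subgraph  : IsSubgraph M T
      forest    : Forest T
      connected : Connected T

  tree⁻ : ∀ T → IsSpanningTree M T → SpanningTree T
  tree⁻ T e = let a , b , c = split in mkTree (subgraphB⁻ T a) (forestB⁻ T b) (connectedB⁻ T c)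
    where
    split : isSubgraphB M T ≡ true × forestB M T ≡ true × connectedB M T ≡ true
    split = let a , bc = ∧-true⁻ {isSubgraphB M T} e in a , ∧-true⁻ {forestB M T} bc

  tree⁺ : ∀ {T} → SpanningTree T → IsSpanningTree M T
  tree⁺ {T} (mkTree s f c) = ∧-true⁺ (subgraphB⁺ T s) (∧-true⁺ (forestB⁺ T f) (connectedB⁺ T c))

  remove-mono : ∀ {S S′} e → S ⊆ₕ S′ → removeEdge M S e ⊆ₕ removeEdge M S′ e
  remove-mono {S} {S′} e le x q = let a , b = ∈-remove⁻ S e x q in ∈-remove⁺ S′ e x a (le x b)

  remove-⊆ : ∀ S e → removeEdge M S e ⊆ₕ S
  remove-⊆ S e x q = proj₂ (∈-remove⁻ S e x q)

  forest-sub : ∀ {S S′} → S ⊆ₕ S′ → Forest S′ → Forest S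
  forest-sub {S} {S′} le F h hS c = F h (le h hS) (reaches-mono (remove-mono {S} {S′} h le) c)

  -- A cycle created by `e` passes through `e`, and the rest of it would connect the ends of `e`
  -- within `S`.
  forest-add : ∀ {S e} → IsSubgraph M S → Forest S → ¬ Conn S e (α e) → Forest (addEdge M S e)
  forest-add {S} {e} sub F ne h h∈ c with bool-cases (onEdge e h)
  ... | inj₁ q = ne (case onEdge⁻ e h q of λ where
        (inj₁ refl) → c′
        (inj₂ refl) → subst (λ y → Conn S y (α e)) (αα e) (conn-sym S sub c′))
    where
    c′ : Conn S h (α h)
    c′ = reaches-mono (λ z z∈ → let a , b = ∈-remove⁻ (addEdge M S e) h z z∈ in
           case ∈-add⁻ S e z b of λ where
             (inj₂ zS) → zS
             (inj₁ on) → clash (subst (λ b → b ≡ true) (same z) on) a) c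
      where
      same : ∀ z → onEdge e z ≡ onEdge h z
      same z with onEdge⁻ e h q
      ... | inj₁ refl = refl
      ... | inj₂ refl = trans (𝔹.∨-comm (e == z) (α e == z)) (cong (λ y → (α e == z) ∨ (y == z)) (sym (αα e)))
  ... | inj₂ q with ∈-add⁻ S e h h∈
  ...   | inj₁ q′ = clash q′ q
  ...   | inj₂ hS with reaches-split {lookup (removeEdge M S h)} {e = e} sp c
      where
      sp : ∀ z → z ∈ₕ removeEdge M (addEdge M S e) h → z ∈ₕ removeEdge M S h ⊎ z ≡ e ⊎ z ≡ α e
      sp z z∈ = let a , b = ∈-remove⁻ (addEdge M S e) h z z∈ in
        [ inj₂ ∘ onEdge⁻ e z , inj₁ ∘ ∈-remove⁺ S h z a ]′ (∈-add⁻ S e z b)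
  ...     | inj₁ r = F h hS r
  ...     | inj₂ (inj₁ (r , s)) = ne (reaches-trans (conn-sym S sub (up r)) (reaches-trans (cross hS here) (conn-sym S sub (up s))))
      where
      up : ∀ {x y} → Conn (removeEdge M S h) x y → Conn S x y
      up = reaches-mono (remove-⊆ S h)
  ...     | inj₂ (inj₂ (r , s)) = ne (reaches-trans (up s) (reaches-trans (conn-sym S sub (cross hS here)) (up r)))
      where
      up : ∀ {x y} → Conn (removeEdge M S h) x y → Conn S x y
      up = reaches-mono (remove-⊆ S h)

  -- Components and rank

  private
    rep-test : HSet M → Fin n → Fin n → Bool
    rep-test S h h′ = not (conn M S h h′) ∨ (toℕ h ≤ᵇ toℕ h′)

  isRep : HSet M → Fin n → Bool
  isRep S h = allF (rep-test S h)

  isRep⁻ : ∀ S h → isRep S h ≡ true → ∀ h′ → Conn S h h′ → toℕ h ≤ toℕ h′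
  isRep⁻ S h e h′ c with ∨-true⁻ {not (conn M S h h′)} (allF⁻ (rep-test S h) e h′)
  ... | inj₁ a = clash (conn⁺ S c) (not-true⁻ a)
  ... | inj₂ b = ≤ᵇ⁻ b

  isRep⁺ : ∀ S h → (∀ h′ → Conn S h h′ → toℕ h ≤ toℕ h′) → isRep S h ≡ true
  isRep⁺ S h f = allF⁺ (rep-test S h) λ h′ → case bool-cases (conn M S h h′) of λ where
    (inj₁ t) → ∨-trueʳ {not (conn M S h h′)} (≤ᵇ⁺ (f h′ (conn⁻ S h h′ t)))
    (inj₂ q) → ∨-trueˡ (not-true⁺ q)

  rep-unique : ∀ S {x y} → IsSubgraph M S → isRep S x ≡ true → isRep S y ≡ true → Conn S x y → x ≡ y
  rep-unique S {x} {y} sub rx ry c = FP.toℕ-injective (≤-antisym (isRep⁻ S x rx y c) (isRep⁻ S y ry x (conn-sym S sub c)))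

  leader : ∀ S x → ∃ λ h → Conn S x h × isRep S h ≡ true
  leader S x = let h , c , min = leastF (conn M S x) x (conn⁺ S here) in
    h , conn⁻ S x h c , isRep⁺ S h λ h′ c′ → min h′ (conn⁺ S (reaches-trans (conn⁻ S x h c) c′))

  numComp-cong : ∀ {S S′} → (∀ {x y} → Conn S x y → Conn S′ x y) → (∀ {x y} → Conn S′ x y → Conn S x y) →
                 numComp M S ≡ numComp M S′
  numComp-cong {S} {S′} f g = countF-cong {p = isRep S} {isRep S′} λ h → bool-ext
    (λ e → isRep⁺ S′ h λ h′ c → isRep⁻ S h e h′ (g c))
    (λ e → isRep⁺ S h λ h′ c → isRep⁻ S′ h e h′ (f c))

  numComp-add-connected : ∀ {S e} → IsSubgraph M S → Conn S e (α e) → numComp M (addEdge M S e) ≡ numComp M S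
  numComp-add-connected {S} {e} sub c =
    numComp-cong {addEdge M S e} {S} (conn-add-absorb {S} {e} sub c) (reaches-mono (∈-add-old S e))

  numComp-add-separated : ∀ {S e} → IsSubgraph M S → ¬ Conn S e (α e) →
                          numComp M S ≡ suc (numComp M (addEdge M S e))
  numComp-add-separated {S} {e} sub ne = by-order e ne (leader S e) (leader S (α e))
    where
    ordered : ∀ e {a b} → ¬ Conn S e (α e) → Conn S e a → isRep S a ≡ true → Conn S (α e) b → isRep S b ≡ true →
              toℕ a < toℕ b → numComp M S ≡ suc (numComp M (addEdge M S e))
    ordered e {a} {b} ne ca ra cb rb a<b = countF-drop {p = isRep S} {isRep S′} b rb
      (≢true⇒false λ r → <⇒≱ a<b (isRep⁻ S′ b r a b~a))
      λ i i≢b → bool-ext (λ r → isRep⁺ S′ i (stays i i≢b r))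
                         (λ r → isRep⁺ S i λ h′ c → isRep⁻ S′ i r h′ (reaches-mono (∈-add-old S e) c))
      where
      S′ = addEdge M S e
      b~a : Conn S′ b a
      b~a = conn-sym S′ (add-subgraph {S} e sub) (reaches-trans (reaches-mono (∈-add-old S e) (conn-sym S sub ca))
              (reaches-trans (conn-new S e) (reaches-mono (∈-add-old S e) cb)))
      stays : ∀ i → i ≢ b → isRep S i ≡ true → ∀ h′ → Conn S′ i h′ → toℕ i ≤ toℕ h′
      stays i i≢b r h′ c with conn-add {S} {e} c
      ... | inj₁ q = isRep⁻ S i r h′ q
      ... | inj₂ (inj₁ (q , s)) rewrite rep-unique S sub r ra (reaches-trans q ca) =
            <⇒≤ (<-≤-trans a<b (isRep⁻ S b rb h′ (reaches-trans (conn-sym S sub cb) s)))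
      ... | inj₂ (inj₂ (q , s)) = ⊥-elim (i≢b (rep-unique S sub r rb (reaches-trans q cb)))
    by-order : ∀ e → ¬ Conn S e (α e) → (∃ λ h → Conn S e h × isRep S h ≡ true) →
               (∃ λ h → Conn S (α e) h × isRep S h ≡ true) → numComp M S ≡ suc (numComp M (addEdge M S e))
    by-order e ne (a , ca , ra) (b , cb , rb) with <-cmp (toℕ a) (toℕ b)
    ... | tri< lt _ _ = ordered e ne ca ra cb rb lt
    ... | tri≈ _ eq _ = ⊥-elim (ne (reaches-trans ca
            (subst (λ h → Conn S h (α e)) (sym (FP.toℕ-injective eq)) (conn-sym S sub cb))))
    ... | tri> _ _ gt = trans
            (ordered (α e) (λ c → ne (conn-sym S sub (subst (Conn S (α e)) (αα e) c)))
                     cb rb (subst (λ h → Conn S h a) (sym (αα e)) ca) ra gt)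
            (cong (suc ∘ numComp M) (add-comm-α S e))

  numComp-connected : ∀ {S} → IsSubgraph M S → Connected S → numComp M S ≡ 1
  numComp-connected {S} sub c = let h , _ , r = leader S h₀ in
    countF-one {p = isRep S} h r λ y ry → rep-unique S sub r ry (c h y)

  numComp-disconnected : ∀ {S x y} → IsSubgraph M S → ¬ Conn S x y → 2 ≤ numComp M S
  numComp-disconnected {S} {x} {y} sub nc =
    let a , ca , ra = leader S x
        b , cb , rb = leader S y
    in countF-two {p = isRep S} a b
         (λ a≡b → nc (reaches-trans ca (subst (λ h → Conn S h y) (sym a≡b) (conn-sym S sub cb)))) ra rb

  onEdge-other : ∀ e {x y} → onEdge e x ≡ true → onEdge e y ≡ true → x ≢ y → x ≡ α y
  onEdge-other e {x} {y} ex ey ne with onEdge⁻ e x ex | onEdge⁻ e y ey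
  ... | inj₁ refl | inj₁ refl = ⊥-elim (ne refl)
  ... | inj₁ refl | inj₂ refl = sym (αα e)
  ... | inj₂ refl | inj₁ refl = refl
  ... | inj₂ refl | inj₂ refl = ⊥-elim (ne refl)

  size-add : ∀ {S e} → IsSubgraph M S → e ∉ₕ S → size M (addEdge M S e) ≡ suc (size M S)
  size-add {S} {e} sub e∉ = case <-cmp (toℕ e) (toℕ (α e)) of λ where
      (tri< lt _ _) → at e (onEdge-self e) lt
      (tri≈ _ eq _) → ⊥-elim (α-fpf e (sym (FP.toℕ-injective eq)))
      (tri> _ _ gt) → at (α e) (onEdge⁺ e (α e) (inj₂ refl)) (subst (λ h → toℕ (α e) < toℕ h) (sym (αα e)) gt)
    where
    S′ = addEdge M S e
    at : ∀ r → onEdge e r ≡ true → toℕ r < toℕ (α r) → size M S′ ≡ suc (size M S)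
    at r on lt = countF-drop {p = λ h → lookup S′ h ∧ isEdgeRep M h} {λ h → lookup S h ∧ isEdgeRep M h} r
      (∧-true⁺ (∈-add-self S e r on) (<ᵇ⁺ lt)) (cong (_∧ isEdgeRep M r) (trans (onEdge-∈ {S} sub on) e∉)) off
      where
      off : ∀ i → i ≢ r → lookup S′ i ∧ isEdgeRep M i ≡ lookup S i ∧ isEdgeRep M i
      off i ne with bool-cases (onEdge e i)
      ... | inj₂ f = cong (_∧ isEdgeRep M i) (trans (lookup-add S e i) (cong (_∨ lookup S i) f))
      ... | inj₁ t = trans (cong (lookup S′ i ∧_) norep) (trans (𝔹.∧-zeroʳ (lookup S′ i))
                       (sym (trans (cong (lookup S i ∧_) norep) (𝔹.∧-zeroʳ (lookup S i)))))
        where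
        norep : isEdgeRep M i ≡ false
        norep rewrite onEdge-other e t on ne = ≢true⇒false λ q →
          <-asym lt (subst (λ h → toℕ (α r) < toℕ h) (αα r) (<ᵇ⁻ q))

  numComp-empty : ∀ {S} → (∀ h → h ∉ₕ S) → numComp M S ≡ numV M
  numComp-empty {S} empty = countF-cong {p = isRep S} {isVertexRep M} λ h → bool-ext
    (λ r → allBelow⁺ n λ k _ → ≤ᵇ⁺ (isRep⁻ S h r (iter k σ h) (sameV-reaches h (iter k σ h) (sameV⁺ k refl))))
    (λ v → isRep⁺ S h λ h′ c →
      let k , k<n , e = anyBelow⁻ n (closed-reaches (sameV-vertexSet h) (λ z _ q → clash q (empty z)) c (sameV-refl h))
      in subst (λ x → toℕ h ≤ toℕ x) (==⁻ (iter k σ h) h′ e) (≤ᵇ⁻ (allBelow⁻ n v k k<n)))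

  empty-or-edge : ∀ (S : HSet M) → (∀ h → h ∉ₕ S) ⊎ (∃ λ e → e ∈ₕ S)
  empty-or-edge S with search (lookup S)
  ... | inj₁ x = inj₂ x
  ... | inj₂ f = inj₁ f

  remove-shrinks : ∀ {S e} → e ∈ₕ S → countF (lookup (removeEdge M S e)) < countF (lookup S)
  remove-shrinks {S} {e} eS = countF-strict e
    (≢true⇒false λ q → clash (onEdge-self e) (proj₁ (∈-remove⁻ S e e q))) eS (remove-⊆ S e)

  -- The nullity vanishes exactly on forests. The comparison is kept additive because the exponent
  -- in the Tutte polynomial is a truncated difference.
  Rank : HSet M → Set
  Rank S = (Forest S × size M S + numComp M S ≡ numV M) ⊎ (¬ Forest S × numV M < size M S + numComp M S)

  -- Edges are put back one at a time. A bridge adds an edge and loses a component, so `|S| + c(S)`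
  -- stays the same; an edge closing a cycle raises it by one, and no later edge lowers it.
  rank : ∀ {S} → IsSubgraph M S → Rank S
  rank {S} sub = go (suc (countF (lookup S))) S sub ≤-refl
    where
    go : ∀ k S → IsSubgraph M S → countF (lookup S) < k → Rank S
    go (suc k) S sub (s≤s le) with empty-or-edge S
    ... | inj₁ empty = inj₁ ((λ h hS → clash hS (empty h)) ,
            cong₂ _+_ (countF-none {p = λ h → lookup S h ∧ isEdgeRep M h} (λ h → cong (_∧ isEdgeRep M h) (empty h)))
                      (numComp-empty {S} empty))
    ... | inj₂ (e , eS) = subst Rank (add-remove {S} sub eS) (extend (go k S₀ sub₀ (<-≤-trans (remove-shrinks {S} eS) le)))
      where
      S₀ = removeEdge M S e
      sub₀ = remove-subgraph {S} e sub
      size₁ : size M (addEdge M S₀ e) ≡ suc (size M S₀)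
      size₁ = size-add {S₀} {e} sub₀ (remove-∉ S e)
      S₀≡ : removeEdge M (addEdge M S₀ e) e ≡ S₀
      S₀≡ = remove-add {S₀} {e} sub₀ (remove-∉ S e)
      joined : Conn S₀ e (α e) → ¬ Forest (addEdge M S₀ e)
      joined c F = F e (∈-add-self S₀ e e (onEdge-self e)) (subst (λ R → Conn R e (α e)) (sym S₀≡) c)
      more : Conn S₀ e (α e) → size M (addEdge M S₀ e) + numComp M (addEdge M S₀ e) ≡ suc (size M S₀ + numComp M S₀)
      more c = cong₂ _+_ size₁ (numComp-add-connected {S₀} sub₀ c)
      same : ¬ Conn S₀ e (α e) → size M (addEdge M S₀ e) + numComp M (addEdge M S₀ e) ≡ size M S₀ + numComp M S₀
      same nc = trans (cong (_+ numComp M (addEdge M S₀ e)) size₁) (trans (sym (+-suc (size M S₀) _))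
                  (cong (size M S₀ +_) (sym (numComp-add-separated {S₀} sub₀ nc))))
      extend : Rank S₀ → Rank (addEdge M S₀ e)
      extend (inj₁ (F , eq)) with reaches? (lookup S₀) e (α e)
      ... | yes c = inj₂ (joined c , ≤-reflexive (trans (cong suc (sym eq)) (sym (more c))))
      ... | no nc = inj₁ (forest-add {S₀} sub₀ F nc , trans (same nc) eq)
      extend (inj₂ (nF , lt)) = inj₂ ((λ F → nF (forest-sub {S₀} {addEdge M S₀ e} (∈-add-old S₀ e) F)) ,
        (case reaches? (lookup S₀) e (α e) of λ where
          (yes c) → <-trans lt (≤-reflexive (sym (more c)))
          (no nc) → <-≤-trans lt (≤-reflexive (sym (same nc)))))

  full : HSet M
  full = tabulate (λ _ → true)

  ∈-full : ∀ x → x ∈ₕ full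
  ∈-full = VP.lookup∘tabulate (λ _ → true)

  full-connected : Connected full
  full-connected x y = reaches-trans (conn-sym full full-sub (from-root (transitive x))) (from-root (transitive y))
    where
    full-sub : IsSubgraph M full
    full-sub h = trans (∈-full h) (sym (∈-full (α h)))
    from-root : ∀ {h} → Reach σᴾ αᴾ h₀ h → Conn full h₀ h
    from-root here      = here
    from-root (viaσ r)  = fwd (from-root r)
    from-root (viaσ⁻ r) = bwd (from-root r)
    from-root (viaα {h} r) = cross (∈-full h) (from-root r)

  spanning-tree : ∃ SpanningTree
  spanning-tree = go (suc (countF (lookup full))) full (λ h → trans (∈-full h) (sym (∈-full (α h)))) full-connected ≤-refl
    where
    go : ∀ k S → IsSubgraph M S → Connected S → countF (lookup S) < k → ∃ SpanningTree
    go (suc k) S sub con (s≤s le) with bool-cases (forestB M S)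
    ... | inj₁ F = S , mkTree sub (forestB⁻ S F) con
    ... | inj₂ nF with forestB-false S nF
    ...   | e , eS , c = go k (removeEdge M S e) (remove-subgraph {S} e sub)
              (λ x y → conn-add-absorb {removeEdge M S e} {e} (remove-subgraph {S} e sub) c
                         (subst (λ R → Conn R x y) (sym (add-remove {S} sub eS)) (con x y)))
              (<-≤-trans (remove-shrinks {S} eS) le)

  side : ∀ {T e} → SpanningTree T → e ∈ₕ T → ∀ x →
         Conn (removeEdge M T e) x e ⊎ Conn (removeEdge M T e) x (α e)
  side {T} {e} (mkTree sub F con) eT x
    with conn-add {removeEdge M T e} {e} (subst (λ R → Conn R x e) (sym (add-remove {T} sub eT)) (con x e))
  ... | inj₁ q = inj₁ q
  ... | inj₂ (inj₁ (q , _)) = inj₁ q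
  ... | inj₂ (inj₂ (q , _)) = inj₂ q

  -- `f` rejoins the two sides into which the removal of `e` splits the vertices.
  exchange⁺ : ∀ {T e f} → SpanningTree T → e ∈ₕ T → ¬ Conn (removeEdge M T e) f (α f) →
              SpanningTree (addEdge M (removeEdge M T e) f)
  exchange⁺ {T} {e} {f} tr@(mkTree sub F con) eT nc = mkTree (add-subgraph {T₀} f sub₀)
      (forest-add {T₀} sub₀ (forest-sub {T₀} {T} (remove-⊆ T e) F) nc)
      (λ x y → reaches-trans (to-e x) (conn-sym T′ sub′ (to-e y)))
    where
    T₀ = removeEdge M T e
    sub₀ = remove-subgraph {T} e sub
    T′ = addEdge M T₀ f
    sub′ = add-subgraph {T₀} f sub₀
    up : ∀ {x y} → Conn T₀ x y → Conn T′ x y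
    up = reaches-mono (∈-add-old T₀ f)
    joined : Conn T′ (α e) e
    joined with side {T} {e} tr eT f | side {T} {e} tr eT (α f)
    ... | inj₁ a | inj₁ b = ⊥-elim (nc (reaches-trans a (conn-sym T₀ sub₀ b)))
    ... | inj₂ a | inj₂ b = ⊥-elim (nc (reaches-trans a (conn-sym T₀ sub₀ b)))
    ... | inj₁ a | inj₂ b = conn-sym T′ sub′ (reaches-trans (conn-sym T′ sub′ (up a)) (reaches-trans (conn-new T₀ f) (up b)))
    ... | inj₂ a | inj₁ b = reaches-trans (conn-sym T′ sub′ (up a)) (reaches-trans (conn-new T₀ f) (up b))
    to-e : ∀ x → Conn T′ x e
    to-e x with side {T} {e} tr eT x
    ... | inj₁ c = up c
    ... | inj₂ c = reaches-trans (up c) joined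

  exchange⁻ : ∀ {T e f} → IsSubgraph M T → f ∉ₕ T → SpanningTree (addEdge M (removeEdge M T e) f) →
              ¬ Conn (removeEdge M T e) f (α f)
  exchange⁻ {T} {e} {f} sub f∉ (mkTree _ F _) c = F f (∈-add-self T₀ f f (onEdge-self f))
    (subst (λ R → Conn R f (α f)) (sym (remove-add {T₀} {f} (remove-subgraph {T} e sub)
      (≢true⇒false λ q → clash (remove-⊆ T e f q) f∉))) c)
    where T₀ = removeEdge M T e

-- The tour of a spanning tree

module Tours (M : RootedMap) where
  open Subgraphs M public

  motion-in : ∀ {T h} → h ∈ₕ T → motion M T h ≡ σ (α h)
  motion-in {T} {h} e = cong (if_then σ (α h) else σ h) e

  motion-out : ∀ {T h} → h ∉ₕ T → motion M T h ≡ σ h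
  motion-out {T} {h} e = cong (if_then σ (α h) else σ h) e

  motion-injective : ∀ {T} → IsSubgraph M T → Injective _≡_ _≡_ (motion M T)
  motion-injective {T} sub {x} {y} e with bool-cases (lookup T x) | bool-cases (lookup T y)
  ... | inj₁ a | inj₁ b = α-injective (σ-injective (trans (sym (motion-in {T} a)) (trans e (motion-in {T} b))))
  ... | inj₂ a | inj₂ b = σ-injective (trans (sym (motion-out {T} a)) (trans e (motion-out {T} b)))
  ... | inj₁ a | inj₂ b with σ-injective (trans (sym (motion-in {T} a)) (trans e (motion-out {T} b)))
  ...   | refl = clash (trans (sym (sub x)) a) b
  motion-injective {T} sub {x} {y} e | inj₂ a | inj₁ b
    with σ-injective (trans (sym (motion-out {T} a)) (trans e (motion-in {T} b)))
  ...   | refl = clash (trans (sym (sub y)) b) a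

  Orbit : (Fin n → Fin n) → Fin n → Fin n → Set
  Orbit f x y = ∃ λ k → iter k f x ≡ y

  orbit-trans : ∀ {f x y z} → Orbit f x y → Orbit f y z → Orbit f x z
  orbit-trans {f} {x} (j , refl) (k , refl) = k + j , iter-+ k j f x

  orbit-sym : ∀ {f} → Injective _≡_ _≡_ f → ∀ {x y} → Orbit f x y → Orbit f y x
  orbit-sym inj {x} (k , refl) = iter-back inj x k

  orbit⇒conn : ∀ T {x y} → Orbit (motion M T) x y → Conn T x y
  orbit⇒conn T {x} (k , refl) = go k
    where
    go : ∀ k → Conn T x (iter k (motion M T) x)
    go zero = here
    go (suc k) with bool-cases (lookup T (iter k (motion M T) x))
    ... | inj₁ t = subst (Conn T x) (sym (motion-in {T} t)) (fwd (cross t (go k)))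
    ... | inj₂ f = subst (Conn T x) (sym (motion-out {T} f)) (fwd (go k))

  conn⇒orbit : ∀ T {f} → Injective _≡_ _≡_ f → (∀ y → Orbit f y (σ y)) → (∀ y → y ∈ₕ T → Orbit f y (α y)) →
               ∀ {x y} → Conn T x y → Orbit f x y
  conn⇒orbit T {f} inj Hσ Hα here = 0 , refl
  conn⇒orbit T {f} inj Hσ Hα (fwd {y} r) = orbit-trans (conn⇒orbit T inj Hσ Hα r) (Hσ y)
  conn⇒orbit T {f} inj Hσ Hα (bwd {y} r) = orbit-trans (conn⇒orbit T inj Hσ Hα r)
    (orbit-sym inj (subst (Orbit f (σ⁻¹ y)) (σσ⁻ y) (Hσ (σ⁻¹ y))))
  conn⇒orbit T {f} inj Hσ Hα (cross {y} e r) = orbit-trans (conn⇒orbit T inj Hσ Hα r) (Hα y e)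

  -- g is obtained from f by exchanging the images of a and b, which lie on different f-orbits;
  -- the two orbits get merged.
  module _ {f g : Fin n → Fin n} {a b : Fin n} (inj : Injective _≡_ _≡_ f)
           (off : ∀ x → x ≢ a → x ≢ b → g x ≡ f x) (ga : g a ≡ f b) (gb : g b ≡ f a)
           (apart : ¬ Orbit f b a) where

    merge-toward : ∀ m x → iter m f x ≡ a → Orbit g x a
    merge-toward zero    x e = 0 , e
    merge-toward (suc m) x e with x ≟ a
    ... | yes refl = 0 , refl
    ... | no x≢a with x ≟ b
    ...   | yes refl = ⊥-elim (apart (suc m , e))
    ...   | no x≢b = orbit-trans (1 , off x x≢a x≢b) (merge-toward m (f x) (trans (sym (iter-suc m f x)) e))

    merge-orbits : Orbit g b a
    merge-orbits = let k , e = orbit-sym inj (1 , refl) in orbit-trans (1 , gb) (merge-toward k (f a) e)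

  -- This is why the motion function of a spanning tree is one cycle. Removing `e` from the forest
  -- exchanges the images of `e` and `α e`; as orbits stay within components, these two then lie on
  -- different orbits, and putting `e` back merges them.
  forest-orbit : ∀ {T} → IsSubgraph M T → Forest T → ∀ {x y} → Conn T x y → Orbit (motion M T) x y
  forest-orbit {T} sub F = go (suc (countF (lookup T))) T sub F ≤-refl
    where
    go : ∀ k T → IsSubgraph M T → Forest T → countF (lookup T) < k → ∀ {x y} → Conn T x y → Orbit (motion M T) x y
    go (suc k) T sub F (s≤s le) with empty-or-edge T
    ... | inj₁ empty = conn⇒orbit T (motion-injective {T} sub) (λ y → 1 , motion-out {T} (empty y))
                         (λ y yT → clash yT (empty y))
    ... | inj₂ (e , eT) = conn⇒orbit T (motion-injective {T} sub) (λ y → lift (IH (fwd here))) crosses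
      where
      T₀ = removeEdge M T e
      sub₀ = remove-subgraph {T} e sub
      t = motion M T
      t₀ = motion M T₀
      IH : ∀ {x y} → Conn T₀ x y → Orbit t₀ x y
      IH = go k T₀ sub₀ (forest-sub {T₀} {T} (remove-⊆ T e) F) (<-≤-trans (remove-shrinks {T} eT) le)
      inj₀ = motion-injective {T₀} sub₀
      removed : ∀ x → onEdge e x ≡ true → x ∉ₕ T₀
      removed x on = trans (lookup-remove T e x) (cong (λ b → not b ∧ lookup T x) on)
      kept : ∀ x → onEdge e x ≡ false → t x ≡ t₀ x
      kept x off = cong (if_then σ (α x) else σ x) (sym (trans (lookup-remove T e x) (cong (λ b → not b ∧ lookup T x) off)))
      off-edge : ∀ x → x ≢ e → x ≢ α e → t x ≡ t₀ x
      off-edge x p q = kept x (≢true⇒false λ on → [ p , q ]′ (onEdge⁻ e x on))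
      te : t e ≡ t₀ (α e)
      te = trans (motion-in {T} eT) (sym (motion-out {T₀} (removed (α e) (onEdge⁺ e _ (inj₂ refl)))))
      tαe : t (α e) ≡ t₀ e
      tαe = trans (motion-in {T} (trans (sym (sub e)) eT)) (trans (cong σ (αα e)) (sym (motion-out {T₀} (removed e (onEdge-self e)))))
      apart : ¬ Orbit t₀ e (α e)
      apart o = F e eT (orbit⇒conn T₀ o)
      αe→e : Orbit t (α e) e
      αe→e = merge-orbits inj₀ off-edge te tαe (apart ∘ orbit-sym inj₀)
      e→αe : Orbit t e (α e)
      e→αe = merge-orbits inj₀ (λ x p q → off-edge x q p) tαe te apart
      step : ∀ y → Orbit t y (t₀ y)
      step y with y ≟ e | y ≟ α e
      ... | yes refl | _        = orbit-trans e→αe (1 , tαe)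
      ... | no _     | yes refl = orbit-trans αe→e (1 , te)
      ... | no p     | no q     = 1 , off-edge y p q
      lift : ∀ {x y} → Orbit t₀ x y → Orbit t x y
      lift (zero  , refl) = 0 , refl
      lift {x} (suc j , refl) = orbit-trans (lift (j , refl)) (step (iter j t₀ x))
      crosses : ∀ y → y ∈ₕ T → Orbit t y (α y)
      crosses y yT with bool-cases (onEdge e y)
      ... | inj₂ off = lift (IH (cross (∈-remove⁺ T e y off yT) here))
      ... | inj₁ on with onEdge⁻ e y on
      ...   | inj₁ refl = e→αe
      ...   | inj₂ refl = subst (Orbit t (α e)) (sym (αα e)) αe→e

  module Tour {T : HSet M} (tr : SpanningTree T) where
    open SpanningTree tr public

    t : Fin n → Fin n
    t = motion M T

    p : Fin n → ℕ
    p = pos M T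

    t-injective : Injective _≡_ _≡_ t
    t-injective = motion-injective {T} subgraph

    at : ℕ → Fin n
    at k = iter k t h₀

    visits : ∀ h → ∃ λ m → at m ≡ h
    visits h = forest-orbit {T} subgraph forest (connected h₀ h)

    private
      early : ∀ h → ∃ λ k → k < n × at k ≡ h
      early h = let m , e = visits h
                    k , k<n , q = iter-<n t-injective h₀ m
                in k , k<n , trans q e

      pos-spec : ∀ h k → k < n → at k ≡ h → p h ≤ k × (at (p h) == h) ≡ true
      pos-spec h k k<n e = firstBelow-spec n {λ k → at k == h} k k<n (==⁺ e)

    at-pos : ∀ h → at (p h) ≡ h
    at-pos h = let k , k<n , e = early h in ==⁻ (at (p h)) h (proj₂ (pos-spec h k k<n e))

    pos<n : ∀ h → p h < n
    pos<n h = let k , k<n , e = early h in ≤-<-trans (proj₁ (pos-spec h k k<n e)) k<n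

    pos-at : ∀ k → k < n → p (at k) ≡ k
    pos-at k k<n with m≤n⇒m<n∨m≡n (proj₁ (pos-spec (at k) k k<n refl))
    ... | inj₂ eq = eq
    -- Were this half-edge visited at an earlier time `j`, the tour would have a period `k - j`
    -- below `n`, although it visits everything.
    ... | inj₁ lt = ⊥-elim (full-period t-injective visits d
            (≤-<-trans (≤-trans (m≤n+m (suc d) j) (≤-reflexive j+d)) k<n)
            (sym (iter-injective t-injective j (trans (at-pos (at k))
              (trans (cong at (sym j+d)) (iter-+ j (suc d) t h₀))))))
      where
      j = p (at k)
      d = k ∸ suc j
      j+d : j + suc d ≡ k
      j+d = trans (+-suc j d) (m+[n∸m]≡n lt)

    p-injective : ∀ {x y} → p x ≡ p y → x ≡ y
    p-injective {x} {y} e = trans (sym (at-pos x)) (trans (cong at e) (at-pos y))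

    p-root : p h₀ ≡ 0
    p-root = pos-at 0 (≤-<-trans z≤n (pos<n h₀))

    p-step : ∀ h → suc (p h) < n → p (t h) ≡ suc (p h)
    p-step h lt = trans (cong (p ∘ t) (sym (at-pos h))) (pos-at (suc (p h)) lt)

    First : Fin n → Set
    First h = p h < p (α h)

    first-or : ∀ h → First h ⊎ First (α h)
    first-or h with <-cmp (p h) (p (α h))
    ... | tri< lt _ _ = inj₁ lt
    ... | tri≈ _ eq _ = ⊥-elim (α-fpf h (sym (p-injective eq)))
    ... | tri> _ _ gt = inj₂ (subst (λ x → p (α h) < p x) (sym (αα h)) gt)

    first-flip : ∀ {g} → p (α g) < p g → First (α g)
    first-flip {g} lt = subst (λ x → p (α g) < p x) (sym (αα g)) lt

    p-αα : ∀ g → p g ≡ p (α (α g))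
    p-αα g = cong p (sym (αα g))

    ∈-α : ∀ {h} → h ∈ₕ T → α h ∈ₕ T
    ∈-α {h} e = trans (sym (subgraph h)) e

    ∉-α : ∀ {h} → h ∉ₕ T → α h ∉ₕ T
    ∉-α {h} e = trans (sym (subgraph h)) e

    T-α : ∀ h → lookup T (α h) ≡ lookup T h
    T-α h = sym (subgraph h)

    p-≢ : ∀ {x y} → lookup T x ≡ true → lookup T y ≡ false → p x ≢ p y
    p-≢ a b e with p-injective e
    ... | refl = clash a b

    -- The half-edges incident to the descendants of the internal edge g.
    subtree : Fin n → HalfEdges
    subtree g h = (p g <ᵇ p h) ∧ (p h ≤ᵇ p (α g))

    subtree⁻ : ∀ g h → subtree g h ≡ true → p g < p h × p h ≤ p (α g)
    subtree⁻ g h e = let a , b = ∧-true⁻ {p g <ᵇ p h} e in <ᵇ⁻ a , ≤ᵇ⁻ b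

    subtree⁺ : ∀ g h → p g < p h → p h ≤ p (α g) → subtree g h ≡ true
    subtree⁺ g h a b = ∧-true⁺ (<ᵇ⁺ a) (≤ᵇ⁺ b)

    subtree-false⁻ : ∀ g h → subtree g h ≡ false → p h ≤ p g ⊎ p (α g) < p h
    subtree-false⁻ g h e with <-≤-connex (p g) (p h) | <-≤-connex (p (α g)) (p h)
    ... | inj₂ le | _       = inj₁ le
    ... | inj₁ _  | inj₁ lt = inj₂ lt
    ... | inj₁ lt | inj₂ le = clash (subtree⁺ g h lt le) e

    subtree-before : ∀ g h → p h ≤ p g → subtree g h ≡ false
    subtree-before g h le = ≢true⇒false λ e → <⇒≱ (proj₁ (subtree⁻ g h e)) le

    subtree-after : ∀ g h → p (α g) < p h → subtree g h ≡ false
    subtree-after g h lt = ≢true⇒false λ e → <⇒≱ lt (proj₂ (subtree⁻ g h e))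

    subtree-root : ∀ g → subtree g h₀ ≡ false
    subtree-root g = subtree-before g h₀ (≤-trans (≤-reflexive p-root) z≤n)

    subtree-self : ∀ g → subtree g g ≡ false
    subtree-self g = subtree-before g g ≤-refl

    subtree-α : ∀ {g} → First g → subtree g (α g) ≡ true
    subtree-α {g} F = subtree⁺ g (α g) F ≤-refl

    module _ {g : Fin n} (gT : g ∈ₕ T) (first : First g) where
      private
        T₀ : HSet M
        T₀ = removeEdge M T g

        sub₀ : IsSubgraph M T₀
        sub₀ = remove-subgraph {T} g subgraph

        t₀ : Fin n → Fin n
        t₀ = motion M T₀

        -- Once `g` has left the tree, `α g` is followed by `σ (α g)`, which is `t g`, at position
        -- `p g + 1`: the segment after `g` up to `α g` closes up. As orbits are components, it is
        -- one of the two components of the rest of the tree.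
        stays : ∀ h → subtree g h ≡ true → subtree g (t₀ h) ≡ true
        stays h e with h ≟ α g
        ... | yes refl = subst (λ x → subtree g x ≡ true) (sym t₀αg)
                (subtree⁺ g (t g) (≤-reflexive (sym pt)) (≤-trans (≤-reflexive pt) first))
          where
          t₀αg : t₀ (α g) ≡ t g
          t₀αg = trans (motion-out {T₀} (trans (lookup-remove T g (α g)) (cong (λ b → not b ∧ lookup T (α g)) (onEdge⁺ g _ (inj₂ refl)))))
                       (sym (motion-in {T} gT))
          pt : p (t g) ≡ suc (p g)
          pt = p-step g (≤-<-trans first (pos<n (α g)))
        ... | no h≢ = subst (λ x → subtree g x ≡ true) (sym t₀h)
                (subtree⁺ g (t h) (≤-trans lo (≤-trans (n≤1+n (p h)) (≤-reflexive (sym pt)))) (≤-trans (≤-reflexive pt) hi))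
          where
          lo = proj₁ (subtree⁻ g h e)
          hi : p h < p (α g)
          hi = ≤∧≢⇒< (proj₂ (subtree⁻ g h e)) (h≢ ∘ p-injective)
          pt : p (t h) ≡ suc (p h)
          pt = p-step h (≤-<-trans hi (pos<n (α g)))
          off : onEdge g h ≡ false
          off = ≢true⇒false λ on → [ (λ { refl → <-irrefl refl lo }) , h≢ ]′ (onEdge⁻ g h on)
          t₀h : t₀ h ≡ t h
          t₀h = cong (if_then σ (α h) else σ h) (trans (lookup-remove T g h) (cong (λ b → not b ∧ lookup T h) off))

        stays* : ∀ k h → subtree g h ≡ true → subtree g (iter k t₀ h) ≡ true
        stays* zero    h e = e
        stays* (suc k) h e = stays (iter k t₀ h) (stays* k h e)

        orbit-subtree : ∀ {x y} → Orbit t₀ x y → subtree g x ≡ subtree g y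
        orbit-subtree {x} o = bool-ext (λ e → forth o e) (λ e → forth (orbit-sym (motion-injective {T₀} sub₀) o) e)
          where
          forth : ∀ {x y} → Orbit t₀ x y → subtree g x ≡ true → subtree g y ≡ true
          forth {x} (k , refl) = stays* k x

      subtree-conn : ∀ {x y} → Conn (removeEdge M T g) x y → subtree g x ≡ subtree g y
      subtree-conn c = orbit-subtree (forest-orbit {T₀} sub₀ (forest-sub {T₀} {T} (remove-⊆ T g) forest) c)

      subtree-vertexSet : VertexSet (subtree g)
      subtree-vertexSet h = sym (subtree-conn (fwd here))

      subtree-internal : ∀ {h} → h ∈ₕ T → onEdge g h ≡ false → subtree g (α h) ≡ subtree g h
      subtree-internal {h} hT off = sym (subtree-conn (cross (∈-remove⁺ T g h off hT) here))

      subtree-connected : ∀ {x y} → subtree g x ≡ subtree g y → Conn (removeEdge M T g) x y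
      subtree-connected {x} {y} e with side {T} {g} tr gT x | side {T} {g} tr gT y
      ... | inj₁ a | inj₁ b = reaches-trans a (conn-sym T₀ sub₀ b)
      ... | inj₂ a | inj₂ b = reaches-trans a (conn-sym T₀ sub₀ b)
      ... | inj₁ a | inj₂ b = clash (subtree-α first) (trans (sym (subtree-conn b)) (trans (sym e) (trans (subtree-conn a) (subtree-self g))))
      ... | inj₂ a | inj₁ b = clash (subtree-α first) (trans (sym (subtree-conn a)) (trans e (trans (subtree-conn b) (subtree-self g))))

      subtree-entry : ∀ {h} → h ∈ₕ T → subtree g h ≡ false → subtree g (α h) ≡ true → h ≡ g
      subtree-entry {h} hT out in′ with bool-cases (onEdge g h)
      ... | inj₂ off = clash in′ (trans (subtree-internal hT off) out)
      ... | inj₁ on with onEdge⁻ g h on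
      ...   | inj₁ e = e
      ...   | inj₂ refl = clash (subtree-α first) out

    -- The tree path from `x` to `y` traverses this edge from `g` to `α g`: downwards if `y` but not
    -- `x` is below it, upwards if `x` but not `y` is.
    Between : Fin n → Fin n → Fin n → Set
    Between x y g = (p x ≤ p g × p g < p y × p y ≤ p (α g)) ⊎ (p (α g) < p x × p x ≤ p g × p g < p y)

    -- The tree path between the vertices of x and y consists of the internal edges separating
    -- them in the tour, so some such edge enters W if y is in W but x is not.
    path-entry : ∀ {W} → VertexSet W → ∀ {x y} → p x ≤ p y → W x ≡ false → W y ≡ true →
                 ∃ λ g → g ∈ₕ T × W g ≡ false × W (α g) ≡ true × Between x y g
    path-entry {W} vW {x} {y} = <-rec Goal step (p y) y refl
      where
      Goal : ℕ → Set
      Goal b = ∀ y → p y ≡ b → p x ≤ p y → W x ≡ false → W y ≡ true →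
               ∃ λ g → g ∈ₕ T × W g ≡ false × W (α g) ≡ true × Between x y g
      step : ∀ b → (∀ {j} → j < b → Goal j) → Goal b
      step zero IH y py le Wx Wy = clash Wy (subst (λ z → W z ≡ false)
        (p-injective (trans (n≤0⇒n≡0 (subst (p x ≤_) py le)) (sym py))) Wx)
      step (suc b) IH y py le Wx Wy = main
        where
        -- `h` is visited just before `y`. If it is external, it lies at the vertex of `y`; if it is
        -- internal, its other half `α h` does.
        h = at b
        b<n : suc b < n
        b<n = subst (_< n) py (pos<n y)
        ph : p h ≡ b
        ph = pos-at b (<-trans (n<1+n b) b<n)
        y≡ : t h ≡ y
        y≡ = p-injective (trans (pos-at (suc b) b<n) (sym py))
        py′ : p y ≡ suc (p h)
        py′ = trans py (cong suc (sym ph))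
        x≤h : p x ≤ p h
        x≤h = ≤-pred (subst (p x <_) py′ (≤∧≢⇒< le λ e → clash Wy (subst (λ z → W z ≡ false) (p-injective e) Wx)))
        later : ∀ {z g} → p z ≤ p h → p g < p z → p g < p y
        later z≤h lt = <-≤-trans lt (≤-trans z≤h (≤-trans (n≤1+n _) (≤-reflexive (sym py′))))
        extend : ∀ {z g} → p z ≤ p h → (p z ≤ p (α g) → p h < p (α g)) → Between x z g → Between x y g
        extend z≤h f (inj₁ (a , b , c)) = inj₁ (a , later z≤h b , ≤-trans (≤-reflexive py′) (f c))
        extend z≤h f (inj₂ (a , b , c)) = inj₂ (a , b , later z≤h c)
        IH′ : ∀ z → p z ≤ p h → p x ≤ p z → W z ≡ true →
              ∃ λ g → g ∈ₕ T × W g ≡ false × W (α g) ≡ true × Between x z g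
        IH′ z z≤h x≤z Wz = IH (s≤s (≤-trans z≤h (≤-reflexive ph))) z refl x≤z Wx Wz
        Wα : h ∈ₕ T → W (α h) ≡ true
        Wα hT = trans (sym (vW (α h))) (trans (cong W (trans (sym (motion-in {T} hT)) y≡)) Wy)
        main : ∃ λ g → g ∈ₕ T × W g ≡ false × W (α g) ≡ true × Between x y g
        main with bool-cases (lookup T h)
        ... | inj₂ hT =
          let Wh = trans (sym (vW h)) (trans (cong W (trans (sym (motion-out {T} hT)) y≡)) Wy)
              g , gT , a , b , btw = IH′ h ≤-refl x≤h Wh
          in g , gT , a , b , extend ≤-refl (λ le → ≤∧≢⇒< le (p-≢ (∈-α gT) hT ∘ sym)) btw
        ... | inj₁ hT with bool-cases (W h)
        ...   | inj₁ Wh =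
          let g , gT , a , b , btw = IH′ h ≤-refl x≤h Wh
          in g , gT , a , b , extend ≤-refl (λ le → ≤∧≢⇒< le λ e →
               clash (trans (cong W (trans (sym (αα g)) (cong α (sym (p-injective e))))) (Wα hT)) a) btw
        -- Here `h` itself enters `W`. It is on the path if it leads down to `y`, or if its edge was
        -- first traversed before `x`, so that it leads up from `x`. Otherwise the excursion from
        -- `α h` to `h` is skipped, and the search continues from `α h`, which shares the vertex of
        -- `y`.
        ...   | inj₂ ¬Wh with <-≤-connex (p h) (p (α h)) | <-≤-connex (p (α h)) (p x)
        ...     | inj₁ lt | _ = h , hT , ¬Wh , Wα hT , inj₁ (x≤h , ≤-reflexive (sym py′) , ≤-trans (≤-reflexive py′) lt)
        ...     | inj₂ _ | inj₁ lt = h , hT , ¬Wh , Wα hT , inj₂ (lt , x≤h , ≤-reflexive (sym py′))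
        ...     | inj₂ z≤h | inj₂ x≤z =
          let g , gT , a , b , btw = IH′ z z≤h x≤z (Wα hT) in g , gT , a , b , go g gT a btw
          where
          z = α h
          go : ∀ g → g ∈ₕ T → W g ≡ false → Between x z g → Between x y g
          go g gT Wg (inj₂ (a , b , c)) = inj₂ (a , b , later z≤h c)
          go g gT Wg btw@(inj₁ (x≤g , g<z , z≤αg)) = extend z≤h (λ _ → h<αg) btw
            where
            h≢αg : h ≢ α g
            h≢αg e = <-irrefl refl (subst (λ w → p g < p w) (trans (cong α e) (αα g)) g<z)
            off : onEdge g z ≡ false
            off = ≢true⇒false λ on → case onEdge⁻ g z on of λ where
              (inj₁ e) → <-irrefl (cong p (sym e)) g<z
              (inj₂ e) → <⇒≱ g<z (subst (λ w → p z ≤ p w) (α-injective e) z≤h)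
            h<αg : p h < p (α g)
            h<αg = ≤∧≢⇒< (proj₂ (subtree⁻ g h (trans (cong (subtree g) (sym (αα h)))
                     (trans (subtree-internal gT (<-≤-trans g<z z≤αg) (∈-α hT) off) (subtree⁺ g z g<z z≤αg)))))
                     (h≢αg ∘ p-injective)

-- Fundamental cycles and cocycles as crossings, activities, and the image Φ(S)

allF-cong : ∀ {n} (p q : Fin n → Bool) → (∀ i → p i ≡ q i) → allF p ≡ allF q
allF-cong p q eq = bool-ext (λ e → allF⁺ q λ i → trans (sym (eq i)) (allF⁻ p e i))
                            (λ e → allF⁺ p λ i → trans (eq i) (allF⁻ q e i))

anyF-cong : ∀ {n} (p q : Fin n → Bool) → (∀ i → p i ≡ q i) → anyF p ≡ anyF q
anyF-cong p q eq = bool-ext (λ e → let i , r = anyF⁻ p e in anyF⁺ q i (trans (sym (eq i)) r))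
                            (λ e → let i , r = anyF⁻ q e in anyF⁺ p i (trans (eq i) r))

xor-trueʳ : ∀ {a b} → a xor b ≡ true → b ≡ true → a ≡ false
xor-trueʳ {false} e refl = refl

xor-falseʳ : ∀ {a b} → a xor b ≡ true → b ≡ false → a ≡ true
xor-falseʳ {true} e refl = refl

≢⇒xor : ∀ {a b} → a ≢ b → a xor b ≡ true
≢⇒xor {true}  {true}  ne = ⊥-elim (ne refl)
≢⇒xor {true}  {false} ne = refl
≢⇒xor {false} {true}  ne = refl
≢⇒xor {false} {false} ne = ⊥-elim (ne refl)

module Activities (M : RootedMap) where
  open Tours M public

  onEdge-αˡ : ∀ e x → onEdge (α e) x ≡ onEdge e x
  onEdge-αˡ e x = trans (cong (λ y → (α e == x) ∨ (y == x)) (αα e)) (𝔹.∨-comm (α e == x) (e == x))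

  remove-comm-α : ∀ S e → removeEdge M S (α e) ≡ removeEdge M S e
  remove-comm-α S e = vec-ext λ x → trans (lookup-remove S (α e) x)
    (trans (cong (λ b → not b ∧ lookup S x) (onEdge-αˡ e x)) (sym (lookup-remove S e x)))

  inCocycle-αˡ : ∀ T e f → inCocycle M T (α e) f ≡ inCocycle M T e f
  inCocycle-αˡ T e f = cong (λ R → spanningTreeB M (addEdge M R f)) (remove-comm-α T e)

  inCocycle-αʳ : ∀ T e f → inCocycle M T e (α f) ≡ inCocycle M T e f
  inCocycle-αʳ T e f = cong (spanningTreeB M) (add-comm-α (removeEdge M T e) f)

  inCycle-αˡ : ∀ T e f → inCycle M T (α e) f ≡ inCycle M T e f
  inCycle-αˡ T e f = cong (λ R → spanningTreeB M (removeEdge M R f)) (add-comm-α T e)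

  edgeKey-α : ∀ T h → edgeKey M T (α h) ≡ edgeKey M T h
  edgeKey-α T h = trans (cong (λ x → pos M T (α h) ⊓ pos M T x) (αα h)) (⊓-comm (pos M T (α h)) (pos M T h))

  -- The condition under which Φ orients e from its first to its second half-edge.
  forward : HSet M → HSet M → Fin n → Bool
  forward T S e =
    if lookup T e
    then not (anyF (λ e′ → (lookup S e′ xor lookup T e′) ∧ inCocycle M T e e′))
    else anyF (λ e′ → (lookup S e′ xor lookup T e′) ∧ inCycle M T e e′)

  lookup-phi : ∀ T S h → lookup (phi M T S) h ≡
               (if pos M T h <ᵇ pos M T (α h) then forward T S h else not (forward T S h))
  lookup-phi T S h = VP.lookup∘tabulate
    (λ h → if pos M T h <ᵇ pos M T (α h) then forward T S h else not (forward T S h)) h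

  module Tree {T : HSet M} (tr : SpanningTree T) where
    open Tour tr public

    -- Both exchanges yield the same edge set because `f` and `g` lie on different edges; cycles are
    -- therefore studied through cocycles.
    cycle≡cocycle : ∀ {f g} → f ∉ₕ T → g ∈ₕ T → inCycle M T f g ≡ inCocycle M T g f
    cycle≡cocycle {f} {g} fT gT = cong (spanningTreeB M) {removeEdge M (addEdge M T f) g} {addEdge M (removeEdge M T g) f}
      (vec-ext λ x → trans (lookup-remove (addEdge M T f) g x)
      (trans (cong (not (onEdge g x) ∧_) (lookup-add T f x)) (trans (pt x)
      (sym (trans (lookup-add (removeEdge M T g) f x) (cong (onEdge f x ∨_) (lookup-remove T g x)))))))
      where
      pt : ∀ x → not (onEdge g x) ∧ (onEdge f x ∨ lookup T x) ≡ onEdge f x ∨ (not (onEdge g x) ∧ lookup T x)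
      pt x with onEdge g x in q | onEdge f x in r
      ... | true  | true  = clash (trans (sym (onEdge-∈ {T} subgraph r)) (trans (onEdge-∈ {T} subgraph q) gT)) fT
      ... | true  | false = refl
      ... | false | true  = refl
      ... | false | false = refl

    -- With another internal edge the exchange would merely delete `g`, and the result would be
    -- disconnected.
    cocycle-internal : ∀ {g f} → g ∈ₕ T → f ∈ₕ T → inCocycle M T g f ≡ true → onEdge g f ≡ true
    cocycle-internal {g} {f} gT fT e = ≢false⇒true λ off → forest g gT
      (subst (λ R → Conn R g (α g)) (vec-ext {u = addEdge M (removeEdge M T g) f} {removeEdge M T g} λ x → trans (lookup-add (removeEdge M T g) f x) (pt off x))
        (SpanningTree.connected (tree⁻ (addEdge M (removeEdge M T g) f) e) g (α g)))
      where
      pt : onEdge g f ≡ false → ∀ x → onEdge f x ∨ lookup (removeEdge M T g) x ≡ lookup (removeEdge M T g) x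
      pt off x with onEdge f x in q
      ... | false = refl
      ... | true  = sym (trans (onEdge-∈ {removeEdge M T g} (remove-subgraph {T} g subgraph) q) (∈-remove⁺ T g f off fT))

    cocycle-self : ∀ {g} → g ∈ₕ T → inCocycle M T g g ≡ true
    cocycle-self {g} gT = trans (cong (spanningTreeB M) (add-remove {T} subgraph gT)) (tree⁺ tr)

    cycle-external : ∀ {f g} → f ∉ₕ T → g ∉ₕ T → inCycle M T f g ≡ true → onEdge f g ≡ true
    cycle-external {f} {g} fT gT e = ≢false⇒true λ off → SpanningTree.forest (tree⁻ T₂ e) f
      (∈-remove⁺ T₁ g f (≢true⇒false λ on → clash (onEdge-sym g f on) off) (∈-add-self T f f (onEdge-self f)))
      (reaches-mono (λ x xT → ∈-remove⁺ T₂ f x (≢true⇒false λ on → clash (trans (sym (onEdge-∈ {T} subgraph on)) xT) fT)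
         (∈-remove⁺ T₁ g x (≢true⇒false λ on → clash (trans (sym (onEdge-∈ {T} subgraph on)) xT) gT) (∈-add-old T f x xT)))
         (connected f (α f)))
      where
      T₁ = addEdge M T f
      T₂ = removeEdge M T₁ g

    cycle-self : ∀ {f} → f ∉ₕ T → inCycle M T f f ≡ true
    cycle-self {f} fT = trans (cong (spanningTreeB M) (remove-add {T} subgraph fT)) (tree⁺ tr)

    -- The two ways in which an internal edge g and an external edge f, both given by their
    -- first half-edges, can cross in the tour; g or f is the smaller edge, respectively.
    record CrossI (g f : Fin n) : Set where
      constructor crossI
      field
        g<f  : p g < p f
        f<g′ : p f < p (α g)
        g′<f′ : p (α g) < p (α f)

    record CrossE (g f : Fin n) : Set where
      constructor crossE
      field
        f<g  : p f < p g
        g<f′ : p g < p (α f)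
        f′<g′ : p (α f) < p (α g)

    module _ {g f : Fin n} (gT : g ∈ₕ T) (fg : First g) (fT : f ∉ₕ T) where

      cocycle⇒separated : inCocycle M T g f ≡ true → subtree g f ≢ subtree g (α f)
      cocycle⇒separated e eq = exchange⁻ {T} {g} {f} subgraph fT (tree⁻ (addEdge M (removeEdge M T g) f) e) (subtree-connected gT fg eq)

      separated⇒cocycle : subtree g f ≢ subtree g (α f) → inCocycle M T g f ≡ true
      separated⇒cocycle ne = tree⁺ (exchange⁺ {T} {g} {f} tr gT λ c → ne (subtree-conn gT fg c))

      module _ (ff : First f) where

        cocycle⇒cross : inCocycle M T g f ≡ true → CrossI g f ⊎ CrossE g f
        cocycle⇒cross e with bool-cases (subtree g f) | bool-cases (subtree g (α f))
        ... | inj₁ a | inj₁ b = ⊥-elim (cocycle⇒separated e (trans a (sym b)))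
        ... | inj₂ a | inj₂ b = ⊥-elim (cocycle⇒separated e (trans a (sym b)))
        ... | inj₁ a | inj₂ b with subtree⁻ g f a | subtree-false⁻ g (α f) b
        ...   | lo , hi | inj₁ le = ⊥-elim (<⇒≱ (<-trans lo ff) le)
        ...   | lo , hi | inj₂ lt = inj₁ (crossI lo (≤∧≢⇒< hi (p-≢ (∈-α gT) fT ∘ sym)) lt)
        cocycle⇒cross e | inj₂ a | inj₁ b with subtree-false⁻ g f a | subtree⁻ g (α f) b
        ...   | inj₁ le | lo , hi = inj₂ (crossE (≤∧≢⇒< le (p-≢ gT fT ∘ sym)) lo (≤∧≢⇒< hi (p-≢ (∈-α gT) (∉-α fT) ∘ sym)))
        ...   | inj₂ lt | lo , hi = ⊥-elim (<⇒≱ (<-trans lt ff) hi)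

        crossI⇒cocycle : CrossI g f → inCocycle M T g f ≡ true
        crossI⇒cocycle (crossI a b c) = separated⇒cocycle λ e →
          clash (trans (sym e) (subtree⁺ g f a (<⇒≤ b))) (subtree-after g (α f) c)

        crossE⇒cocycle : CrossE g f → inCocycle M T g f ≡ true
        crossE⇒cocycle (crossE a b c) = separated⇒cocycle λ e →
          clash (trans e (subtree⁺ g (α f) b (<⇒≤ c))) (subtree-before g f (<⇒≤ a))

    -- The tour meets the outer end of the edge either after `α g` or before `g`, and this decides
    -- which of the two edges is smaller. Inequalities become strict because internal and external
    -- half-edges never share a position.
    leaving : ∀ {g h} → g ∈ₕ T → First g → h ∉ₕ T → subtree g h ≡ true → subtree g (α h) ≡ false →
              (First h × CrossI g h) ⊎ (First (α h) × CrossE g (α h))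
    leaving {g} {h} gT fg hT in′ out with subtree⁻ g h in′ | subtree-false⁻ g (α h) out
    ... | lo , hi | inj₂ lt = inj₁ (≤-<-trans hi lt , crossI lo (≤∧≢⇒< hi (p-≢ (∈-α gT) hT ∘ sym)) lt)
    ... | lo , hi | inj₁ le = inj₂ (first-flip (≤-<-trans le lo) ,
          crossE (≤∧≢⇒< le (p-≢ gT (∉-α hT) ∘ sym)) (<-≤-trans lo (≤-reflexive (p-αα h)))
                 (≤-<-trans (≤-reflexive (sym (p-αα h))) (≤∧≢⇒< hi (p-≢ (∈-α gT) hT ∘ sym))))

    key-first : ∀ {h} → First h → edgeKey M T h ≡ p h
    key-first {h} F = m≤n⇒m⊓n≡m (<⇒≤ F)

    activeB-α : ∀ h → activeB M T (α h) ≡ activeB M T h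
    activeB-α h with lookup T h in e
    ... | true rewrite trans (sym (subgraph h)) e = allF-cong _ _ λ e′ →
          cong₂ (λ a b → not a ∨ (b ≤ᵇ edgeKey M T e′)) (inCocycle-αˡ T h e′) (edgeKey-α T h)
    ... | false rewrite trans (sym (subgraph h)) e = allF-cong _ _ λ e′ →
          cong₂ (λ a b → not a ∨ (b ≤ᵇ edgeKey M T e′)) (inCycle-αˡ T h e′) (edgeKey-α T h)

    private
      testI testE : Fin n → Fin n → Bool
      testI e e′ = not (inCocycle M T e e′) ∨ (edgeKey M T e ≤ᵇ edgeKey M T e′)
      testE e e′ = not (inCycle M T e e′) ∨ (edgeKey M T e ≤ᵇ edgeKey M T e′)

      active≡I : ∀ {e} → e ∈ₕ T → activeB M T e ≡ allF (testI e)
      active≡I eT rewrite eT = refl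

      active≡E : ∀ {e} → e ∉ₕ T → activeB M T e ≡ allF (testE e)
      active≡E eT rewrite eT = refl

      test⁻ : ∀ {a m k} → not a ∨ (m ≤ᵇ k) ≡ true → a ≡ true → m ≤ k
      test⁻ e refl = ≤ᵇ⁻ e

      test-false : ∀ {a m k} → not a ∨ (m ≤ᵇ k) ≡ false → a ≡ true × k < m
      test-false {true} e = refl , ≰⇒> λ le → clash (≤ᵇ⁺ le) e

    -- The key of a first half-edge is its position. Activity thus means the absence of the
    -- crossings in which the other edge comes first: `CrossE` for an internal edge, `CrossI` for an
    -- external one.
    active-internal⁻ : ∀ {g} → g ∈ₕ T → First g → activeB M T g ≡ true →
                       ∀ {f} → f ∉ₕ T → First f → ¬ CrossE g f
    active-internal⁻ {g} gT fg e {f} fT ff c = <⇒≱ (CrossE.f<g c) (subst₂ _≤_ (key-first fg) (key-first ff)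
      (test⁻ (allF⁻ (testI g) (trans (sym (active≡I gT)) e) f) (crossE⇒cocycle gT fg fT ff c)))

    active-external⁻ : ∀ {f} → f ∉ₕ T → First f → activeB M T f ≡ true →
                       ∀ {g} → g ∈ₕ T → First g → ¬ CrossI g f
    active-external⁻ {f} fT ff e {g} gT fg c = <⇒≱ (CrossI.g<f c) (subst₂ _≤_ (key-first ff) (key-first fg)
      (test⁻ (allF⁻ (testE f) (trans (sym (active≡E fT)) e) g)
             (trans (cycle≡cocycle fT gT) (crossI⇒cocycle gT fg fT ff c))))

    inactive-internal : ∀ {g} → g ∈ₕ T → First g → activeB M T g ≡ false →
                        ∃ λ f → f ∉ₕ T × First f × CrossE g f
    inactive-internal {g} gT fg e with allF-false (testI g) (trans (sym (active≡I gT)) e)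
    ... | f , q with test-false q | bool-cases (lookup T f)
    ...   | c , lt | inj₁ fT = ⊥-elim (<-irrefl (same (onEdge⁻ g f (cocycle-internal gT fT c))) lt)
      where
      same : f ≡ g ⊎ f ≡ α g → edgeKey M T f ≡ edgeKey M T g
      same (inj₁ refl) = refl
      same (inj₂ refl) = edgeKey-α T g
    ...   | c , lt | inj₂ fT with first-or f
    ...     | inj₁ ff = case cocycle⇒cross gT fg fT ff c of λ where
                (inj₁ x) → ⊥-elim (<-asym (CrossI.g<f x) (subst₂ _<_ (key-first ff) (key-first fg) lt))
                (inj₂ x) → f , fT , ff , x
    ...     | inj₂ ff = case cocycle⇒cross gT fg (∉-α fT) ff (trans (inCocycle-αʳ T g f) c) of λ where
                (inj₁ x) → ⊥-elim (<-asym (CrossI.g<f x) (subst₂ _<_ (trans (sym (edgeKey-α T f)) (key-first ff)) (key-first fg) lt))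
                (inj₂ x) → α f , ∉-α fT , ff , x

    inactive-external : ∀ {f} → f ∉ₕ T → First f → activeB M T f ≡ false →
                        ∃ λ g → g ∈ₕ T × First g × CrossI g f
    inactive-external {f} fT ff e with allF-false (testE f) (trans (sym (active≡E fT)) e)
    ... | g , q with test-false q | bool-cases (lookup T g)
    ...   | c , lt | inj₂ gT = ⊥-elim (<-irrefl (same (onEdge⁻ f g (cycle-external fT gT c))) lt)
      where
      same : g ≡ f ⊎ g ≡ α f → edgeKey M T g ≡ edgeKey M T f
      same (inj₁ refl) = refl
      same (inj₂ refl) = edgeKey-α T f
    ...   | c , lt | inj₁ gT with first-or g
    ...     | inj₁ fg = case cocycle⇒cross gT fg fT ff (trans (sym (cycle≡cocycle fT gT)) c) of λ where
                (inj₁ x) → g , gT , fg , x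
                (inj₂ x) → ⊥-elim (<-asym (CrossE.f<g x) (subst₂ _<_ (key-first fg) (key-first ff) lt))
    ...     | inj₂ fg = case cocycle⇒cross (∈-α gT) fg fT ff (trans (inCocycle-αˡ T g f) (trans (sym (cycle≡cocycle fT gT)) c)) of λ where
                (inj₁ x) → α g , ∈-α gT , fg , x
                (inj₂ x) → ⊥-elim (<-asym (CrossE.f<g x) (subst₂ _<_ (trans (sym (edgeKey-α T g)) (key-first fg)) (key-first ff) lt))

    module Image {S : HSet M} (subS : IsSubgraph M S)
                 (act : ∀ e → lookup S e ≢ lookup T e → activeB M T e ≡ true) where

      O : HSet M
      O = phi M T S

      added-active : ∀ {f} → f ∉ₕ T → f ∈ₕ S → activeB M T f ≡ true
      added-active {f} fT fS = act f λ e → clash fS (trans e fT)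

      removed-active : ∀ {g} → g ∈ₕ T → g ∉ₕ S → activeB M T g ≡ true
      removed-active {g} gT gS = act g λ e → clash (trans e gT) gS

      added-minimal : ∀ {f} → f ∉ₕ T → First f → f ∈ₕ S → ∀ {g} → g ∈ₕ T → First g → ¬ CrossI g f
      added-minimal fT ff fS = active-external⁻ fT ff (added-active fT fS)

      removed-minimal : ∀ {g} → g ∈ₕ T → First g → g ∉ₕ S → ∀ {f} → f ∉ₕ T → First f → ¬ CrossE g f
      removed-minimal gT fg gS = active-internal⁻ gT fg (removed-active gT gS)

      private
        diff : Fin n → Bool
        diff e = lookup S e xor lookup T e

        diffI diffE : Fin n → Fin n → Bool
        diffI e e′ = diff e′ ∧ inCocycle M T e e′
        diffE e e′ = diff e′ ∧ inCycle M T e e′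

        forward-I : ∀ {h} → h ∈ₕ T → forward T S h ≡ not (anyF (diffI h))
        forward-I hT rewrite hT = refl

        forward-E : ∀ {h} → h ∉ₕ T → forward T S h ≡ anyF (diffE h)
        forward-E hT rewrite hT = refl

      phi-first : ∀ {h} → First h → lookup O h ≡ forward T S h
      phi-first {h} F = trans (lookup-phi T S h) (cong (if_then forward T S h else not (forward T S h)) (<ᵇ⁺ F))

      private
        forward-α : ∀ h → forward T S (α h) ≡ forward T S h
        forward-α h with lookup T h in e
        ... | true rewrite trans (sym (subgraph h)) e = cong not (anyF-cong _ _ λ e′ → cong (diff e′ ∧_) (inCocycle-αˡ T h e′))
        ... | false rewrite trans (sym (subgraph h)) e = anyF-cong _ _ λ e′ → cong (diff e′ ∧_) (inCycle-αˡ T h e′)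

        phi-second : ∀ {h} → First h → lookup O (α h) ≡ not (lookup O h)
        phi-second {h} F = trans (lookup-phi T S (α h)) (trans
          (cong (if_then forward T S (α h) else not (forward T S (α h)))
                (≢true⇒false λ lt → <-asym F (subst (λ x → p (α h) < p x) (αα h) (<ᵇ⁻ lt))))
          (cong not (trans (forward-α h) (sym (phi-first F)))))

      orientation : IsOrientation M O
      orientation h with first-or h
      ... | inj₁ F = sym (trans (cong not (phi-second F)) (𝔹.not-involutive (lookup O h)))
      ... | inj₂ F = trans (cong (lookup O) (sym (αα h))) (phi-second F)

      -- An edge of S △ T in the cocycle of `h` is `h` itself or an added external edge. The latter
      -- is active, hence smaller than `h`, which leaves only the crossing `CrossE`.
      internal-flipped : ∀ {h} → h ∈ₕ T → First h → h ∉ₕ O →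
                         h ∉ₕ S ⊎ (∃ λ f → f ∉ₕ T × First f × f ∈ₕ S × CrossE h f)
      internal-flipped {h} hT fh hO with anyF⁻ (diffI h)
        (≢false⇒true λ none → clash (trans (phi-first fh) (trans (forward-I hT) (cong not none))) hO)
      ... | e , q with ∧-true⁻ {diff e} q | bool-cases (lookup T e)
      ...   | d , c | inj₁ eT = inj₁ (trans (sym (onEdge-∈ {S} subS (cocycle-internal hT eT c))) (xor-trueʳ d eT))
      ...   | d , c | inj₂ eT with first-or e
      ...     | inj₁ fe = case cocycle⇒cross hT fh eT fe c of λ where
                  (inj₁ x) → ⊥-elim (added-minimal eT fe (xor-falseʳ d eT) hT fh x)
                  (inj₂ x) → inj₂ (e , eT , fe , xor-falseʳ d eT , x)
      ...     | inj₂ fe = case cocycle⇒cross hT fh (∉-α eT) fe (trans (inCocycle-αʳ T h e) c) of λ where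
                  (inj₁ x) → ⊥-elim (added-minimal (∉-α eT) fe αeS hT fh x)
                  (inj₂ x) → inj₂ (α e , ∉-α eT , fe , αeS , x)
        where
        αeS : α e ∈ₕ S
        αeS = trans (sym (subS e)) (xor-falseʳ d eT)

      internal-removed : ∀ {h} → h ∈ₕ T → First h → h ∉ₕ S → h ∉ₕ O
      internal-removed {h} hT fh hS = trans (phi-first fh) (trans (forward-I hT) (cong not
        (anyF⁺ (diffI h) h (∧-true⁺ (≢⇒xor λ e → clash (trans e hT) hS) (cocycle-self hT)))))

      internal-crossed : ∀ {h f} → h ∈ₕ T → First h → f ∉ₕ T → First f → f ∈ₕ S → CrossE h f → h ∉ₕ O
      internal-crossed {h} {f} hT fh fT ff fS c = trans (phi-first fh) (trans (forward-I hT) (cong not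
        (anyF⁺ (diffI h) f (∧-true⁺ (≢⇒xor λ e → clash fS (trans e fT)) (crossE⇒cocycle hT fh fT ff c)))))

      -- Dually, an internal edge of S △ T in the cycle of `h` has been removed, so it is active and
      -- smaller than `h`; only `CrossI` remains.
      external-flipped : ∀ {h} → h ∉ₕ T → First h → h ∈ₕ O →
                         h ∈ₕ S ⊎ (∃ λ g → g ∈ₕ T × First g × g ∉ₕ S × CrossI g h)
      external-flipped {h} hT fh hO with anyF⁻ (diffE h) (trans (sym (forward-E hT)) (trans (sym (phi-first fh)) hO))
      ... | e , q with ∧-true⁻ {diff e} q | bool-cases (lookup T e)
      ...   | d , c | inj₂ eT = inj₁ (trans (sym (onEdge-∈ {S} subS (cycle-external hT eT c))) (xor-falseʳ d eT))
      ...   | d , c | inj₁ eT with first-or e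
      ...     | inj₁ fe = case cocycle⇒cross eT fe hT fh (trans (sym (cycle≡cocycle hT eT)) c) of λ where
                  (inj₁ x) → inj₂ (e , eT , fe , xor-trueʳ d eT , x)
                  (inj₂ x) → ⊥-elim (removed-minimal eT fe (xor-trueʳ d eT) hT fh x)
      ...     | inj₂ fe = case cocycle⇒cross (∈-α eT) fe hT fh
                  (trans (inCocycle-αˡ T e h) (trans (sym (cycle≡cocycle hT eT)) c)) of λ where
                  (inj₁ x) → inj₂ (α e , ∈-α eT , fe , αeS , x)
                  (inj₂ x) → ⊥-elim (removed-minimal (∈-α eT) fe αeS hT fh x)
        where
        αeS : α e ∉ₕ S
        αeS = trans (sym (subS e)) (xor-trueʳ d eT)

      external-added : ∀ {h} → h ∉ₕ T → First h → h ∈ₕ S → h ∈ₕ O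
      external-added {h} hT fh hS = trans (phi-first fh) (trans (forward-E hT)
        (anyF⁺ (diffE h) h (∧-true⁺ (≢⇒xor λ e → clash hS (trans e hT)) (cycle-self hT))))

      external-crossed : ∀ {h g} → h ∉ₕ T → First h → g ∈ₕ T → First g → g ∉ₕ S → CrossI g h → h ∈ₕ O
      external-crossed {h} {g} hT fh gT fg gS c = trans (phi-first fh) (trans (forward-E hT)
        (anyF⁺ (diffE h) g (∧-true⁺ (≢⇒xor λ e → clash (trans e gT) gS)
          (trans (cycle≡cocycle hT gT) (crossI⇒cocycle gT fg hT fh c)))))

-- Directed cuts, and connectivity of Φ(S)

module Orientations (M : RootedMap) where
  open Activities M public

  record Interval (T S : HSet M) : Set where
    constructor mkInterval
    field
      tree : SpanningTree T
      subS : IsSubgraph M S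
      act  : ∀ e → lookup S e ≢ lookup T e → activeB M T e ≡ true

  interval⁻ : ∀ {T S} → InInterval M T S → Interval T S
  interval⁻ {T} (tr , sub , act) = mkInterval (tree⁻ T tr) sub act

  interval⁺ : ∀ {T S} → Interval T S → InInterval M T S
  interval⁺ (mkInterval tr sub act) = tree⁺ tr , sub , act

  tail-unique : ∀ {O h} → IsOrientation M O → h ∈ₕ O → α h ∉ₕ O
  tail-unique {O} {h} or hO = trans (or (α h)) (cong not (trans (cong (lookup O) (αα h)) hO))

  tail-other : ∀ {O h} → IsOrientation M O → h ∉ₕ O → α h ∈ₕ O
  tail-other {O} {h} or hO = trans (or (α h)) (cong not (trans (cong (lookup O) (αα h)) hO))

  OutCut : HSet M → HalfEdges → Set
  OutCut O X = ∀ h → X h ≡ true → X (α h) ≡ false → h ∈ₕ O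

  outcut-no-entry : ∀ {O X x y} → IsOrientation M O → VertexSet X → OutCut O X →
                    Reaches (lookup O) x y → X x ≡ false → X y ≡ false
  outcut-no-entry {O} {X} or vX cut r x∉ = not-true⁻ (closed-reaches (compl-VertexSet {X} vX) closed r (not-true⁺ x∉))
    where
    closed : ClosedUnder (lookup O) (compl X)
    closed h h∉ hO = not-true⁺ (≢true⇒false λ in′ →
      clash (cut (α h) in′ (trans (cong X (αα h)) (not-true⁻ h∉))) (tail-unique {O} or hO))

  module Phi {T S : HSet M} (I : Interval T S) where
    open Interval I public
    open Tree tree public
    open Image {S} subS act public

    nested : ∀ {g h} → g ∈ₕ T → First g → h ∈ₕ T → p g < p h → p h < p (α g) → p g < p (α h) × p (α h) < p (α g)
    nested {g} {h} gT fg hT lo hi =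
      let a , b = subtree⁻ g (α h) (trans (subtree-internal gT fg hT off) (subtree⁺ g h lo (<⇒≤ hi)))
      in a , ≤∧≢⇒< b λ e → <-irrefl (cong p (sym (α-injective (p-injective e)))) lo
      where
      off : onEdge g h ≡ false
      off = ≢true⇒false λ on → case onEdge⁻ g h on of λ where
        (inj₁ refl) → <-irrefl refl lo
        (inj₂ refl) → <-irrefl refl hi

    t-vertex : ∀ {X g} → VertexSet X → g ∈ₕ T → X (t g) ≡ X (α g)
    t-vertex {X} {g} vX gT = trans (cong X (motion-in {T} gT)) (vX (α g))

    p-t : ∀ {g} → First g → p (t g) ≡ suc (p g)
    p-t {g} fg = p-step g (≤-<-trans fg (pos<n (α g)))

    root-first : ∀ x → p h₀ ≤ p x
    root-first x = ≤-trans (≤-reflexive p-root) z≤n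

    root-path : ∀ {W} → VertexSet W → ∀ {y} → W h₀ ≡ false → W y ≡ true →
                ∃ λ g → g ∈ₕ T × W g ≡ false × W (α g) ≡ true × p g < p y × p y ≤ p (α g)
    root-path vW {y} a b = case path-entry vW (root-first y) a b of λ where
      (g , gT , c , d , inj₁ (_ , lo , hi)) → g , gT , c , d , lo , hi
      (g , gT , c , d , inj₂ (lt , _)) → ⊥-elim (<⇒≱ lt (root-first (α g)))

    -- min says that f is externally active.
    module _ {f : Fin n} (fT : f ∉ₕ T) (ff : First f) (min : ∀ {g} → g ∈ₕ T → First g → ¬ CrossI g f) where

      -- The tree path from `f` to `α f` runs downwards only: an edge traversed upwards would have
      -- been met before `f` and would cross it, against minimality of `f` in its cycle.
      fundamental-entry : ∀ {W} → VertexSet W → W f ≡ false → W (α f) ≡ true →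
                          ∃ λ g → g ∈ₕ T × First g × CrossE g f × W g ≡ false × W (α g) ≡ true
      fundamental-entry vW a b = case path-entry vW (<⇒≤ ff) a b of λ where
        (g , gT , c , d , inj₁ (lo , mid , hi)) → g , gT , <-≤-trans mid hi ,
          crossE (≤∧≢⇒< lo (p-≢ gT fT ∘ sym)) mid (≤∧≢⇒< hi (p-≢ (∈-α gT) (∉-α fT) ∘ sym)) , c , d
        (g , gT , c , d , inj₂ (lo , mid , hi)) → ⊥-elim (min (∈-α gT) (first-flip (<-≤-trans lo mid)) (crossI lo
          (<-≤-trans (≤∧≢⇒< mid (p-≢ gT fT ∘ sym)) (≤-reflexive (p-αα g))) (≤-<-trans (≤-reflexive (sym (p-αα g))) hi)))

      upward-path : ∀ {m} → (∀ g → g ∈ₕ T → First g → CrossE g f → m (α g) ≡ true) → Reaches m (α f) f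
      upward-path {m} mv = reachSet⁻ m (α f) f (≢false⇒true λ out →
        let g , gT , fg , c , a , b = fundamental-entry (reachSet-vertexSet m (α f)) out (reachSet-start m (α f))
        in clash (trans (cong (lookup (reachSet M m (α f))) (sym (αα g))) (reachSet-closed m (α f) (α g) b (mv g gT fg c))) a)

      downward-path : ∀ {m} → (∀ g → g ∈ₕ T → First g → CrossE g f → m g ≡ true) → Reaches m f (α f)
      downward-path {m} mv = reachSet⁻ m f (α f) (≢false⇒true λ out →
        let g , gT , fg , c , a , b = fundamental-entry (compl-VertexSet {lookup (reachSet M m f)} (reachSet-vertexSet m f))
                                        (cong not (reachSet-start m f)) (not-true⁺ out)
        in clash (reachSet-closed m f g (≢false⇒true λ e → clash (not-true⁺ e) a) (mv g gT fg c)) (not-true⁻ b))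

    module _ {f : Fin n} (fT : f ∉ₕ T) (ff : First f) (fS : f ∈ₕ S) where
      private
        min = added-minimal fT ff fS

        flipped : ∀ {g} → g ∈ₕ T → First g → CrossE g f → α g ∈ₕ O
        flipped gT fg c = tail-other {O} orientation (internal-crossed gT fg fT ff fS c)

      -- All tree edges of the fundamental cycle are turned upwards by `f`. The extra conjuncts
      -- record that the return path is internal, for the comparison of two trees, and that it is
      -- met after `f`, which makes `f` the smallest half-edge of the cycle.
      added-cycle : Reaches (λ z → lookup O z ∧ (lookup T z ∧ ((p f <ᵇ p z) ∧ (p f <ᵇ p (α z))))) (α f) f
      added-cycle = upward-path fT ff min λ { g gT fg c@(crossE a b d) → ∧-true⁺ (flipped gT fg c) (∧-true⁺ (∈-α gT)
        (∧-true⁺ (<ᵇ⁺ (<-trans a fg)) (<ᵇ⁺ (<-≤-trans a (≤-reflexive (p-αα g)))))) }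

      added-on-cycle : Reaches (lookup O) (α f) f
      added-on-cycle = reaches-mono (λ z e → proj₁ (∧-true⁻ e)) added-cycle

      -- The edge of `g` is directed from `α g` to `g` on the fundamental cycle of `f`. The
      -- remainder of that cycle goes up from `g` to `f`, across `f`, and up from `α f` to `α g`.
      crossed-on-cycle : ∀ {g} → g ∈ₕ T → First g → CrossE g f → Reaches (lookup O) g (α g)
      crossed-on-cycle {g} gT fg (crossE f<g g<f′ f′<g′) = reachSet⁻ (lookup O) g (α g) (≢false⇒true impossible)
        where
        R = lookup (reachSet M (lookup O) g)
        vR = reachSet-vertexSet (lookup O) g
        clR = reachSet-closed (lookup O) g
        no-entry : ∀ {z} → z ∈ₕ T → First z → CrossE z f → R z ≡ false → R (α z) ≡ true → ⊥
        no-entry {z} zT fz c out in′ = clash (trans (cong R (sym (αα z))) (clR (α z) in′ (flipped zT fz c))) out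
        impossible : R (α g) ≡ false → ⊥
        impossible g′∉ = [ inside , outside ]′ (bool-cases (R f))
          where
          -- If `f` were missed, the tree path from `f` down to `g` would enter `R` on an edge that
          -- `f` has turned upwards.
          outside : R f ≡ false → ⊥
          outside f∉ = case path-entry vR (<⇒≤ f<g) f∉ (reachSet-start (lookup O) g) of λ where
            (z , zT , a , b , inj₂ (y , y′ , w)) → min (∈-α zT) (first-flip (<-≤-trans y y′)) (crossI y
                (<-≤-trans (≤∧≢⇒< y′ (p-≢ zT fT ∘ sym)) (≤-reflexive (p-αα z)))
                (≤-<-trans (≤-reflexive (sym (p-αα z))) (<-trans w g<f′)))
            (z , zT , a , b , inj₁ (lo , mid , hi)) →
              let fz = <-≤-trans mid hi
                  g<z′ = ≤∧≢⇒< hi λ e → <-asym fg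
                           (≤-<-trans (≤-reflexive (cong p (trans (cong α (p-injective e)) (αα z)))) mid)
              in no-entry zT fz (crossE (≤∧≢⇒< lo (p-≢ zT fT ∘ sym)) (<-trans mid g<f′)
                   (<-trans f′<g′ (proj₂ (nested zT fz gT mid g<z′)))) a b
          -- Likewise for the path down to `α f` from the vertex of `α g`, represented by `t g`
          -- because its position is `p g + 1`.
          inside : R f ≡ true → ⊥
          inside f∈ = case path-entry vR (≤-trans (≤-reflexive (p-t fg)) g<f′)
                             (trans (t-vertex {R} vR gT) g′∉) (clR f f∈ (external-added fT ff fS)) of λ where
            (z , zT , a , b , inj₁ (lo , mid , hi)) → no-entry zT (<-≤-trans mid hi)
                (crossE (<-trans f<g (<-≤-trans (≤-reflexive (sym (p-t fg))) lo)) mid (≤∧≢⇒< hi (p-≢ (∈-α zT) (∉-α fT) ∘ sym))) a b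
            (z , zT , a , b , inj₂ (z′<tg , tg≤z , z<f′)) → <⇒≱
                (proj₁ (nested gT fg zT (<-≤-trans (≤-reflexive (sym (p-t fg))) tg≤z) (<-trans z<f′ f′<g′)))
                (≤-pred (<-≤-trans z′<tg (≤-reflexive (p-t fg))))

    -- The cocycle of `g` is directed out of its subtree: `g` is reversed, and an external edge of
    -- the cocycle, being larger than the active `g`, is oriented from its first half-edge, which
    -- lies inside.
    removed-cut : ∀ {g} → g ∈ₕ T → First g → g ∉ₕ S → OutCut O (subtree g)
    removed-cut {g} gT fg gS h in′ out = case bool-cases (lookup T h) of λ where
      (inj₁ hT) → subst (_∈ₕ O) (sym (α-swap (subtree-entry gT fg (∈-α hT) out (trans (cong (subtree g) (αα h)) in′))))
                    (tail-other {O} orientation (internal-removed gT fg gS))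
      (inj₂ hT) → case leaving gT fg hT in′ out of λ where
        (inj₁ (fh , c)) → external-crossed hT fh gT fg gS c
        (inj₂ (fh , c)) → ⊥-elim (removed-minimal gT fg gS (∉-α hT) fh c)

    internal-flip : ∀ {h} → h ∈ₕ T → First h → h ∉ₕ O → h ∉ₕ S ⊎ Reaches (lookup O) h (α h)
    internal-flip hT fh hO = case internal-flipped hT fh hO of λ where
      (inj₁ hS) → inj₁ hS
      (inj₂ (f , fT , ff , fS , c)) → inj₂ (crossed-on-cycle fT ff fS hT fh c)

    external-flip : ∀ {h} → h ∉ₕ T → First h → h ∈ₕ O → h ∈ₕ S ⊎
                    (∃ λ g → g ∈ₕ T × g ∉ₕ S × OutCut O (subtree g) × VertexSet (subtree g)
                             × subtree g h ≡ true × subtree g (α h) ≡ false)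
    external-flip {h} hT fh hO = case external-flipped hT fh hO of λ where
      (inj₁ hS) → inj₁ hS
      (inj₂ (g , gT , fg , gS , crossI a b c)) →
        inj₂ (g , gT , gS , removed-cut gT fg gS , subtree-vertexSet gT fg , subtree⁺ g h a (<⇒≤ b) , subtree-after g (α h) c)

    -- An edge on a directed cycle lies in no directed cut.
    external-flip-cyclic : ∀ {h} → h ∉ₕ T → First h → h ∈ₕ O → Reaches (lookup O) (α h) h → h ∈ₕ S
    external-flip-cyclic hT fh hO r = case external-flip hT fh hO of λ where
      (inj₁ hS) → hS
      (inj₂ (g , _ , _ , cut , vX , a , b)) → clash a (outcut-no-entry {O} orientation vX cut r b)

    first-of : ∀ h → ∃ λ r → First r × (∀ S → IsSubgraph M S → lookup S r ≡ lookup S h) × activeB M T r ≡ activeB M T h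
    first-of h with first-or h
    ... | inj₁ F = h , F , (λ _ _ → refl) , refl
    ... | inj₂ F = α h , F , (λ _ sub → sym (sub h)) , activeB-α h

    T⊆S : Set
    T⊆S = ∀ g → g ∈ₕ T → g ∈ₕ S

    S⊆T : Set
    S⊆T = ∀ f → f ∈ₕ S → f ∈ₕ T

    T⊆S-by-first : (∀ g → g ∈ₕ T → First g → g ∈ₕ S) → T⊆S
    T⊆S-by-first k g gT = let r , fr , same , _ = first-of g in
      trans (sym (same S subS)) (k r (trans (same T subgraph) gT) fr)

    S⊆T-by-first : (∀ f → f ∉ₕ T → First f → f ∉ₕ S) → S⊆T
    S⊆T-by-first k f fS = ≢false⇒true λ fT → let r , fr , same , _ = first-of f in
      clash fS (trans (sym (same S subS)) (k r (trans (same T subgraph) fT) fr))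

    V0⇒T⊆S : V0Connected M O → T⊆S
    V0⇒T⊆S v0 = T⊆S-by-first λ g gT fg → ≢false⇒true λ gS → clash (subtree-α fg)
      (outcut-no-entry {O} orientation (subtree-vertexSet gT fg) (removed-cut gT fg gS)
        (reachSet⁻ (lookup O) h₀ (α g) (v0 (α g))) (subtree-root g))

    -- On a root path, an internal edge leaving the reachable set must point back. As it is not
    -- removed, it lies on a directed cycle, which leads to its far end nevertheless.
    T⊆S⇒V0 : T⊆S → V0Connected M O
    T⊆S⇒V0 sub h = ≢false⇒true λ h∉ →
      let g , gT , a , b , lo , hi = root-path (compl-VertexSet {R} (reachSet-vertexSet (lookup O) h₀))
                                       (cong not (reachSet-start (lookup O) h₀)) (not-true⁺ h∉)
          g∈ = ≢false⇒true (λ e → clash (not-true⁺ e) a)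
          fg = <-≤-trans lo hi
          gO = ≢true⇒false λ gO → clash (clR g g∈ gO) (not-true⁻ b)
      in case internal-flip gT fg gO of λ where
           (inj₁ gS) → clash (sub g gT) gS
           (inj₂ r)  → clash (closed-reaches (reachSet-vertexSet (lookup O) h₀) clR r g∈) (not-true⁻ b)
      where
      R = lookup (reachSet M (lookup O) h₀)
      clR = reachSet-closed (lookup O) h₀

    NoInternalActive NoExternalActive : Set
    NoInternalActive = ∀ g → g ∈ₕ T → activeB M T g ≡ false
    NoExternalActive = ∀ f → f ∉ₕ T → activeB M T f ≡ false

    no-internal⇒T⊆S : NoInternalActive → T⊆S
    no-internal⇒T⊆S none g gT = ≢false⇒true λ gS → clash (removed-active gT gS) (none g gT)

    no-external⇒S⊆T : NoExternalActive → S⊆T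
    no-external⇒S⊆T none f fS = ≢false⇒true λ fT → clash (added-active fT fS) (none f fT)

    -- Since T ⊆ S, no internal edge is removed. An active `g` would then point into its subtree,
    -- and so would every external edge of its cocycle; the root could not be reached from below.
    strong⇒no-internal : StronglyConnected M O → NoInternalActive
    strong⇒no-internal sc h hT = ≢true⇒false λ active →
      let g , fg , same , act≡ = first-of h in impossible fg (trans (same T subgraph) hT) (trans act≡ active)
      where
      T⊆ : T⊆S
      T⊆ = V0⇒T⊆S λ x → sc h₀ x
      impossible : ∀ {g} → First g → g ∈ₕ T → activeB M T g ≡ true → ⊥
      impossible {g} fg gT active = clash (closed-reaches (subtree-vertexSet gT fg) closed
          (reachSet⁻ (lookup O) (α g) h₀ (sc (α g) h₀)) (subtree-α fg)) (subtree-root g)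
        where
        uncrossed : ∀ {f} → f ∉ₕ T → First f → ¬ CrossE g f
        uncrossed = active-internal⁻ gT fg active
        closed : ClosedUnder (lookup O) (subtree g)
        closed x in′ xO = ≢false⇒true λ out → case bool-cases (lookup T x) of λ where
          (inj₁ xT) → case internal-flipped gT fg (≢true⇒false λ gO → clash
                (subst (_∈ₕ O) (α-swap (subtree-entry gT fg (∈-α xT) out (trans (cong (subtree g) (αα x)) in′))) xO)
                (tail-unique {O} orientation gO)) of λ where
              (inj₁ gS) → clash (T⊆ g gT) gS
              (inj₂ (f , fT , ff , _ , c)) → uncrossed fT ff c
          (inj₂ xT) → case leaving gT fg xT in′ out of λ where
              (inj₂ (fx , c)) → uncrossed (∉-α xT) fx c
              (inj₁ (fx , c)) → case external-flip xT fx xO of λ where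
                (inj₁ xS) → added-minimal xT fx xS gT fg c
                (inj₂ (g′ , g′T , g′S , _)) → clash (T⊆ g′ g′T) g′S

    -- As T ⊆ S makes everything reachable from the root, it remains to reach the root. Otherwise
    -- the first edge of the tour on the border of the reachable set `R` gives a contradiction.
    no-internal⇒strong : NoInternalActive → StronglyConnected M O
    no-internal⇒strong none h h′ = reachSet⁺ (lookup O) (reaches-trans
        (reachSet⁻ (lookup O) h h₀ (≢false⇒true impossible)) (reachSet⁻ (lookup O) h₀ h′ (T⊆S⇒V0 T⊆ h′)))
      where
      T⊆ : T⊆S
      T⊆ = no-internal⇒T⊆S none
      R = lookup (reachSet M (lookup O) h)
      vR = reachSet-vertexSet (lookup O) h
      clR = reachSet-closed (lookup O) h
      cut : Fin n → Bool
      cut z = R z xor R (α z)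
      impossible : R h₀ ≡ false → ⊥
      impossible root∉ =
        let g₀ , g₀T , a₀ , b₀ , _ = root-path vR root∉ (reachSet-start (lookup O) h)
            k , k≤ , ek , below = least (λ k → cut (at k)) (p g₀)
              (trans (cong cut (at-pos g₀)) (≢⇒xor λ eq → clash b₀ (trans (sym eq) a₀)))
        in smallest (at k) ek λ z z<k → xor-false⇒≡ (trans (cong cut (sym (at-pos z)))
             (below (p z) (subst (p z <_) (pos-at k (≤-<-trans k≤ (pos<n g₀))) z<k)))
        where
        smallest : ∀ e → cut e ≡ true → (∀ z → p z < p e → R z ≡ R (α z)) → ⊥
        smallest e e-cut below = case bool-cases (lookup T e) of λ where
            (inj₂ eT) → case external-flip eT fe eO of λ where
              (inj₁ eS) → clash (closed-reaches vR clR (added-on-cycle eT fe eS) e′∈) e∉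
              (inj₂ (g , gT , gS , _)) → clash (T⊆ g gT) gS
            (inj₁ eT) → let f , fT , ff , c = inactive-internal eT fe (none e eT) in crossing eT fT c
          where
          -- The edges of a root path precede its end in the tour, and no edge before `e` is on the
          -- border; so everything visited up to `e` is outside `R`.
          outside : ∀ z → p z ≤ p e → R z ≡ false
          outside z z≤e = ≢true⇒false λ z∈ →
            let g , gT , a , b , lo , _ = root-path vR root∉ z∈
            in clash (trans (below g (<-≤-trans lo z≤e)) b) a
          e∉ = outside e ≤-refl
          e′∈ : R (α e) ≡ true
          e′∈ = ≢false⇒true λ e′∉ → xor-true⇒≢ e-cut (trans e∉ (sym e′∉))
          fe : First e
          fe = ≰⇒> λ le → clash e′∈ (outside (α e) le)
          eO : e ∈ₕ O
          eO = ≢false⇒true λ e∉O → clash (trans (cong R (sym (αα e))) (clR (α e) e′∈ (tail-other {O} orientation e∉O))) e∉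
          -- `f` comes before `e`, so it is not on the border and `α f` is outside `R`, though below
          -- `e`. The tree path to it from the lower end of `e`, which is in `R`, leaves `R` on an
          -- edge pointing upwards; that edge lies on a directed cycle and so cannot leave `R`.
          crossing : ∀ {f} → e ∈ₕ T → f ∉ₕ T → CrossE e f → ⊥
          crossing {f} eT fT (crossE f<e e<f′ f′<e′) =
            case path-entry (compl-VertexSet {R} vR) (≤-trans (≤-reflexive (p-t fe)) e<f′)
                   (cong not (trans (t-vertex {R} vR eT) e′∈))
                   (not-true⁺ (trans (sym (below f f<e)) (outside f (<⇒≤ f<e)))) of λ where
            (g , gT , a , b , inj₂ (g′<te , te≤g , g<f′)) → <⇒≱
                  (proj₁ (nested eT fe gT (<-≤-trans (≤-reflexive (sym (p-t fe))) te≤g) (<-trans g<f′ f′<e′)))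
                  (≤-pred (<-≤-trans g′<te (≤-reflexive (p-t fe))))
            (g , gT , a , b , inj₁ (lo , mid , hi)) →
                  let g∈ = ≢false⇒true (λ e → clash (not-true⁺ e) a)
                  in case internal-flip gT (<-≤-trans mid hi) (≢true⇒false λ gO → clash (clR g g∈ gO) (not-true⁻ b)) of λ where
                    (inj₁ gS) → clash (T⊆ g gT) gS
                    (inj₂ r)  → clash (closed-reaches vR clR r g∈) (not-true⁻ b)

-- The cyclic successor, and directed cycles of orientations

private
  shift : ∀ {k} → Fin (suc k) → Fin (suc (suc k))
  shift zero    = zero
  shift (suc j) = suc (suc j)

  next-suc : ∀ {k} (i : Fin (suc k)) → next (suc i) ≡ shift (next i)
  next-suc i with next i
  ... | zero  = refl
  ... | suc j = refl

  shift≢1 : ∀ {k} (i : Fin (suc k)) → suc zero ≢ shift i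
  shift≢1 zero    ()
  shift≢1 (suc i) ()

  shift-injective : ∀ {k} {i j : Fin (suc k)} → shift i ≡ shift j → i ≡ j
  shift-injective {i = zero}  {zero}  e = refl
  shift-injective {i = suc i} {suc .i} refl = refl

next-injective : ∀ {k} → Injective _≡_ _≡_ (next {k})
next-injective {zero}  {zero}  {zero}  e = refl
next-injective {suc k} {zero}  {zero}  e = refl
next-injective {suc k} {zero}  {suc j} e = ⊥-elim (shift≢1 (next j) (trans e (next-suc j)))
next-injective {suc k} {suc i} {zero}  e = ⊥-elim (shift≢1 (next i) (trans (sym e) (next-suc i)))
next-injective {suc k} {suc i} {suc j} e =
  cong suc (next-injective (shift-injective (trans (sym (next-suc i)) (trans e (next-suc j)))))

countF-next : ∀ {k} (q : Fin (suc k) → Bool) → countF (q ∘ next) ≡ countF q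
countF-next q = trans (sym (countF-image next next-injective q)) (countF-cong λ j → cong (_∧ q j)
  (let p , _ , e = period next-injective j in anyF⁺ (λ i → next i == j) (iter p next j) (==⁺ e)))

module Cycles (M : RootedMap) where
  open Orientations M public

  module OnCycle {O : HSet M} (C : DirCycle M O) where
    open DirCycle C public renaming (t to tail)

    link-vset : ∀ {X} → VertexSet X → ∀ i → X (α (tail i)) ≡ X (tail (next i))
    link-vset vX i = vset-sameV vX (α (tail i)) (tail (next i)) (link i)

    around : ∀ (i : Fin (suc len)) → ∃ λ k → iter k next (next i) ≡ i
    around i = let p , _ , e = period next-injective i in p , trans (sym (iter-suc p next i)) e

    recross : ∀ {X} → VertexSet X → ∀ i → X (tail i) ≡ false → X (α (tail i)) ≡ true →
              ∃ λ j → X (tail j) ≡ true × X (α (tail j)) ≡ false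
    recross {X} vX i out in′ with search (λ j → X (tail j) ∧ not (X (α (tail j))))
    ... | inj₁ (j , e) = j , proj₁ (∧-true⁻ e) , not-true⁻ (proj₂ (∧-true⁻ {X (tail j)} e))
    ... | inj₂ none = clash (home (around i)) out
      where
      stays : ∀ k → X (tail (iter k next (next i))) ≡ true
      stays zero    = trans (sym (link-vset vX i)) in′
      stays (suc k) = trans (sym (link-vset vX (iter k next (next i)))) (≢false⇒true λ f →
        clash (∧-true⁺ (stays k) (not-true⁺ f)) (none (iter k next (next i))))
      home : (∃ λ k → iter k next (next i) ≡ i) → X (tail i) ≡ true
      home (k , e) = trans (cong (X ∘ tail) (sym e)) (stays k)

    cyclic : ∀ i → Reaches (lookup O) (α (tail i)) (tail i)
    cyclic i = home (around i)
      where
      go : ∀ k → Reaches (lookup O) (α (tail i)) (tail (iter k next (next i)))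
      go zero    = sameV-reaches _ _ (link i)
      go (suc k) = let j = iter k next (next i) in
        reaches-trans (cross (tails j) (go k)) (sameV-reaches _ _ (link j))
      home : (∃ λ k → iter k next (next i) ≡ i) → Reaches (lookup O) (α (tail i)) (tail i)
      home (k , e) = subst (Reaches (lookup O) (α (tail i))) (cong tail e) (go k)

  -- Loop erasure, keeping the half-edge g.
  module _ {m : HalfEdges} {g : Fin n} where
    private
      Chain : Fin n → List (Fin n) → Set
      Chain x []       = sameV M x g ≡ true
      Chain x (z ∷ zs) = sameV M x z ≡ true × m z ≡ true × Chain (α z) zs

      -- The vertices also avoid that of `g`, since `g` is to be put in front of the list. For the
      -- empty list the condition is an equation that always holds.
      Distinct : List (Fin n) → Set
      Distinct []       = sameV M g g ≡ true
      Distinct (z ∷ zs) = All (λ y → sameV M z y ≡ false) zs × sameV M g z ≡ false × Distinct zs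

      SimpleWalk : Fin n → Set
      SimpleWalk x = ∃ λ zs → Chain x zs × Distinct zs

      relocate : ∀ {x y} → sameV M x y ≡ true → SimpleWalk y → SimpleWalk x
      relocate {x} {y} e ([] , c , d)               = [] , sameV-trans x y g e c , d
      relocate {x} {y} e (z ∷ zs , (s , mz , c) , d) = z ∷ zs , (sameV-trans x y z e s , mz , c) , d

      shortcut : ∀ {x} y zs → Chain x zs → Distinct zs → SimpleWalk y ⊎ All (λ z → sameV M y z ≡ false) zs
      shortcut y [] c d = inj₂ []
      shortcut y (z ∷ zs) (s , mz , c) (a , b , d) with bool-cases (sameV M y z)
      ... | inj₁ e = inj₁ (z ∷ zs , (e , mz , c) , (a , b , d))
      ... | inj₂ f with shortcut y zs c d
      ...   | inj₁ w = inj₁ w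
      ...   | inj₂ fs = inj₂ (f ∷ fs)

      -- At the vertex of `g` the rest of the walk is discarded, and if the vertex of `y` recurs
      -- later, the loop up to there is cut out.
      prepend : ∀ y → m y ≡ true → SimpleWalk (α y) → SimpleWalk y
      prepend y my (zs , c , d) with bool-cases (sameV M g y)
      ... | inj₁ e = [] , sameV-sym g y e , sameV-refl g
      ... | inj₂ f with shortcut y zs c d
      ...   | inj₁ w  = w
      ...   | inj₂ fs = y ∷ zs , (sameV-refl y , my , c) , (fs , f , d)

      simplify : ∀ {x y} → Reaches m x y → SimpleWalk y → SimpleWalk x
      simplify here w = w
      simplify (fwd {y} r) w = simplify r (relocate (sameV⁺ 1 refl) w)
      simplify (bwd {y} r) w = simplify r (relocate (sameV-sym (σ⁻¹ y) y (sameV⁺ 1 (σσ⁻ y))) w)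
      simplify (cross {y} my r) w = simplify r (prepend y my w)

      links : ∀ z zs → Chain (α z) zs → ∀ i → sameV M (α (L.lookup (z ∷ zs) i)) (L.lookup (g ∷ zs) (next i)) ≡ true
      links z [] c zero = c
      links z (y ∷ zs) (s , _ , c) zero = s
      links z (y ∷ zs) (s , _ , c) (suc i) with next i | links y zs c i
      ... | zero  | q = q
      ... | suc j | q = q

      moves : ∀ {x} zs → Chain x zs → ∀ i → m (L.lookup zs i) ≡ true
      moves (z ∷ zs) (_ , mz , c) zero    = mz
      moves (z ∷ zs) (_ , mz , c) (suc i) = moves zs c i

      apart : ∀ {z} zs → All (λ y → sameV M z y ≡ false) zs → ∀ i → sameV M z (L.lookup zs i) ≡ false
      apart (y ∷ zs) (e ∷ es) zero    = e
      apart (y ∷ zs) (e ∷ es) (suc i) = apart zs es i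

      apart-g : ∀ zs → Distinct zs → ∀ i → sameV M g (L.lookup zs i) ≡ false
      apart-g (z ∷ zs) (_ , e , d) zero    = e
      apart-g (z ∷ zs) (_ , e , d) (suc i) = apart-g zs d i

      distinct : ∀ zs → Distinct zs → ∀ i j → sameV M (L.lookup zs i) (L.lookup zs j) ≡ true → i ≡ j
      distinct (z ∷ zs) (a , b , d) zero    zero    e = refl
      distinct (z ∷ zs) (a , b , d) zero    (suc j) e = clash e (apart zs a j)
      distinct (z ∷ zs) (a , b , d) (suc i) zero    e = clash (sameV-sym (L.lookup zs i) z e) (apart zs a i)
      distinct (z ∷ zs) (a , b , d) (suc i) (suc j) e = cong suc (distinct zs d i j e)

    -- All tails other than `g` come from the given walk, so whatever is built into `m` remains true
    -- along the cycle.
    extract-cycle : ∀ {O} → (∀ z → m z ≡ true → z ∈ₕ O) → g ∈ₕ O → Reaches m (α g) g →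
                    Σ (DirCycle M O) λ C → (∃ λ i → DirCycle.t C i ≡ g)
                                           × (∀ i → DirCycle.t C i ≡ g ⊎ m (DirCycle.t C i) ≡ true)
    extract-cycle {O} m⊆O gO r = build (simplify r ([] , sameV-refl g , sameV-refl g))
      where
      build : SimpleWalk (α g) → Σ (DirCycle M O) λ C → (∃ λ i → DirCycle.t C i ≡ g)
                                           × (∀ i → DirCycle.t C i ≡ g ⊎ m (DirCycle.t C i) ≡ true)
      build (zs , c , d) = record { len = L.length zs ; t = L.lookup (g ∷ zs) ; tails = is-tail
                                  ; link = links g zs c ; simple = simple } , (zero , refl) , sort
        where
        sort : ∀ i → L.lookup (g ∷ zs) i ≡ g ⊎ m (L.lookup (g ∷ zs) i) ≡ true
        sort zero    = inj₁ refl
        sort (suc i) = inj₂ (moves zs c i)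
        is-tail : ∀ i → L.lookup (g ∷ zs) i ∈ₕ O
        is-tail zero    = gO
        is-tail (suc i) = m⊆O _ (moves zs c i)
        simple : ∀ i j → sameV M (L.lookup (g ∷ zs) i) (L.lookup (g ∷ zs) j) ≡ true → i ≡ j
        simple zero    zero    e = refl
        simple zero    (suc j) e = clash e (apart-g zs d j)
        simple (suc i) zero    e = clash (sameV-sym (L.lookup zs i) g e) (apart-g zs d i)
        simple (suc i) (suc j) e = cong suc (distinct zs d i j e)

  module Reverse {O : HSet M} (or : IsOrientation M O) (C : DirCycle M O) where
    open OnCycle C

    onTail : HalfEdges
    onTail h = anyF (λ i → tail i == h)

    onHead : HalfEdges
    onHead h = anyF (λ i → α (tail i) == h)

    onTail⁻ : ∀ {h} → onTail h ≡ true → ∃ λ i → tail i ≡ h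
    onTail⁻ {h} e = let i , q = anyF⁻ (λ i → tail i == h) e in i , ==⁻ (tail i) h q

    onHead⁻ : ∀ {h} → onHead h ≡ true → ∃ λ i → α (tail i) ≡ h
    onHead⁻ {h} e = let i , q = anyF⁻ (λ i → α (tail i) == h) e in i , ==⁻ (α (tail i)) h q

    onTail⁺ : ∀ i → onTail (tail i) ≡ true
    onTail⁺ i = anyF⁺ (λ j → tail j == tail i) i (==-refl (tail i))

    onTail-α : ∀ h → onTail (α h) ≡ onHead h
    onTail-α h = bool-ext
      (λ e → let i , q = onTail⁻ e in anyF⁺ (λ i → α (tail i) == h) i (==⁺ (trans (cong α q) (αα h))))
      (λ e → let i , q = onHead⁻ e in anyF⁺ (λ i → tail i == α h) i (==⁺ (α-swap q)))

    onTail⇒tail : ∀ {h} → onTail h ≡ true → h ∈ₕ O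
    onTail⇒tail e = let i , q = onTail⁻ e in subst (_∈ₕ O) q (tails i)

    onHead⇒head : ∀ {h} → onHead h ≡ true → h ∉ₕ O
    onHead⇒head e = let i , q = onHead⁻ e in subst (_∉ₕ O) q (tail-unique {O} or (tails i))

    revB : HalfEdges
    revB h = not (onTail h) ∧ (onHead h ∨ lookup O h)

    reversed : HSet M
    reversed = tabulate revB

    lookup-reversed : ∀ h → lookup reversed h ≡ revB h
    lookup-reversed = VP.lookup∘tabulate revB

    reversed-off : ∀ {h} → onTail h ≡ false → onHead h ≡ false → lookup reversed h ≡ lookup O h
    reversed-off {h} a b = trans (lookup-reversed h) (cong₂ (λ x y → not x ∧ (y ∨ lookup O h)) a b)

    reversed-tail : ∀ {h} → onTail h ≡ true → h ∉ₕ reversed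
    reversed-tail {h} a = trans (lookup-reversed h) (cong (λ x → not x ∧ (onHead h ∨ lookup O h)) a)

    reversed-orientation : IsOrientation M reversed
    reversed-orientation h = trans (lookup-reversed h) (trans pt (cong not (sym (lookup-reversed (α h)))))
      where
      pt : revB h ≡ not (revB (α h))
      pt rewrite onTail-α h | sym (onTail-α (α h)) | αα h with onTail h in a | onHead h in b
      ... | true  | true  = clash (onTail⇒tail a) (onHead⇒head b)
      ... | true  | false = refl
      ... | false | true  = refl
      ... | false | false = or h

    reversed-outdeg : outdeg M reversed ≡ outdeg M O
    reversed-outdeg = VP.tabulate-cong λ x → at x
      where
      open ≡-Reasoning
      at : ∀ x → countF (λ h → sameV M x h ∧ lookup reversed h) ≡ countF (λ h → sameV M x h ∧ lookup O h)
      at x = begin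
          countF (λ h → v h ∧ lookup reversed h)
            ≡⟨ countF-split (λ h → v h ∧ lookup reversed h) onHead ⟩
          countF (λ h → (v h ∧ lookup reversed h) ∧ onHead h) + countF (λ h → (v h ∧ lookup reversed h) ∧ not (onHead h))
            ≡⟨ cong₂ _+_ (countF-cong heads) (countF-cong rest) ⟩
          countF (λ h → onHead h ∧ v h) + countF (λ h → (v h ∧ lookup O h) ∧ not (onTail h))
            ≡⟨ cong (_+ countF (λ h → (v h ∧ lookup O h) ∧ not (onTail h))) balance ⟩
          countF (λ h → onTail h ∧ v h) + countF (λ h → (v h ∧ lookup O h) ∧ not (onTail h))
            ≡⟨ cong (_+ countF (λ h → (v h ∧ lookup O h) ∧ not (onTail h))) (countF-cong tails′) ⟨
          countF (λ h → (v h ∧ lookup O h) ∧ onTail h) + countF (λ h → (v h ∧ lookup O h) ∧ not (onTail h))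
            ≡⟨ countF-split (λ h → v h ∧ lookup O h) onTail ⟨
          countF (λ h → v h ∧ lookup O h) ∎
        where
        v : HalfEdges
        v = sameV M x
        heads : ∀ h → (v h ∧ lookup reversed h) ∧ onHead h ≡ onHead h ∧ v h
        heads h with onHead h in b
        ... | false = 𝔹.∧-zeroʳ (v h ∧ lookup reversed h)
        ... | true  = trans (𝔹.∧-identityʳ _) (trans (cong (v h ∧_) (trans (lookup-reversed h)
                        (cong₂ (λ x y → not x ∧ (y ∨ lookup O h)) (≢true⇒false λ a → clash (onTail⇒tail a) (onHead⇒head b)) b)))
                        (𝔹.∧-identityʳ (v h)))
        tails′ : ∀ h → (v h ∧ lookup O h) ∧ onTail h ≡ onTail h ∧ v h
        tails′ h with onTail h in a
        ... | false = 𝔹.∧-zeroʳ (v h ∧ lookup O h)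
        ... | true  = trans (𝔹.∧-identityʳ _) (trans (cong (v h ∧_) (onTail⇒tail a)) (𝔹.∧-identityʳ (v h)))
        rest : ∀ h → (v h ∧ lookup reversed h) ∧ not (onHead h) ≡ (v h ∧ lookup O h) ∧ not (onTail h)
        rest h with onTail h in a | onHead h in b
        ... | true  | true  = trans (𝔹.∧-zeroʳ _) (sym (𝔹.∧-zeroʳ (v h ∧ lookup O h)))
        ... | true  | false = trans (cong (λ y → (v h ∧ y) ∧ true) (reversed-tail a))
                               (trans (cong (_∧ true) (𝔹.∧-zeroʳ (v h))) (sym (𝔹.∧-zeroʳ (v h ∧ lookup O h))))
        ... | false | true  = trans (𝔹.∧-zeroʳ _) (sym (trans (cong (λ y → (v h ∧ y) ∧ true) (onHead⇒head b))
                               (cong (_∧ true) (𝔹.∧-zeroʳ (v h)))))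
        ... | false | false = cong (λ y → (v h ∧ y) ∧ true) (reversed-off a b)
        tail-injective : Injective _≡_ _≡_ tail
        tail-injective {i} {j} e = simple i j (subst (λ y → sameV M (tail i) y ≡ true) e (sameV-refl (tail i)))
        -- The head of the `i`-th edge is at the vertex of the tail numbered `next i`, and `next`
        -- permutes the indices: each vertex gains as many tails as it loses.
        balance : countF (λ h → onHead h ∧ v h) ≡ countF (λ h → onTail h ∧ v h)
        balance = trans (countF-image (α ∘ tail) (tail-injective ∘ α-injective) v)
          (trans (countF-cong {p = v ∘ α ∘ tail} {v ∘ tail ∘ next} (λ i → link-vset (sameV-vertexSet x) i))
          (trans (countF-next (v ∘ tail)) (sym (countF-image tail tail-injective v))))

  module PhiCycles {T S : HSet M} (I : Interval T S) where
    open Phi I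

    outcut-not-cyclic : ∀ {X} (C : DirCycle M O) → VertexSet X → OutCut O X → ∀ i →
                        X (DirCycle.t C i) ≡ true → X (α (DirCycle.t C i)) ≡ false → ⊥
    outcut-not-cyclic C vX cut i a b = clash a (outcut-no-entry {O} orientation vX cut (OnCycle.cyclic C i) b)

    added-dircycle : ∀ {f} → f ∉ₕ T → First f → f ∈ₕ S → Σ (DirCycle M O) λ C → IsSmallestHalfEdge M T C f
    added-dircycle {f} fT ff fS =
      let C , (i , ti) , sort = extract-cycle {O = O} (λ z e → proj₁ (∧-true⁻ e)) (external-added fT ff fS) (added-cycle fT ff fS)
      in C , (i , inj₁ (sym ti)) , λ j → smallest (sort j)
      where
      smallest : ∀ {z} → z ≡ f ⊎ lookup O z ∧ (lookup T z ∧ ((p f <ᵇ p z) ∧ (p f <ᵇ p (α z)))) ≡ true → p f ≤ p z × p f ≤ p (α z)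
      smallest (inj₁ refl) = ≤-refl , <⇒≤ ff
      smallest {z} (inj₂ e) = let _ , e₁ = ∧-true⁻ {lookup O z} e
                                  _ , e₂ = ∧-true⁻ {lookup T z} e₁
                                  a , b = ∧-true⁻ {p f <ᵇ p z} e₂
                              in <⇒≤ (<ᵇ⁻ a) , <⇒≤ (<ᵇ⁻ b)

    minimal⇒S⊆T : Minimal M O → S⊆T
    minimal⇒S⊆T min = S⊆T-by-first λ f fT ff → ≢true⇒false λ fS →
      let C , sm = added-dircycle fT ff fS
      in clash (external-added fT ff fS) (min S T (interval⁺ I) refl C f sm)

    acyclic⇒S⊆T : Acyclic M O → S⊆T
    acyclic⇒S⊆T acyc = S⊆T-by-first λ f fT ff → ≢true⇒false λ fS → acyc (proj₁ (added-dircycle fT ff fS))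

    acyclic⇒no-external : Acyclic M O → NoExternalActive
    acyclic⇒no-external acyc h hT = ≢true⇒false λ active →
        let f , ff , same , act≡ = first-of h in impossible ff (trans (same T subgraph) hT) (trans act≡ active)
      where
      ⊆T = acyclic⇒S⊆T acyc
      impossible : ∀ {f} → First f → f ∉ₕ T → activeB M T f ≡ true → ⊥
      impossible {f} ff fT active = acyc (proj₁ (extract-cycle {m = lookup O} {α f} {O} (λ z e → e) αfO
          (subst (λ x → Reaches (lookup O) x (α f)) (sym (αα f)) (downward-path fT ff uncrossed down))))
        where
        uncrossed : ∀ {g} → g ∈ₕ T → First g → ¬ CrossI g f
        uncrossed = active-external⁻ fT ff active
        αfO : α f ∈ₕ O
        αfO = tail-other {O} orientation (≢true⇒false λ fO → case external-flipped fT ff fO of λ where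
          (inj₁ fS) → clash (⊆T f fS) fT
          (inj₂ (g , gT , fg , _ , c)) → uncrossed gT fg c)
        down : ∀ g → g ∈ₕ T → First g → CrossE g f → g ∈ₕ O
        down g gT fg c = ≢false⇒true λ gO → case internal-flipped gT fg gO of λ where
          (inj₁ gS) → removed-minimal gT fg gS fT ff c
          (inj₂ (f′ , f′T , _ , f′S , _)) → clash (⊆T f′ f′S) f′T

    module _ (⊆T : S⊆T) (C : DirCycle M O) where
      open OnCycle C

      external-tail : ∀ i → tail i ∉ₕ T → First (tail i) → ⊥
      external-tail i tT ft = case external-flip tT ft (tails i) of λ where
        (inj₁ tS) → clash (⊆T (tail i) tS) tT
        (inj₂ (g , _ , _ , cut , vX , a , b)) → outcut-not-cyclic C vX cut i a b

      -- Suppose the smallest half-edge is a tail `g`. An external `g` pointing forward and not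
      -- added would lie in a directed cut. If `g` is internal, the cycle enters its subtree and
      -- must leave it again: not through `g`, not through an external edge pointing forward, and
      -- any other external edge would come before `g`.
      smallest-is-head : ∀ h → IsSmallestHalfEdge M T C h → h ∉ₕ O
      smallest-is-head h (member , small) = ≢true⇒false (impossible member)
        where
        impossible : (∃ λ i → h ≡ tail i ⊎ h ≡ α (tail i)) → h ∈ₕ O → ⊥
        impossible (i , inj₂ refl) hO = clash hO (tail-unique {O} orientation (tails i))
        impossible (i , inj₁ refl) hO = [ internal , (λ tT → external-tail i tT ft) ]′ (bool-cases (lookup T (tail i)))
          where
          ft : First (tail i)
          ft = ≤∧≢⇒< (proj₂ (small i)) λ e → α-fpf (tail i) (sym (p-injective e))
          internal : tail i ∈ₕ T → ⊥
          internal tT =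
            let j , a , b = recross (subtree-vertexSet tT ft) i (subtree-self (tail i)) (subtree-α ft)
            in case bool-cases (lookup T (tail j)) of λ where
              (inj₁ jT) → clash (tails j) (subst (_∉ₕ O)
                (sym (α-swap (subtree-entry tT ft (∈-α jT) b (trans (cong (subtree (tail i)) (αα (tail j))) a))))
                (tail-unique {O} orientation hO))
              (inj₂ jT) → case leaving tT ft jT a b of λ where
                (inj₁ (fj , _)) → external-tail j jT fj
                (inj₂ (_ , c))  → <⇒≱ (CrossE.f<g c) (proj₂ (small j))

    smallest-half-edge : (C : DirCycle M O) → ∃ (IsSmallestHalfEdge M T C)
    smallest-half-edge C =
        let k , k≤ , e , below = least here? (p (tail zero)) (anyF⁺ (λ i → onEdge (tail i) (at (p (tail zero)))) zero
              (onEdge⁺ (tail zero) _ (inj₁ (at-pos (tail zero)))))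
            i , on = anyF⁻ (λ i → onEdge (tail i) (at k)) e
            pk = pos-at k (≤-<-trans k≤ (pos<n (tail zero)))
            lower = λ z j (on : onEdge (tail j) z ≡ true) → subst (_≤ p z) (sym pk) (≮⇒≥ λ z<k → clash
                      (anyF⁺ (λ i → onEdge (tail i) (at (p z))) j (trans (cong (onEdge (tail j)) (at-pos z)) on)) (below (p z) z<k))
        in at k , (i , onEdge⁻ (tail i) (at k) on) ,
           λ j → lower (tail j) j (onEdge-self (tail j)) , lower (α (tail j)) j (onEdge⁺ (tail j) _ (inj₂ refl))
      where
      open OnCycle C
      here? : ℕ → Bool
      here? k = anyF (λ i → onEdge (tail i) (at k))

    -- The smallest half-edge `h` of a cycle must be a head. An internal `h` would then lie in the
    -- cut of a removed edge. An external `h` is inactive, hence crossed by an earlier internal `g`;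
    -- the cycle enters the subtree of `g` and would leave it through an edge before `h` or an
    -- external tail pointing forward.
    no-external⇒acyclic : NoExternalActive → Acyclic M O
    no-external⇒acyclic none C = let h , member , small = smallest-half-edge C in
        impossible h member small (smallest-is-head ⊆T C h (member , small))
      where
      open OnCycle C
      ⊆T = no-external⇒S⊆T none
      impossible : ∀ h → (∃ λ i → h ≡ tail i ⊎ h ≡ α (tail i)) →
                   (∀ j → p h ≤ p (tail j) × p h ≤ p (α (tail j))) → h ∉ₕ O → ⊥
      impossible h (i , inj₁ refl) small hO = clash (tails i) hO
      impossible h (i , inj₂ refl) small hO = [ internal , external ]′ (bool-cases (lookup T h))
        where
        fh : First h
        fh = ≤∧≢⇒< (≤-trans (proj₁ (small i)) (≤-reflexive (p-αα (tail i)))) λ e → α-fpf h (sym (p-injective e))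
        internal : h ∈ₕ T → ⊥
        internal hT = case internal-flipped hT fh hO of λ where
          (inj₁ hS) → outcut-not-cyclic C (subtree-vertexSet hT fh) (removed-cut hT fh hS) i
                        (trans (cong (subtree h) (sym (αα (tail i)))) (subtree-α fh)) (subtree-self h)
          (inj₂ (f , fT , _ , fS , _)) → clash (⊆T f fS) fT
        external : h ∉ₕ T → ⊥
        external hT = case inactive-external hT fh (none h hT) of λ where
          (g , gT , fg , crossI g<h h<g′ g′<h′) →
            let j , a , b = recross (subtree-vertexSet gT fg) i
                              (subtree-after g (tail i) (<-≤-trans g′<h′ (≤-reflexive (sym (p-αα (tail i))))))
                              (subtree⁺ g h g<h (<⇒≤ h<g′))
            in case bool-cases (lookup T (tail j)) of λ where
              (inj₁ jT) → <⇒≱ g<h (subst (λ x → p h ≤ p x)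
                 (subtree-entry gT fg (∈-α jT) b (trans (cong (subtree g) (αα (tail j))) a)) (proj₂ (small j)))
              (inj₂ jT) → case leaving gT fg jT a b of λ where
                (inj₁ (fj , _)) → external-tail ⊆T C j jT fj
                (inj₂ (_ , c))  → <-asym (CrossE.f<g c) (<-≤-trans g<h (proj₂ (small j)))

-- Orientations with equal outdegrees

double-injective : ∀ {a b} → a + a ≡ b + b → a ≡ b
double-injective {a} {b} e with <-cmp a b
... | tri< lt _ _ = ⊥-elim (<-irrefl e (+-mono-< lt lt))
... | tri≈ _ eq _ = eq
... | tri> _ _ gt = ⊥-elim (<-irrefl (sym e) (+-mono-< gt gt))

module Outdegrees (M : RootedMap) where
  open Cycles M public

  vertex-count : ∀ {O₁ O₂} → outdeg M O₁ ≡ outdeg M O₂ → ∀ x →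
                 countF (λ h → sameV M x h ∧ lookup O₁ h) ≡ countF (λ h → sameV M x h ∧ lookup O₂ h)
  vertex-count {O₁} {O₂} eq x = trans (sym (VP.lookup∘tabulate (λ x → countF (λ h → sameV M x h ∧ lookup O₁ h)) x))
    (trans (cong (λ d → lookup d x) eq) (VP.lookup∘tabulate (λ x → countF (λ h → sameV M x h ∧ lookup O₂ h)) x))

  -- Outdegrees are added up by splitting off one vertex of `X` at a time.
  tail-count : ∀ {O₁ O₂ X} → outdeg M O₁ ≡ outdeg M O₂ → VertexSet X →
               countF (λ h → X h ∧ lookup O₁ h) ≡ countF (λ h → X h ∧ lookup O₂ h)
  tail-count {O₁} {O₂} {X} eq vX = go (suc (countF X)) X vX ≤-refl
    where
    go : ∀ k X → VertexSet X → countF X < k → countF (λ h → X h ∧ lookup O₁ h) ≡ countF (λ h → X h ∧ lookup O₂ h)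
    go (suc k) X vX (s≤s le) with search X
    ... | inj₂ none = trans (countF-none (λ h → cong (_∧ lookup O₁ h) (none h)))
                            (sym (countF-none (λ h → cong (_∧ lookup O₂ h) (none h))))
    ... | inj₁ (x , xX) = trans (split O₁) (trans (cong₂ _+_ (vertex-count {O₁} {O₂} eq x) smaller) (sym (split O₂)))
      where
      X′ : HalfEdges
      X′ h = X h ∧ not (sameV M x h)
      smaller : countF (λ h → X′ h ∧ lookup O₁ h) ≡ countF (λ h → X′ h ∧ lookup O₂ h)
      smaller = go k X′ (λ h → cong₂ (λ a b → a ∧ not b) (vX h) (sameV-vertexSet x h))
        (<-≤-trans (countF-strict {p = X′} x (trans (cong (λ b → X x ∧ not b) (sameV-refl x)) (𝔹.∧-zeroʳ (X x))) xX
          (λ h e → proj₁ (∧-true⁻ e))) le)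
      split : ∀ O → countF (λ h → X h ∧ lookup O h) ≡
                    countF (λ h → sameV M x h ∧ lookup O h) + countF (λ h → X′ h ∧ lookup O h)
      split O = trans (countF-split (λ h → X h ∧ lookup O h) (sameV M x)) (cong₂ _+_ (countF-cong in′) (countF-cong out))
        where
        in′ : ∀ h → (X h ∧ lookup O h) ∧ sameV M x h ≡ sameV M x h ∧ lookup O h
        in′ h with sameV M x h in s
        ... | false = 𝔹.∧-zeroʳ (X h ∧ lookup O h)
        ... | true  = trans (𝔹.∧-identityʳ _) (cong (_∧ lookup O h) (trans (sym (vset-sameV vX x h s)) xX))
        out : ∀ h → (X h ∧ lookup O h) ∧ not (sameV M x h) ≡ X′ h ∧ lookup O h
        out h = trans (𝔹.∧-assoc (X h) _ _) (trans (cong (X h ∧_) (𝔹.∧-comm (lookup O h) _)) (sym (𝔹.∧-assoc (X h) _ _)))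

  cutB : HalfEdges → HalfEdges
  cutB X h = X h ∧ not (X (α h))

  -- `α` exchanges tails and heads of the edges inside `X`, so the tails are half of all inner
  -- half-edges; doubling replaces the division.
  inner-count : ∀ {O} → IsOrientation M O → (X : HalfEdges) →
                countF (λ h → (X h ∧ X (α h)) ∧ lookup O h) + countF (λ h → (X h ∧ X (α h)) ∧ lookup O h)
                ≡ countF (λ h → X h ∧ X (α h))
  inner-count {O} or X = trans (cong (countF (λ h → (X h ∧ X (α h)) ∧ lookup O h) +_) (trans
      (countF-permute αᴾ (λ h → (X h ∧ X (α h)) ∧ lookup O h)) (countF-cong swap)))
      (sym (countF-split (λ h → X h ∧ X (α h)) (lookup O)))
    where
    swap : ∀ h → (X (α h) ∧ X (α (α h))) ∧ lookup O (α h) ≡ (X h ∧ X (α h)) ∧ not (lookup O h)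
    swap h = cong₂ _∧_ (trans (cong (λ y → X (α h) ∧ X y) (αα h)) (𝔹.∧-comm (X (α h)) (X h)))
                       (trans (or (α h)) (cong (not ∘ lookup O) (αα h)))

  -- Edges inside X contribute one tail each, so the number of edges leaving X is
  -- determined by the outdegrees.
  cut-count : ∀ {O₁ O₂ X} → IsOrientation M O₁ → IsOrientation M O₂ → outdeg M O₁ ≡ outdeg M O₂ → VertexSet X →
              countF (λ h → cutB X h ∧ lookup O₁ h) ≡ countF (λ h → cutB X h ∧ lookup O₂ h)
  cut-count {O₁} {O₂} {X} or₁ or₂ eq vX = +-cancelˡ-≡ _ _ _ (trans (sym (split O₁)) (trans (tail-count {O₁} {O₂} eq vX)
      (trans (split O₂) (cong (_+ countF (λ h → cutB X h ∧ lookup O₂ h)) (sym inner)))))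
    where
    inner : countF (λ h → (X h ∧ X (α h)) ∧ lookup O₁ h) ≡ countF (λ h → (X h ∧ X (α h)) ∧ lookup O₂ h)
    inner = double-injective (trans (inner-count {O₁} or₁ X) (sym (inner-count {O₂} or₂ X)))
    split : ∀ O → countF (λ h → X h ∧ lookup O h) ≡
                  countF (λ h → (X h ∧ X (α h)) ∧ lookup O h) + countF (λ h → cutB X h ∧ lookup O h)
    split O = trans (countF-split (λ h → X h ∧ lookup O h) (X ∘ α)) (cong₂ _+_
      (countF-cong λ h → mix (X h) (lookup O h) (X (α h))) (countF-cong λ h → mix (X h) (lookup O h) (not (X (α h)))))
      where
      mix : ∀ a b c → (a ∧ b) ∧ c ≡ (a ∧ c) ∧ b
      mix a b c = trans (𝔹.∧-assoc a b c) (trans (cong (a ∧_) (𝔹.∧-comm b c)) (sym (𝔹.∧-assoc a c b)))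

  module SameOutdegrees {O₁ O₂ : HSet M} (or₁ : IsOrientation M O₁) (or₂ : IsOrientation M O₂)
                        (eq : outdeg M O₁ ≡ outdeg M O₂) where

    -- Equally many tails leave `X` in both orientations. Outside `K` they are the same ones, so
    -- inside `K` the numbers agree too, and closedness says that this number is zero.
    closed-transfer : ∀ {K X} → (∀ h → K h ≡ false → lookup O₁ h ≡ lookup O₂ h) → VertexSet X →
                      ClosedUnder (λ h → lookup O₁ h ∧ K h) X → ClosedUnder (λ h → lookup O₂ h ∧ K h) X
    closed-transfer {K} {X} agree vX closed h hX hO = ≢false⇒true λ out →
        clash (∧-true⁺ (∧-true⁺ hX (not-true⁺ out)) hO) (countF≡0⇒none K₂≡0 h)
      where
      outK offK : HSet M → ℕ
      outK O = countF (λ h → cutB X h ∧ (lookup O h ∧ K h))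
      offK O = countF (λ h → cutB X h ∧ (lookup O h ∧ not (K h)))
      split : ∀ O → countF (λ h → cutB X h ∧ lookup O h) ≡ outK O + offK O
      split O = trans (countF-split (λ h → cutB X h ∧ lookup O h) K)
        (cong₂ _+_ (countF-cong λ h → 𝔹.∧-assoc (cutB X h) _ _) (countF-cong λ h → 𝔹.∧-assoc (cutB X h) _ _))
      off-eq : offK O₁ ≡ offK O₂
      off-eq = countF-cong λ h → cong (cutB X h ∧_) (pt h)
        where
        pt : ∀ h → lookup O₁ h ∧ not (K h) ≡ lookup O₂ h ∧ not (K h)
        pt h with K h in k
        ... | true  = trans (𝔹.∧-zeroʳ (lookup O₁ h)) (sym (𝔹.∧-zeroʳ (lookup O₂ h)))
        ... | false = cong (_∧ true) (agree h k)
      K₁≡0 : outK O₁ ≡ 0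
      K₁≡0 = countF-none λ h → ≢true⇒false λ e →
        let c , o = ∧-true⁻ {cutB X h} e
            a , b = ∧-true⁻ {X h} c
        in clash (closed h a o) (not-true⁻ b)
      K₂≡0 : outK O₂ ≡ 0
      K₂≡0 = trans (+-cancelʳ-≡ (offK O₁) _ _ (trans (cong (outK O₂ +_) off-eq)
        (trans (sym (split O₂)) (trans (sym (cut-count {O₁} {O₂} or₁ or₂ eq vX)) (split O₁))))) K₁≡0

    outcut-transfer : ∀ {X} → VertexSet X → OutCut O₁ X → OutCut O₂ X
    outcut-transfer {X} vX cut h hX out = ≢false⇒true λ hO → clash hX (not-true⁻ (trans (cong (compl X) (sym (αα h)))
        (closed-transfer {λ _ → true} {compl X} (λ h ()) (compl-VertexSet {X} vX) closed (α h) (not-true⁺ out)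
          (∧-true⁺ (tail-other {O₂} or₂ hO) refl))))
      where
      closed : ClosedUnder (λ h → lookup O₁ h ∧ true) (compl X)
      closed h h∉ hO = not-true⁺ (≢true⇒false λ in′ →
        clash (cut (α h) in′ (trans (cong X (αα h)) (not-true⁻ h∉))) (tail-unique {O₁} or₁ (proj₁ (∧-true⁻ hO))))

    -- Take the set reached from `α g` along tails of `O₁` at which the orientations differ. By
    -- transfer it is closed for `O₂` as well, and there `α g` is a differing tail that leads to
    -- `g`.
    difference-cycle : ∀ {g} → g ∈ₕ O₁ → g ∉ₕ O₂ →
                       Reaches (λ h → lookup O₁ h ∧ (lookup O₁ h xor lookup O₂ h)) (α g) g
    difference-cycle {g} g₁ g₂ = reachSet⁻ m (α g) g (trans (cong R (sym (αα g)))
        (closed-transfer {D} (λ h → xor-false⇒≡) (reachSet-vertexSet m (α g)) (reachSet-closed m (α g)) (α g)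
          (reachSet-start m (α g)) (∧-true⁺ g₂′ (≢⇒xor λ e → clash (trans e g₂′) (tail-unique {O₁} or₁ g₁)))))
      where
      D m R : HalfEdges
      D h = lookup O₁ h xor lookup O₂ h
      m h = lookup O₁ h ∧ D h
      R = lookup (reachSet M m (α g))
      g₂′ = tail-other {O₂} or₂ g₂

  reaches-transfer : ∀ {O₁ O₂} → IsOrientation M O₁ → IsOrientation M O₂ → outdeg M O₁ ≡ outdeg M O₂ →
                     ∀ {K} → (∀ h → K h ≡ false → lookup O₁ h ≡ lookup O₂ h) → ∀ {x y} →
                     Reaches (λ h → lookup O₂ h ∧ K h) x y → Reaches (λ h → lookup O₁ h ∧ K h) x y
  reaches-transfer {O₁} {O₂} or₁ or₂ eq {K} agree {x} {y} r = reachSet⁻ m x y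
      (closed-reaches (reachSet-vertexSet m x) (SameOutdegrees.closed-transfer {O₁} {O₂} or₁ or₂ eq {K} agree
        (reachSet-vertexSet m x) (reachSet-closed m x)) r (reachSet-start m x))
    where
    m : HalfEdges
    m h = lookup O₁ h ∧ K h

  reaches-outdeg : ∀ {O₁ O₂} → IsOrientation M O₁ → IsOrientation M O₂ → outdeg M O₁ ≡ outdeg M O₂ →
                   ∀ {x y} → Reaches (lookup O₂) x y → Reaches (lookup O₁) x y
  reaches-outdeg {O₁} {O₂} or₁ or₂ eq r = reaches-mono (λ h e → proj₁ (∧-true⁻ e))
    (reaches-transfer {O₁} {O₂} or₁ or₂ eq {λ _ → true} (λ h ()) (reaches-mono (λ h e → ∧-true⁺ e refl) r))

  -- The first edge on which the trees of two orientations with equal outdegrees differ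
  -- cannot precede the first edge on which the orientations themselves differ.
  module Compare {T₁ S₁ T₂ S₂ : HSet M} (I₁ : Interval T₁ S₁) (I₂ : Interval T₂ S₂)
                 (eq : outdeg M (phi M T₁ S₁) ≡ outdeg M (phi M T₂ S₂)) where
    module A = Phi I₁
    module B = Phi I₂

    private
      O₁ O₂ : HSet M
      O₁ = A.O
      O₂ = B.O

    module _ (k : ℕ) (k<n : k < n) (at-agree : ∀ j → j ≤ k → A.at j ≡ B.at j)
             (T-agree : ∀ j → j < k → lookup T₁ (A.at j) ≡ lookup T₂ (A.at j))
             (O-agree : ∀ j → j ≤ k → lookup O₁ (A.at j) ≡ lookup O₂ (A.at j))
             (h₁ : A.at k ∈ₕ T₁) (h₂ : A.at k ∉ₕ T₂) where
      private
        h : Fin n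
        h = A.at k

        pA : A.p h ≡ k
        pA = A.pos-at k k<n

        pB : B.p h ≡ k
        pB = trans (cong B.p (at-agree k ≤-refl)) (B.pos-at k k<n)

        A⇒B : ∀ {z} → A.p z ≤ k → B.p z ≡ A.p z
        A⇒B {z} le = trans (cong B.p (trans (sym (A.at-pos z)) (at-agree _ le))) (B.pos-at _ (A.pos<n z))

        B⇒A : ∀ {z} → B.p z ≤ k → A.p z ≡ B.p z
        B⇒A {z} le = trans (cong A.p (trans (sym (B.at-pos z)) (sym (at-agree _ le)))) (A.pos-at _ (B.pos<n z))

        T-eq : ∀ {z} → A.p z < k → lookup T₁ z ≡ lookup T₂ z
        T-eq {z} lt = subst (λ z → lookup T₁ z ≡ lookup T₂ z) (A.at-pos z) (T-agree _ lt)

        O-eq : ∀ {z} → A.p z ≤ k → lookup O₁ z ≡ lookup O₂ z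
        O-eq {z} le = subst (λ z → lookup O₁ z ≡ lookup O₂ z) (A.at-pos z) (O-agree _ le)

        -- Had `α h` been visited earlier, the trees would have differed already there.
        fA : A.First h
        fA = ≤∧≢⇒< (≮⇒≥ λ lt → clash (trans (sym (T-eq (subst (A.p (α h) <_) pA lt))) (A.∈-α h₁)) (B.∉-α h₂))
                   λ e → α-fpf h (sym (A.p-injective e))

        fB : B.First h
        fB = subst (_< B.p (α h)) (sym pB) (≰⇒> λ le →
          <⇒≱ fA (≤-trans (≤-reflexive (B⇒A le)) (≤-trans le (≤-reflexive (sym pA)))))

        -- The root path in `T₂` to `α h` enters the directed cut `X` through some `z`. If `z` comes
        -- after `h`, it points against its direction on the path: it would be a removed edge
        -- crossed by the smaller `h`, or lie on a directed cycle through the cut. So `z` comes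
        -- before `h` and belongs to both trees, and `early` excludes that case.
        entry : ∀ {X} → VertexSet X → OutCut O₂ X → X h₀ ≡ false → X (α h) ≡ true →
                (∀ z → z ∈ₕ T₁ → z ∈ₕ T₂ → X z ≡ false → X (α z) ≡ true → B.p (α h) ≤ B.p (α z) → ⊥) → ⊥
        entry {X} vX cut root h′∈ early = case B.root-path vX root h′∈ of λ where
          (z , zT , out , in′ , lo , hi) → case <-cmp (B.p z) k of λ where
            (tri< lt _ _) → early z (trans (T-eq (≤-<-trans (≤-reflexive (B⇒A (<⇒≤ lt))) lt)) zT) zT out in′ hi
            (tri≈ _ e _)  → clash zT (subst (_∉ₕ T₂) (B.p-injective (trans pB (sym e))) h₂)
            (tri> _ _ gt) →
              let fz = <-≤-trans lo hi
                  z∉O = ≢true⇒false λ zO → clash (cut (α z) in′ (trans (cong X (αα z)) out)) (tail-unique {O₂} B.orientation zO)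
              in case B.internal-flip zT fz z∉O of λ where
                (inj₁ zS) → B.removed-minimal zT fz zS h₂ fB
                  (B.crossE (≤-<-trans (≤-reflexive pB) gt) lo (≤∧≢⇒< hi (B.p-≢ (B.∈-α zT) (B.∉-α h₂) ∘ sym)))
                (inj₂ r) → clash in′ (outcut-no-entry {O₂} B.orientation vX cut r out)

        -- The return path of `f` is carried over to `O₁`. `K` consists of the half-edges in `T₂`
        -- and of those whose edge is met only after `k`; elsewhere the orientations agree. On
        -- leaving the subtree of `h`, the walk can use neither `h` nor an external edge met before
        -- it, as these are not in `K`. What remains is an external edge on a directed cycle, hence
        -- added for `S₁`, though `h` is smaller in its cycle.
        cycle : ∀ {f} → f ∈ₕ O₁ → Reaches (λ z → lookup O₂ z ∧ lookup T₂ z) (α f) f →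
                A.subtree h (α f) ≡ true → A.subtree h f ≡ false → ⊥
        cycle {f} fO r in′ out = leave (exit (A.subtree-vertexSet h₁ fA) r₁ in′ out)
          where
          later K : HalfEdges
          later z = (k <ᵇ A.p z) ∧ (k <ᵇ A.p (α z))
          K z = lookup T₂ z ∨ later z
          agree : ∀ z → K z ≡ false → lookup O₁ z ≡ lookup O₂ z
          agree z e = case <-≤-connex k (A.p z) of λ where
            (inj₂ le) → O-eq le
            (inj₁ lt) → case <-≤-connex k (A.p (α z)) of λ where
              (inj₂ le) → trans (A.orientation z) (trans (cong not (O-eq le)) (sym (B.orientation z)))
              (inj₁ lt′) → clash (∨-trueʳ {lookup T₂ z} (∧-true⁺ (<ᵇ⁺ lt) (<ᵇ⁺ lt′))) e
          r₁ : Reaches (λ z → lookup O₁ z ∧ K z) (α f) f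
          r₁ = reaches-transfer {O₁} {O₂} A.orientation B.orientation eq {K} agree
                 (reaches-mono (λ z e → let a , b = ∧-true⁻ {lookup O₂ z} e in ∧-true⁺ a (∨-trueˡ b)) r)
          up : ∀ {x y} → Reaches (λ z → lookup O₁ z ∧ K z) x y → Reaches (lookup O₁) x y
          up = reaches-mono λ z e → proj₁ (∧-true⁻ e)
          leave : (∃ λ z → lookup O₁ z ∧ K z ≡ true × A.subtree h z ≡ true × A.subtree h (α z) ≡ false
                   × Reaches (λ z → lookup O₁ z ∧ K z) (α f) z × Reaches (λ z → lookup O₁ z ∧ K z) (α z) f) → ⊥
          leave (z , e , zin , zout , s , s′) = [ internal , external ]′ (bool-cases (lookup T₁ z))
            where
            zO = proj₁ (∧-true⁻ {lookup O₁ z} e)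
            zK = proj₂ (∧-true⁻ {lookup O₁ z} e)
            not-early : lookup T₂ z ≡ false → k < A.p (α z)
            not-early f = [ (λ t → clash t f) , (λ l → <ᵇ⁻ (proj₂ (∧-true⁻ {k <ᵇ A.p z} l))) ]′ (∨-true⁻ {lookup T₂ z} zK)
            internal : z ∈ₕ T₁ → ⊥
            internal zT = case A.subtree-entry h₁ fA (A.∈-α zT) zout (trans (cong (A.subtree h) (αα z)) zin) of λ where
              αz≡h → <-irrefl (sym (trans (cong A.p αz≡h) pA))
                       (not-early (trans (sym (trans (cong (lookup T₂) (sym αz≡h)) (B.T-α z))) h₂))
            external : z ∉ₕ T₁ → ⊥
            external zT = case A.leaving h₁ fA zT zin zout of λ where
              (inj₁ (fz , c)) → A.added-minimal zT fz (A.external-flip-cyclic zT fz zO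
                (reaches-trans (up s′) (reaches-trans (cross fO here) (up s)))) h₁ fA c
              (inj₂ (_ , c)) → let z′<k = <-≤-trans (A.CrossE.f<g c) (≤-reflexive pA) in
                <-asym z′<k (not-early (trans (sym (B.T-α z)) (trans (sym (T-eq z′<k)) (A.∉-α zT))))

        cycle₂ : ∀ {f} → f ∉ₕ T₂ → B.First f → f ∈ₕ S₂ → f ∈ₕ O₁ → A.subtree h (α f) ≡ true → A.subtree h f ≡ false → ⊥
        cycle₂ fT ff fS fO = cycle fO (reaches-mono (λ z e →
          let a , b = ∧-true⁻ {lookup O₂ z} e in ∧-true⁺ a (proj₁ (∧-true⁻ {lookup T₂ z} b))) (B.added-cycle fT ff fS))

        cut₂ : ∀ {X} → VertexSet X → OutCut O₁ X → OutCut O₂ X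
        cut₂ = SameOutdegrees.outcut-transfer {O₁} {O₂} A.orientation B.orientation eq

        -- For `T₂` the external `h` points forward. Either it is added, and its fundamental cycle
        -- is refuted by `cycle`; or it is crossed by a removed `g` before it. In the latter case
        -- `g` lies in a directed cut, so it is removed for `S₁` as well, and its cut in the first
        -- tree contains `α h`, contradicting `entry`.
        tail-case : h ∈ₕ O₁ → ⊥
        tail-case hO = case B.external-flipped h₂ fB (trans (sym (O-eq (≤-reflexive pA))) hO) of λ where
          (inj₁ hS) → cycle₂ h₂ fB hS hO (A.subtree-α fA) (A.subtree-self h)
          (inj₂ (g , gT , fg , gS , B.crossI g<h h<g′ g′<h′)) →
            let g<k = <-≤-trans g<h (≤-reflexive pB)
                k<g′ = ≤-<-trans (≤-reflexive (sym pB)) h<g′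
                pg = B⇒A (<⇒≤ g<k)
                g<k₁ = ≤-<-trans (≤-reflexive pg) g<k
                k≤g′₁ = ≮⇒≥ λ lt → <-asym k<g′ (≤-<-trans (≤-reflexive (A⇒B (<⇒≤ lt))) lt)
                gT₁ = trans (T-eq g<k₁) gT
                fg₁ = <-≤-trans g<k₁ k≤g′₁
                gO₁ = trans (O-eq (<⇒≤ g<k₁)) (B.internal-removed gT fg gS)
                h≢ = ≢true⇒false λ on → clash (trans (onEdge-∈ {T₂} B.subgraph on) gT) h₂
            in case A.internal-flip gT₁ fg₁ gO₁ of λ where
              (inj₂ r) → clash (B.subtree-α fg) (outcut-no-entry {O₁} A.orientation (B.subtree-vertexSet gT fg)
                (SameOutdegrees.outcut-transfer {O₂} {O₁} B.orientation A.orientation (sym eq)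
                  (B.subtree-vertexSet gT fg) (B.removed-cut gT fg gS)) r (B.subtree-self g))
              (inj₁ gS₁) → entry (A.subtree-vertexSet gT₁ fg₁) (cut₂ (A.subtree-vertexSet gT₁ fg₁) (A.removed-cut gT₁ fg₁ gS₁))
                (A.subtree-root g)
                (trans (A.subtree-internal gT₁ fg₁ h₁ h≢)
                  (A.subtree⁺ g h (<-≤-trans g<k₁ (≤-reflexive (sym pA))) (≤-trans (≤-reflexive pA) k≤g′₁)))
                λ z zT₁ zT₂ out in′ le → case A.subtree-entry gT₁ fg₁ zT₁ out in′ of λ where
                  refl → <⇒≱ g′<h′ le

        -- For `T₁` the internal `h` points backwards. Either it is removed, and its cut is refuted
        -- by `entry`; or it is crossed by an added `f` before it. Being on a directed cycle, which
        -- equal outdegrees preserve, `f` is added for `S₂` as well, and `cycle` applies to it.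
        head-case : h ∉ₕ O₁ → ⊥
        head-case hO = case A.internal-flipped h₁ fA hO of λ where
          (inj₁ hS) → entry (A.subtree-vertexSet h₁ fA) (cut₂ (A.subtree-vertexSet h₁ fA) (A.removed-cut h₁ fA hS))
            (A.subtree-root h) (A.subtree-α fA)
            λ z zT₁ zT₂ out in′ le → clash zT₂ (subst (_∉ₕ T₂) (sym (A.subtree-entry h₁ fA zT₁ out in′)) h₂)
          (inj₂ (f , fT , ff , fS , A.crossE f<h h<f′ f′<h′)) →
            let f<k = <-≤-trans f<h (≤-reflexive pA)
                pf = A⇒B (<⇒≤ f<k)
                fT₂ = trans (sym (T-eq f<k)) fT
                fO₁ = A.external-added fT ff fS
                fO₂ = trans (sym (O-eq (<⇒≤ f<k))) fO₁
                k<f′ = ≤-<-trans (≤-reflexive (sym pA)) h<f′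
                ff₂ = <-≤-trans (≤-<-trans (≤-reflexive pf) f<k) (≮⇒≥ λ lt →
                        <-asym k<f′ (≤-<-trans (≤-reflexive (B⇒A (<⇒≤ lt))) lt))
                fS₂ = B.external-flip-cyclic fT₂ ff₂ fO₂
                        (reaches-outdeg {O₂} {O₁} B.orientation A.orientation (sym eq) (A.added-on-cycle fT ff fS))
            in cycle₂ fT₂ ff₂ fS₂ fO₁ (A.subtree⁺ h (α f) h<f′ (<⇒≤ f′<h′)) (A.subtree-before h f (<⇒≤ f<h))

      trees-agree : ⊥
      trees-agree = [ tail-case , head-case ]′ (bool-cases (lookup O₁ h))

-- Injectivity of Φ and uniqueness of minimal orientations

module Uniqueness (M : RootedMap) where
  open Outdegrees M public

  module _ {T₁ S₁ T₂ S₂ : HSet M} (I₁ : Interval T₁ S₁) (I₂ : Interval T₂ S₂)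
           (eq : outdeg M (phi M T₁ S₁) ≡ outdeg M (phi M T₂ S₂)) where
    private
      module A = Phi I₁
      module B = Phi I₂

    -- Each step of a tour depends only on whether its current half-edge is in the tree, so the
    -- tours stay together as long as the trees agree along them.
    common-tour : ∀ k → k ≤ n → (∀ j → j < k → lookup A.O (A.at j) ≡ lookup B.O (A.at j)) →
                  (∀ j → j < k → lookup T₁ (A.at j) ≡ lookup T₂ (A.at j)) × (∀ j → j ≤ k → A.at j ≡ B.at j)
    common-tour zero    k≤n same = (λ j ()) , λ { zero z≤n → refl }
    common-tour (suc k) k<n same = T-agree , at-agree
      where
      IH = common-tour k (<⇒≤ k<n) λ j j<k → same j (m<n⇒m<1+n j<k)
      O-agree : ∀ j → j ≤ k → lookup A.O (A.at j) ≡ lookup B.O (A.at j)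
      O-agree j j≤k = same j (s≤s j≤k)
      T-at : lookup T₁ (A.at k) ≡ lookup T₂ (A.at k)
      T-at = bool-ext
        (λ a → ≢false⇒true λ b → Compare.trees-agree I₁ I₂ eq k k<n (proj₂ IH) (proj₁ IH) O-agree a b)
        (λ b → ≢false⇒true λ a → Compare.trees-agree I₂ I₁ (sym eq) k k<n (λ j le → sym (proj₂ IH j le))
          (λ j lt → subst (λ z → lookup T₂ z ≡ lookup T₁ z) (proj₂ IH j (<⇒≤ lt)) (sym (proj₁ IH j lt)))
          (λ j le → subst (λ z → lookup B.O z ≡ lookup A.O z) (proj₂ IH j le) (sym (O-agree j le)))
          (subst (_∈ₕ T₂) (proj₂ IH k ≤-refl) b) (subst (_∉ₕ T₁) (proj₂ IH k ≤-refl) a))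
      T-agree : ∀ j → j < suc k → lookup T₁ (A.at j) ≡ lookup T₂ (A.at j)
      T-agree j (s≤s j≤k) = case m≤n⇒m<n∨m≡n j≤k of λ where
        (inj₁ j<k)  → proj₁ IH j j<k
        (inj₂ refl) → T-at
      at-agree : ∀ j → j ≤ suc k → A.at j ≡ B.at j
      at-agree j j≤ = case m≤n⇒m<n∨m≡n j≤ of λ where
        (inj₁ (s≤s j≤k)) → proj₂ IH j j≤k
        (inj₂ refl) → trans (cong (λ b → if b then σ (α (A.at k)) else σ (A.at k)) T-at) (cong (motion M T₂) (proj₂ IH k ≤-refl))

    first-difference : A.O ≡ B.O ⊎ (∃ λ k → k < n × lookup A.O (A.at k) ≢ lookup B.O (A.at k)
                                      × (∀ j → j < k → lookup A.O (A.at j) ≡ lookup B.O (A.at j)))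
    first-difference = case search differ of λ where
        (inj₂ none) → inj₁ (vec-ext λ z → xor-false⇒≡ (none z))
        (inj₁ (z , e)) → let k , k≤ , ek , below = least (differ ∘ A.at) (A.p z) (trans (cong differ (A.at-pos z)) e) in
          inj₂ (k , ≤-<-trans k≤ (A.pos<n z) , xor-true⇒≢ ek , λ j lt → xor-false⇒≡ (below j lt))
      where
      differ : Fin n → Bool
      differ z = lookup A.O z xor lookup B.O z

  same-tree : ∀ {T₁ S₁ T₂ S₂} → Interval T₁ S₁ → Interval T₂ S₂ → phi M T₁ S₁ ≡ phi M T₂ S₂ → T₁ ≡ T₂
  same-tree {T₁} {S₁} {T₂} {S₂} I₁ I₂ eq = vec-ext λ z → subst (λ z → lookup T₁ z ≡ lookup T₂ z) (A.at-pos z)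
      (proj₁ (common-tour I₁ I₂ (cong (outdeg M) eq) n ≤-refl (λ j _ → cong (λ O → lookup O (A.at j)) eq)) (A.p z) (A.pos<n z))
    where module A = Phi I₁

  private
    -- If `e` is removed for `S₂` only, it is active and points backwards, so for `S₁` it must be
    -- crossed by a smaller added edge, which activity forbids. External edges are dual.
    S-⊆ : ∀ {T S₁ S₂} (I₁ : Interval T S₁) (I₂ : Interval T S₂) → phi M T S₁ ≡ phi M T S₂ → S₁ ⊆ₕ S₂
    S-⊆ {T} {S₁} {S₂} I₁ I₂ eq x x₁ = let r , fr , same , _ = A.first-of x in
        trans (sym (same S₂ B.subS)) (≢false⇒true (impossible r fr (trans (same S₁ A.subS) x₁)))
      where
      module A = Phi I₁
      module B = Phi I₂
      impossible : ∀ e → A.First e → e ∈ₕ S₁ → e ∉ₕ S₂ → ⊥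
      impossible e fe e₁ e₂ = [ internal , external ]′ (bool-cases (lookup T e))
        where
        internal : e ∈ₕ T → ⊥
        internal eT = case A.internal-flipped eT fe (trans (cong (λ O → lookup O e) eq) (B.internal-removed eT fe e₂)) of λ where
          (inj₁ eS) → clash e₁ eS
          (inj₂ (f , fT , ff , fS , A.crossE a b c)) → B.removed-minimal eT fe e₂ fT ff (B.crossE a b c)
        external : e ∉ₕ T → ⊥
        external eT = case B.external-flipped eT fe (trans (cong (λ O → lookup O e) (sym eq)) (A.external-added eT fe e₁)) of λ where
          (inj₁ eS) → clash eS e₂
          (inj₂ (g , gT , fg , gS , B.crossI a b c)) → A.added-minimal eT fe e₁ gT fg (A.crossI a b c)

  phi-injective : ∀ {T₁ S₁ T₂ S₂} → Interval T₁ S₁ → Interval T₂ S₂ → phi M T₁ S₁ ≡ phi M T₂ S₂ → T₁ ≡ T₂ × S₁ ≡ S₂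
  phi-injective I₁ I₂ eq with same-tree I₁ I₂ eq
  ... | refl = refl , vec-ext λ x → bool-ext (S-⊆ I₁ I₂ eq x) (S-⊆ I₂ I₁ (sym eq) x)

  -- `Minimal` quantifies over all pairs with the given image; injectivity on pairs leaves only this
  -- one.
  minimal-of-forest : ∀ {T S} (I : Interval T S) → Phi.S⊆T I → Minimal M (phi M T S)
  minimal-of-forest {T} {S} I ⊆T S′ T′ I′ eq C h sm with phi-injective (interval⁻ {T′} {S′} I′) I eq
  ... | refl , refl = PhiCycles.smallest-is-head I ⊆T C h sm

  module _ {T S : HSet M} (I : Interval T S) where
    open Phi I

    -- g is then the smallest half-edge of a directed cycle of differently oriented edges.
    not-minimal : ∀ {O′ g} → IsOrientation M O′ → outdeg M O ≡ outdeg M O′ → g ∈ₕ O → g ∉ₕ O′ →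
                  (∀ z → p z < p g → lookup O z ≡ lookup O′ z) → ¬ Minimal M O
    not-minimal {O′} {g} or′ eq g∈ g∉ before min =
      let C , (i , ti) , sort = extract-cycle {O = O} (λ z e → proj₁ (∧-true⁻ e)) g∈
                                  (SameOutdegrees.difference-cycle {O} {O′} orientation or′ eq g∈ g∉)
      in clash g∈ (min S T (interval⁺ I) refl C g ((i , inj₁ (sym ti)) , λ j → smallest (sort j)))
      where
      after : ∀ {z} → lookup O z ≢ lookup O′ z → p g ≤ p z
      after ne = ≮⇒≥ λ lt → ne (before _ lt)
      differ-α : ∀ {z} → lookup O z ≢ lookup O′ z → lookup O (α z) ≢ lookup O′ (α z)
      differ-α {z} ne e = ne (trans (orientation z) (trans (cong not e) (sym (or′ z))))
      smallest : ∀ {z} → z ≡ g ⊎ lookup O z ∧ (lookup O z xor lookup O′ z) ≡ true → p g ≤ p z × p g ≤ p (α z)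
      smallest (inj₁ refl) = ≤-refl , after (differ-α λ e → clash (trans (sym e) g∈) g∉)
      smallest {z} (inj₂ e) = let ne = xor-true⇒≢ (proj₂ (∧-true⁻ {lookup O z} e)) in after ne , after (differ-α ne)

  -- Up to the first half-edge at which the orientations differ, the tours coincide. The orientation
  -- having it as a tail then has a directed cycle on which it is smallest.
  minimal-unique : ∀ {T₁ S₁ T₂ S₂} → Interval T₁ S₁ → Interval T₂ S₂ → outdeg M (phi M T₁ S₁) ≡ outdeg M (phi M T₂ S₂) →
                   Minimal M (phi M T₁ S₁) → Minimal M (phi M T₂ S₂) → phi M T₁ S₁ ≡ phi M T₂ S₂
  minimal-unique {T₁} {S₁} {T₂} {S₂} I₁ I₂ eq min₁ min₂ = case first-difference I₁ I₂ eq of λ where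
      (inj₁ e) → e
      (inj₂ (k , k<n , ne , below)) → ⊥-elim (impossible k k<n ne below)
    where
    module A = Phi I₁
    module B = Phi I₂
    impossible : ∀ k → k < n → lookup A.O (A.at k) ≢ lookup B.O (A.at k) →
                 (∀ j → j < k → lookup A.O (A.at j) ≡ lookup B.O (A.at j)) → ⊥
    impossible k k<n ne below = case bool-cases (lookup A.O g) of λ where
        (inj₁ t) → not-minimal I₁ {B.O} B.orientation eq t (≢true⇒false λ e → ne (trans t (sym e)))
          (λ z lt → subst (λ z → lookup A.O z ≡ lookup B.O z) (A.at-pos z)
            (below (A.p z) (<-≤-trans lt (≤-reflexive (A.pos-at k k<n))))) min₁
        (inj₂ f) → not-minimal I₂ {A.O} A.orientation (sym eq) (≢false⇒true λ e → ne (trans f (sym e))) f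
          (λ z lt → let z<k = <-≤-trans lt (≤-reflexive (trans (cong B.p (at-agree k ≤-refl)) (B.pos-at k k<n)))
                    in subst (λ z → lookup B.O z ≡ lookup A.O z) (trans (at-agree _ (<⇒≤ z<k)) (B.at-pos z))
                         (sym (below (B.p z) z<k))) min₂
      where
      g = A.at k
      at-agree = proj₂ (common-tour I₁ I₂ eq k (<⇒≤ k<n) below)

  code : ∀ {T S} → Interval T S → ℕ
  code I = bin (λ j → lookup (Phi.O I) (Phi.at I j)) n

  private
    lower : ∀ {T S} (I : Interval T S) → ∀ {f} → f ∉ₕ T → Phi.First I f → f ∈ₕ S →
            (C : DirCycle M (phi M T S)) → IsSmallestHalfEdge M T C f →
            ∃ λ O′ → IsOrientation M O′ × outdeg M O′ ≡ outdeg M (phi M T S)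
                     × (∀ {T′ S′} (I′ : Interval T′ S′) → phi M T′ S′ ≡ O′ → code I′ < code I)
    lower {T} {S} I {f} fT ff fS C sm = reversed , reversed-orientation , reversed-outdeg , smaller
      where
      open Phi I
      open Reverse {O} orientation C
      fO = external-added fT ff fS
      f-tail : onTail f ≡ true
      f-tail = case proj₁ sm of λ where
        (i , inj₁ e) → subst (λ x → onTail x ≡ true) (sym e) (onTail⁺ i)
        (i , inj₂ e) → clash fO (subst (_∉ₕ O) (sym e) (tail-unique {O} orientation (DirCycle.tails C i)))
      off : ∀ z → p z < p f → lookup reversed z ≡ lookup O z
      off z lt = reversed-off
        (≢true⇒false λ t → let i , e = onTail⁻ t in <⇒≱ lt (subst (λ x → p f ≤ p x) e (proj₁ (proj₂ sm i))))
        (≢true⇒false λ t → let i , e = onHead⁻ t in <⇒≱ lt (subst (λ x → p f ≤ p x) e (proj₂ (proj₂ sm i))))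
      smaller : ∀ {T′ S′} (I′ : Interval T′ S′) → phi M T′ S′ ≡ reversed → code I′ < code I
      -- The orientations agree before position `p f`, so the new tour follows the old one up to
      -- there, where the digit changes from 1 to 0.
      smaller {T′} {S′} I′ e = bin-lex n (p f) (pos<n f)
          (λ j lt → trans (cong (lookup B.O) (sym (at-agree j (<⇒≤ lt)))) (sym (same j lt)))
          (trans (cong (lookup B.O) (trans (sym (at-agree (p f) ≤-refl)) (at-pos f)))
                 (trans (cong (λ O → lookup O f) e) (reversed-tail f-tail)))
          (trans (cong (lookup O) (at-pos f)) fO)
        where
        module B = Phi I′
        same : ∀ j → j < p f → lookup O (at j) ≡ lookup B.O (at j)
        same j lt = trans (sym (off (at j) (≤-<-trans (≤-reflexive (pos-at j (<-trans lt (pos<n f)))) lt)))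
                          (cong (λ O → lookup O (at j)) (sym e))
        at-agree = proj₂ (common-tour I I′ (trans (sym reversed-outdeg) (cong (outdeg M) (sym e))) (p f) (<⇒≤ (pos<n f)) same)

  -- Reversing the fundamental cycle of an edge of S ∖ T lowers the code.
  improve : ∀ {T S} (I : Interval T S) → (∃ λ f → f ∉ₕ T × Phi.First I f × f ∈ₕ S) →
            ∃ λ O′ → IsOrientation M O′ × outdeg M O′ ≡ outdeg M (phi M T S)
                     × (∀ {T′ S′} (I′ : Interval T′ S′) → phi M T′ S′ ≡ O′ → code I′ < code I)
  improve {T} {S} I (f , fT , ff , fS) = let C , sm = PhiCycles.added-dircycle I fT ff fS in lower I fT ff fS C sm

-- Every subgraph lies in a tree-interval

module Covering (M : RootedMap) where
  open Uniqueness M public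

  _∩ₕ_ : HSet M → HSet M → HSet M
  S ∩ₕ S′ = tabulate (λ h → lookup S h ∧ lookup S′ h)

  lookup-∩ : ∀ S S′ h → lookup (S ∩ₕ S′) h ≡ lookup S h ∧ lookup S′ h
  lookup-∩ S S′ = VP.lookup∘tabulate (λ h → lookup S h ∧ lookup S′ h)

  ∩-subgraph : ∀ {S S′} → IsSubgraph M S → IsSubgraph M S′ → IsSubgraph M (S ∩ₕ S′)
  ∩-subgraph {S} {S′} a b h = trans (lookup-∩ S S′ h) (trans (cong₂ _∧_ (a h) (b h)) (sym (lookup-∩ S S′ (α h))))

  size-∩-add : ∀ {W S e} → IsSubgraph M W → IsSubgraph M S → e ∉ₕ W →
               size M (addEdge M W e ∩ₕ S) ≡ ind (lookup S e) + size M (W ∩ₕ S)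
  size-∩-add {W} {S} {e} subW subS eW with bool-cases (lookup S e)
  ... | inj₁ eS = trans (cong (size M) (vec-ext {u = addEdge M W e ∩ₕ S} {addEdge M (W ∩ₕ S) e} λ x →
        trans (lookup-∩ (addEdge M W e) S x) (trans (cong (_∧ lookup S x) (lookup-add W e x))
        (trans (pt x) (sym (trans (lookup-add (W ∩ₕ S) e x) (cong (onEdge e x ∨_) (lookup-∩ W S x))))))))
        (trans (size-add {W ∩ₕ S} {e} (∩-subgraph {W} {S} subW subS) (trans (lookup-∩ W S e) (cong (_∧ lookup S e) eW)))
               (cong (λ b → ind b + size M (W ∩ₕ S)) (sym eS)))
    where
    pt : ∀ x → (onEdge e x ∨ lookup W x) ∧ lookup S x ≡ onEdge e x ∨ (lookup W x ∧ lookup S x)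
    pt x with onEdge e x in on
    ... | true  = trans (onEdge-∈ {S} subS on) eS
    ... | false = refl
  ... | inj₂ eS = trans (cong (size M) (vec-ext {u = addEdge M W e ∩ₕ S} {W ∩ₕ S} λ x →
        trans (lookup-∩ (addEdge M W e) S x) (trans (cong (_∧ lookup S x) (lookup-add W e x))
        (trans (pt x) (sym (lookup-∩ W S x)))))) (cong (λ b → ind b + size M (W ∩ₕ S)) (sym eS))
    where
    pt : ∀ x → (onEdge e x ∨ lookup W x) ∧ lookup S x ≡ lookup W x ∧ lookup S x
    pt x with onEdge e x in on
    ... | true  = trans (trans (onEdge-∈ {S} subS on) eS) (sym (trans (cong (lookup W x ∧_) (trans (onEdge-∈ {S} subS on) eS)) (𝔹.∧-zeroʳ (lookup W x))))
    ... | false = refl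

  tours-agree : ∀ {T T′} (tr : SpanningTree T) (tr′ : SpanningTree T′) k →
                (∀ j → j < k → lookup T (Tour.at tr j) ≡ lookup T′ (Tour.at tr j)) →
                ∀ j → j ≤ k → Tour.at tr j ≡ Tour.at tr′ j
  tours-agree tr tr′ k same zero    le = refl
  tours-agree {T} {T′} tr tr′ k same (suc j) le = trans
    (cong (λ b → if b then σ (α (Tour.at tr j)) else σ (Tour.at tr j)) (same j le))
    (cong (motion M T′) (tours-agree tr tr′ k same j (<⇒≤ le)))

  module _ {S : HSet M} (subS : IsSubgraph M S) where

    -- Trees are compared by |T ∩ S|, then lexicographically by T △ S along their own tours.
    lexCode : ∀ {T} → SpanningTree T → ℕ
    lexCode {T} tr = bin (λ j → lookup T (Tour.at tr j) xor lookup S (Tour.at tr j)) n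

    -- `lexCode` stays below `2 ^ n`, so the size is the leading digit.
    measure : ∀ {T} → SpanningTree T → ℕ
    measure {T} tr = lexCode tr + size M (T ∩ₕ S) * 2 ^ n

    measure-bound : ∀ {T} (tr : SpanningTree T) → measure tr < suc n * 2 ^ n
    measure-bound {T} tr = +-mono-<-≤ (bin< _ n)
      (*-monoˡ-≤ (2 ^ n) (countF≤n (λ h → lookup (T ∩ₕ S) h ∧ isEdgeRep M h)))

    private
      module Exchange {T : HSet M} (tr : SpanningTree T) {g f : Fin n} (gT : g ∈ₕ T) (fT : f ∉ₕ T)
                      (cross : inCocycle M T g f ≡ true) where
        open Tree tr

        W T′ : HSet M
        W = removeEdge M T g
        T′ = addEdge M W f

        tr′ : SpanningTree T′
        tr′ = tree⁻ T′ cross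

        subW : IsSubgraph M W
        subW = remove-subgraph {T} g subgraph

        size₀ : size M (T ∩ₕ S) ≡ ind (lookup S g) + size M (W ∩ₕ S)
        size₀ = trans (cong (λ R → size M (R ∩ₕ S)) (sym (add-remove {T} subgraph gT)))
          (size-∩-add {W} {S} {g} subW subS (remove-∉ T g))

        size₁ : size M (T′ ∩ₕ S) ≡ ind (lookup S f) + size M (W ∩ₕ S)
        size₁ = size-∩-add {W} {S} {f} subW subS (≢true⇒false λ e → clash (remove-⊆ T g f e) fT)

        T′-f : f ∈ₕ T′
        T′-f = ∈-add-self W f f (onEdge-self f)

        off-gf : ∀ {z} → onEdge g z ≡ false → onEdge f z ≡ false → lookup T z ≡ lookup T′ z
        off-gf {z} a b = sym (trans (lookup-add W f z) (trans (cong (_∨ lookup W z) b)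
          (trans (lookup-remove T g z) (cong (λ c → not c ∧ lookup T z) a))))

        T′-g : g ∉ₕ T′
        T′-g = ≢true⇒false λ e → case ∈-add⁻ W f g e of λ where
          (inj₁ on) → clash (trans (sym (onEdge-∈ {T} subgraph on)) gT) fT
          (inj₂ gW) → clash (onEdge-self g) (proj₁ (∈-remove⁻ T g g gW))

        -- a is the smaller of the two exchanged edges.
        module _ (a : Fin n) (fg : First g) (ff : First f) (a≤g : p a ≤ p g) (a≤f : p a ≤ p f) where

          agree : ∀ z → p z < p a → lookup T z ≡ lookup T′ z
          agree z lt = off-gf (away fg (<-≤-trans lt a≤g)) (away ff (<-≤-trans lt a≤f))
            where
            away : ∀ {e} → First e → p z < p e → onEdge e z ≡ false
            away {e} fe lt = ≢true⇒false λ on → case onEdge⁻ e z on of λ where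
              (inj₁ refl) → <-irrefl refl lt
              (inj₂ refl) → <-asym lt fe

          at-agree : ∀ j → j ≤ p a → at j ≡ Tour.at tr′ j
          at-agree = tours-agree tr tr′ (p a) λ j lt → agree (at j)
            (≤-<-trans (≤-reflexive (pos-at j (<-trans lt (pos<n a)))) lt)

          -- Before `p a` trees and tours coincide; at `a` the new tree differs from `S` where the
          -- old one agreed with it, so this digit rises.
          code-up : lookup T a ≡ lookup S a → lookup T′ a ≡ not (lookup S a) → lexCode tr < lexCode tr′
          code-up e e′ = bin-lex n (p a) (pos<n a)
            (λ j lt → trans (cong (_xor lookup S (at j)) (agree (at j) (≤-<-trans (≤-reflexive (pos-at j (<-trans lt (pos<n a)))) lt)))
                            (cong (λ z → lookup T′ z xor lookup S z) (at-agree j (<⇒≤ lt))))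
            (trans (cong (λ z → lookup T z xor lookup S z) (at-pos a)) (trans (cong (_xor lookup S a) e) (𝔹.xor-same (lookup S a))))
            (trans (cong (λ z → lookup T′ z xor lookup S z) (trans (sym (at-agree (p a) ≤-refl)) (at-pos a)))
                   (trans (cong (_xor lookup S a) e′) (not-xor (lookup S a))))
            where
            not-xor : ∀ b → not b xor b ≡ true
            not-xor true  = refl
            not-xor false = refl

        up-size : size M (T ∩ₕ S) < size M (T′ ∩ₕ S) → measure tr < measure tr′
        up-size lt = <-≤-trans (+-monoˡ-< (size M (T ∩ₕ S) * 2 ^ n) (bin< _ n))
          (≤-trans (*-monoˡ-≤ (2 ^ n) lt) (m≤n+m (size M (T′ ∩ₕ S) * 2 ^ n) (lexCode tr′)))

        up-code : size M (T ∩ₕ S) ≡ size M (T′ ∩ₕ S) → lexCode tr < lexCode tr′ → measure tr < measure tr′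
        up-code e lt = +-mono-<-≤ lt (≤-reflexive (cong (_* 2 ^ n) e))

    Better : ∀ {T} → SpanningTree T → Set
    Better tr = ∃ λ T′ → Σ (SpanningTree T′) λ tr′ → measure tr < measure tr′

    -- An inactive `e` at which `S` and `T` differ is exchanged with a smaller edge of its cycle or
    -- cocycle. If `S` and `T` differ at that edge as well, |T ∩ S| grows. Otherwise the size is
    -- unchanged, and T △ S gains the smaller edge, which decides the lexicographic comparison.
    better : ∀ {T} (tr : SpanningTree T) e → lookup S e ≢ lookup T e → activeB M T e ≡ false → Better tr
    better {T} tr e ne inactive = case first-or e of λ where
        (inj₁ fe) → go e fe ne inactive
        (inj₂ fe) → go (α e) fe (λ q → ne (trans (subS e) (trans q (sym (subgraph e))))) (trans (activeB-α e) inactive)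
      where
      open Tree tr
      go : ∀ e → First e → lookup S e ≢ lookup T e → activeB M T e ≡ false → Better tr
      go e fe ne inactive = [ internal , external ]′ (bool-cases (lookup T e))
        where
        internal : e ∈ₕ T → Better tr
        internal eT = case inactive-internal eT fe inactive of λ where
            (f , fT , ff , c) → grow f fT ff c
          where
          eS : e ∉ₕ S
          eS = ≢true⇒false λ t → ne (trans t (sym eT))
          grow : ∀ f → f ∉ₕ T → First f → CrossE e f → Better tr
          grow f fT ff c = T′ , tr′ , [ (λ fS → up-size (≤-reflexive (trans (cong suc before) (sym (after true fS)))))
                                      , (λ fS → up-code (trans before (sym (after false fS))) (code-up f fe ff (<⇒≤ (CrossE.f<g c)) ≤-refl
                                           (trans fT (sym fS)) (trans T′-f (sym (cong not fS))))) ]′ (bool-cases (lookup S f))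
            where
            open Exchange tr eT fT (crossE⇒cocycle eT fe fT ff c)
            before : size M (T ∩ₕ S) ≡ size M (W ∩ₕ S)
            before = trans size₀ (cong (λ b → ind b + size M (W ∩ₕ S)) eS)
            after : ∀ b → lookup S f ≡ b → size M (T′ ∩ₕ S) ≡ ind b + size M (W ∩ₕ S)
            after b q = trans size₁ (cong (λ b → ind b + size M (W ∩ₕ S)) q)
        external : e ∉ₕ T → Better tr
        external eT = case inactive-external eT fe inactive of λ where
            (g , gT , fg , c) → grow g gT fg c
          where
          eS : e ∈ₕ S
          eS = ≢false⇒true λ t → ne (trans t (sym eT))
          grow : ∀ g → g ∈ₕ T → First g → CrossI g e → Better tr
          grow g gT fg c = T′ , tr′ , [ (λ gS → up-code (trans (before true gS) (sym after)) (code-up g fg fe ≤-refl (<⇒≤ (CrossI.g<f c))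
                                           (trans gT (sym gS)) (trans T′-g (sym (cong not gS)))))
                                      , (λ gS → up-size (≤-reflexive (trans (cong suc (before false gS)) (sym after)))) ]′ (bool-cases (lookup S g))
            where
            open Exchange tr gT eT (crossI⇒cocycle gT fg eT fe c)
            before : ∀ b → lookup S g ≡ b → size M (T ∩ₕ S) ≡ ind b + size M (W ∩ₕ S)
            before b q = trans size₀ (cong (λ b → ind b + size M (W ∩ₕ S)) q)
            after : size M (T′ ∩ₕ S) ≡ suc (size M (W ∩ₕ S))
            after = trans size₁ (cong (λ b → ind b + size M (W ∩ₕ S)) eS)

    interval-of : ∃ λ T → Interval T S
    interval-of = let T , tr = spanning-tree in go (suc n * 2 ^ n) tr (m≤m+n _ _)
      where
      go : ∀ fuel {T} (tr : SpanningTree T) → suc n * 2 ^ n ≤ fuel + measure tr → ∃ λ T → Interval T S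
      go zero tr le = ⊥-elim (<⇒≱ (measure-bound tr) le)
      go (suc fuel) {T} tr le = case search (λ e → (lookup S e xor lookup T e) ∧ not (activeB M T e)) of λ where
        (inj₂ none) → T , mkInterval tr subS λ e ne → ≢false⇒true λ inactive →
          clash (∧-true⁺ (≢⇒xor ne) (not-true⁺ inactive)) (none e)
        (inj₁ (e , q)) →
          let d , a = ∧-true⁻ {lookup S e xor lookup T e} q
              T′ , tr′ , lt = better tr e (xor-true⇒≢ d) (not-true⁻ a)
          in go fuel tr′ (≤-trans le (≤-trans (≤-reflexive (sym (+-suc fuel (measure tr)))) (+-monoʳ-≤ fuel lt)))

open import Axiom.UniquenessOfIdentityProofs.WithK using (uip)
open import Data.Integer as ℤ using (ℤ; +_; -[1+_])
import Data.Integer.Properties as ℤP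
open import Data.Unit using (tt)

-- Sums and enumerations over Vec Bool n

ΣV : ∀ {n} → (Vec Bool n → ℤ) → ℤ
ΣV {zero}  f = f []
ΣV {suc n} f = ΣV (f ∘ (false ∷_)) ℤ.+ ΣV (f ∘ (true ∷_))

ΣV-cong : ∀ {n} {f g : Vec Bool n → ℤ} → (∀ v → f v ≡ g v) → ΣV f ≡ ΣV g
ΣV-cong {zero}  eq = eq []
ΣV-cong {suc n} eq = cong₂ ℤ._+_ (ΣV-cong (eq ∘ (false ∷_))) (ΣV-cong (eq ∘ (true ∷_)))

private
  interchange : ∀ a b c d → (a ℤ.+ b) ℤ.+ (c ℤ.+ d) ≡ (a ℤ.+ c) ℤ.+ (b ℤ.+ d)
  interchange a b c d = trans (ℤP.+-assoc a b (c ℤ.+ d)) (trans (cong (λ s → a ℤ.+ s) (trans (sym (ℤP.+-assoc b c d))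
    (trans (cong (ℤ._+ d) (ℤP.+-comm b c)) (ℤP.+-assoc c b d)))) (sym (ℤP.+-assoc a c (b ℤ.+ d))))

ΣV-+ : ∀ {n} (f g : Vec Bool n → ℤ) → ΣV (λ v → f v ℤ.+ g v) ≡ ΣV f ℤ.+ ΣV g
ΣV-+ {zero}  f g = refl
ΣV-+ {suc n} f g = trans (cong₂ ℤ._+_ (ΣV-+ (f ∘ (false ∷_)) (g ∘ (false ∷_))) (ΣV-+ (f ∘ (true ∷_)) (g ∘ (true ∷_))))
  (interchange (ΣV (f ∘ (false ∷_))) (ΣV (g ∘ (false ∷_))) (ΣV (f ∘ (true ∷_))) (ΣV (g ∘ (true ∷_))))

ΣV-zero : ∀ n → ΣV {n} (λ _ → + 0) ≡ + 0
ΣV-zero zero    = refl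
ΣV-zero (suc n) = cong₂ ℤ._+_ (ΣV-zero n) (ΣV-zero n)

ΣV-neg : ∀ {n} (f : Vec Bool n → ℤ) → ΣV (λ v → ℤ.- f v) ≡ ℤ.- ΣV f
ΣV-neg {zero}  f = refl
ΣV-neg {suc n} f = trans (cong₂ ℤ._+_ (ΣV-neg (f ∘ (false ∷_))) (ΣV-neg (f ∘ (true ∷_))))
  (sym (ℤP.neg-distrib-+ (ΣV (f ∘ (false ∷_))) (ΣV (f ∘ (true ∷_)))))

ΣV-comm : ∀ {m n} (f : Vec Bool m → Vec Bool n → ℤ) → ΣV (λ v → ΣV (f v)) ≡ ΣV (λ w → ΣV (λ v → f v w))
ΣV-comm {zero}  f = refl
ΣV-comm {suc m} f = trans (cong₂ ℤ._+_ (ΣV-comm (f ∘ (false ∷_))) (ΣV-comm (f ∘ (true ∷_))))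
  (sym (ΣV-+ (λ w → ΣV (λ v → f (false ∷ v) w)) (λ w → ΣV (λ v → f (true ∷ v) w))))

eqV : ∀ {n} → Vec Bool n → Vec Bool n → Bool
eqV []      []      = true
eqV (a ∷ v) (b ∷ w) = not (a xor b) ∧ eqV v w

eqV-refl : ∀ {n} (v : Vec Bool n) → eqV v v ≡ true
eqV-refl []      = refl
eqV-refl (a ∷ v) = ∧-true⁺ (not-true⁺ (𝔹.xor-same a)) (eqV-refl v)

eqV⇒≡ : ∀ {n} (v w : Vec Bool n) → eqV v w ≡ true → v ≡ w
eqV⇒≡ []      []      e = refl
eqV⇒≡ (a ∷ v) (b ∷ w) e = let x , y = ∧-true⁻ {not (a xor b)} e in
  cong₂ _∷_ (xor-false⇒≡ (not-true⁻ x)) (eqV⇒≡ v w y)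

ΣV-delta : ∀ {n} (v : Vec Bool n) (g : Vec Bool n → ℤ) → ΣV (λ w → if eqV v w then g w else + 0) ≡ g v
ΣV-delta []          g = refl
ΣV-delta {suc n} (false ∷ v) g = trans (cong₂ ℤ._+_ (ΣV-delta v (g ∘ (false ∷_))) (ΣV-zero n)) (ℤP.+-identityʳ _)
ΣV-delta {suc n} (true ∷ v)  g = trans (cong₂ ℤ._+_ (ΣV-zero n) (ΣV-delta v (g ∘ (true ∷_)))) (ℤP.+-identityˡ _)

-- Both sums are expanded over the pairs `(v , w)` with `ι v ≡ w`, a symmetric relation for an
-- involution.
ΣV-involution : ∀ {n} (ι : Vec Bool n → Vec Bool n) → (∀ v → ι (ι v) ≡ v) → ∀ g → ΣV (g ∘ ι) ≡ ΣV g
ΣV-involution ι invol g = begin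
  ΣV (λ v → g (ι v))                                        ≡⟨ ΣV-cong (λ v → sym (ΣV-delta (ι v) g)) ⟩
  ΣV (λ v → ΣV (λ w → if eqV (ι v) w then g w else + 0))    ≡⟨ ΣV-comm (λ v w → if eqV (ι v) w then g w else + 0) ⟩
  ΣV (λ w → ΣV (λ v → if eqV (ι v) w then g w else + 0))    ≡⟨ ΣV-cong (λ w → ΣV-cong (λ v → cong (λ b → if b then g w else + 0) (swap v w))) ⟩
  ΣV (λ w → ΣV (λ v → if eqV (ι w) v then g w else + 0))    ≡⟨ ΣV-cong (λ w → ΣV-delta (ι w) (λ _ → g w)) ⟩
  ΣV g                                                      ∎
  where
  open ≡-Reasoning
  half : ∀ v w → eqV (ι v) w ≡ true → eqV (ι w) v ≡ true
  half v w e with eqV⇒≡ (ι v) w e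
  ... | refl = subst (λ u → eqV u v ≡ true) (sym (invol v)) (eqV-refl v)
  swap : ∀ v w → eqV (ι v) w ≡ eqV (ι w) v
  swap v w = bool-ext (half v w) (half w v)

self-negative : ∀ s → s ≡ ℤ.- s → s ≡ + 0
self-negative (+ zero)  e = refl
self-negative (+ suc k) ()
self-negative -[1+ k ]  ()

countV : ∀ {n} → (Vec Bool n → Bool) → ℕ
countV {zero}  q = ind (q [])
countV {suc n} q = countV (q ∘ (false ∷_)) + countV (q ∘ (true ∷_))

ΣV-count : ∀ {n} (q : Vec Bool n → Bool) → ΣV (λ v → + ind (q v)) ≡ + countV q
ΣV-count {zero}  q = refl
ΣV-count {suc n} q = cong₂ ℤ._+_ (ΣV-count (q ∘ (false ∷_))) (ΣV-count (q ∘ (true ∷_)))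

-- The terms outside `q` have a sum equal to its own negative. Fixed points of `ι` outside `q` are
-- harmless, as the term there is its own negative too.
sign-reversing : ∀ {n} (q : Vec Bool n → Bool) (t : Vec Bool n → ℤ) (ι : Vec Bool n → Vec Bool n) →
                 (∀ v → ι (ι v) ≡ v) → (∀ v → q v ≡ true → t v ≡ + 1) →
                 (∀ v → q v ≡ false → q (ι v) ≡ false × t (ι v) ≡ ℤ.- t v) → ΣV t ≡ + countV q
sign-reversing q t ι invol one cancel = begin
  ΣV t                                  ≡⟨ ΣV-cong split ⟩
  ΣV (λ v → + ind (q v) ℤ.+ r v)        ≡⟨ ΣV-+ (λ v → + ind (q v)) r ⟩
  ΣV (λ v → + ind (q v)) ℤ.+ ΣV r       ≡⟨ cong₂ ℤ._+_ (ΣV-count q) (self-negative (ΣV r)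
                                             (trans (sym (ΣV-involution ι invol r)) (trans (ΣV-cong flips) (ΣV-neg r)))) ⟩
  + countV q ℤ.+ + 0                    ≡⟨ ℤP.+-identityʳ (+ countV q) ⟩
  + countV q                            ∎
  where
  open ≡-Reasoning
  r : _ → ℤ
  r v = if q v then + 0 else t v
  split : ∀ v → t v ≡ + ind (q v) ℤ.+ r v
  split v with q v in e
  ... | true  = one v e
  ... | false = sym (ℤP.+-identityˡ (t v))
  flips : ∀ v → r (ι v) ≡ ℤ.- r v
  flips v with bool-cases (q v)
  ... | inj₂ f = trans (cong (if_then + 0 else t (ι v)) (proj₁ (cancel v f)))
                       (trans (proj₂ (cancel v f)) (cong ℤ.-_ (cong (if_then + 0 else t v) (sym f))))
  ... | inj₁ e = trans (cong (if_then + 0 else t (ι v)) (≢false⇒true λ f →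
                          clash e (subst (λ u → q u ≡ false) (invol v) (proj₁ (cancel (ι v) f)))))
                       (cong ℤ.-_ (cong (if_then + 0 else t v) (sym e)))

toFin : ∀ {n} (q : Vec Bool n → Bool) v → q v ≡ true → Fin (countV q)
toFin {zero}  q []          e = subst (Fin ∘ ind) (sym e) zero
toFin {suc n} q (false ∷ v) e = toFin (q ∘ (false ∷_)) v e F.↑ˡ countV (q ∘ (true ∷_))
toFin {suc n} q (true ∷ v)  e = countV (q ∘ (false ∷_)) F.↑ʳ toFin (q ∘ (true ∷_)) v e

fromFin : ∀ {n} (q : Vec Bool n → Bool) → Fin (countV q) → ∃ λ v → q v ≡ true
fromFin {zero} q i with q [] in e
fromFin {zero} q i | true = [] , e
fromFin {suc n} q i = [ (λ j → let v , e = fromFin (q ∘ (false ∷_)) j in false ∷ v , e)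
                      , (λ j → let v , e = fromFin (q ∘ (true ∷_)) j in true ∷ v , e) ]′ (F.splitAt (countV (q ∘ (false ∷_))) i)

fromFin-toFin : ∀ {n} (q : Vec Bool n → Bool) v e → proj₁ (fromFin q (toFin q v e)) ≡ v
fromFin-toFin {zero} q [] e with proj₁ (fromFin q (toFin q [] e))
... | [] = refl
fromFin-toFin {suc n} q (false ∷ v) e
  rewrite FP.splitAt-↑ˡ (countV (q ∘ (false ∷_))) (toFin (q ∘ (false ∷_)) v e) (countV (q ∘ (true ∷_)))
  = cong (false ∷_) (fromFin-toFin (q ∘ (false ∷_)) v e)
fromFin-toFin {suc n} q (true ∷ v) e
  rewrite FP.splitAt-↑ʳ (countV (q ∘ (false ∷_))) (countV (q ∘ (true ∷_))) (toFin (q ∘ (true ∷_)) v e)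
  = cong (true ∷_) (fromFin-toFin (q ∘ (true ∷_)) v e)

private
  only-zero : ∀ b (i : Fin (ind b)) (e : b ≡ true) → subst (Fin ∘ ind) (sym e) zero ≡ i
  only-zero true zero refl = refl

toFin-irr : ∀ {n} (q : Vec Bool n → Bool) {v w} e f → v ≡ w → toFin q v e ≡ toFin q w f
toFin-irr q {v} e f refl = cong (toFin q v) (uip e f)

toFin-fromFin : ∀ {n} (q : Vec Bool n → Bool) i → toFin q (proj₁ (fromFin q i)) (proj₂ (fromFin q i)) ≡ i
toFin-fromFin {zero} q i = go (proj₁ (fromFin q i)) (proj₂ (fromFin q i))
  where
  go : ∀ v (e : q v ≡ true) → toFin q v e ≡ i
  go [] e = only-zero (q []) i e
toFin-fromFin {suc n} q i with F.splitAt (countV (q ∘ (false ∷_))) i in eq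
... | inj₁ j = trans (cong (F._↑ˡ countV (q ∘ (true ∷_))) (toFin-fromFin (q ∘ (false ∷_)) j)) (FP.splitAt⁻¹-↑ˡ eq)
... | inj₂ j = trans (cong (countV (q ∘ (false ∷_)) F.↑ʳ_) (toFin-fromFin (q ∘ (true ∷_)) j)) (FP.splitAt⁻¹-↑ʳ eq)

counted-by : ∀ {n} {P : Vec Bool n → Set} {z} (q : Vec Bool n → Bool) → (∀ v → P v → q v ≡ true) →
             (∀ v → q v ≡ true → P v) → z ≡ + countV q → CountedBy P z
counted-by q complete sound z≡ = countV q , record
  { to       = λ {v} p → toFin q v (complete v p)
  ; to-ok    = λ _ → tt
  ; to-irr   = λ {v} p p′ → toFin-irr q (complete v p) (complete v p′) refl
  ; from     = λ {i} _ → proj₁ (fromFin q i)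
  ; from-ok  = λ {i} _ → sound _ (proj₂ (fromFin q i))
  ; from-irr = λ _ _ → refl
  ; from∘to  = λ {v} p → fromFin-toFin q v (complete v p)
  ; to∘from  = λ {i} _ → trans (toFin-irr q _ (proj₂ (fromFin q i)) refl) (toFin-fromFin q i)
  } , z≡

-- Iterating an injection of a finite set leads back to the start, and the last iterate before the
-- return is a preimage.
injective⇒surjective : ∀ {n} (f : Vec Bool n → Vec Bool n) → (∀ {v w} → f v ≡ f w → v ≡ w) → ∀ w → ∃ λ v → f v ≡ w
injective⇒surjective {n} f inj w = let p , _ , e = period f′-inj (enc w) in
    dec (iter p f′ (enc w)) , trans (sym (dec-enc (f (dec (iter p f′ (enc w)))))) (trans (cong dec e) (dec-enc w))
  where
  all : Vec Bool n → Bool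
  all _ = true
  enc : Vec Bool n → Fin (countV all)
  enc v = toFin all v refl
  dec : Fin (countV all) → Vec Bool n
  dec i = proj₁ (fromFin all i)
  dec-enc : ∀ v → dec (enc v) ≡ v
  dec-enc v = fromFin-toFin all v refl
  dec-inj : ∀ {i j} → dec i ≡ dec j → i ≡ j
  dec-inj {i} {j} e = trans (sym (toFin-fromFin all i)) (trans (toFin-irr all _ _ e) (toFin-fromFin all j))
  f′ : Fin (countV all) → Fin (countV all)
  f′ = enc ∘ f ∘ dec
  f′-inj : Injective _≡_ _≡_ f′
  f′-inj e = dec-inj (inj (trans (sym (dec-enc _)) (trans (cong dec e) (dec-enc _))))

sumℤ-++ : ∀ xs ys → sumℤ (xs L.++ ys) ≡ sumℤ xs ℤ.+ sumℤ ys
sumℤ-++ []       ys = sym (ℤP.+-identityˡ (sumℤ ys))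
sumℤ-++ (x ∷ xs) ys = trans (cong (λ s → x ℤ.+ s) (sumℤ-++ xs ys)) (sym (ℤP.+-assoc x (sumℤ xs) (sumℤ ys)))

sumℤ-allSubsets : ∀ n (g : Vec Bool n → ℤ) → sumℤ (L.map g (allSubsets n)) ≡ ΣV g
sumℤ-allSubsets zero    g = ℤP.+-identityʳ (g [])
sumℤ-allSubsets (suc n) g = trans (cong sumℤ (LP.map-++ g (L.map (false ∷_) (allSubsets n)) (L.map (true ∷_) (allSubsets n))))
  (trans (sumℤ-++ (L.map g (L.map (false ∷_) (allSubsets n))) _) (cong₂ ℤ._+_ (part false) (part true)))
  where
  part : ∀ b → sumℤ (L.map g (L.map (b ∷_) (allSubsets n))) ≡ ΣV (g ∘ (b ∷_))
  part b = trans (cong sumℤ (sym (LP.map-∘ (allSubsets n)))) (sumℤ-allSubsets n (g ∘ (b ∷_)))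

-- The sum defining the Tutte polynomial ranges over a list filtered by a function local to the
-- definition; abstracting the list of all subsets recovers that sum as a function of the list.
mutual
  partialTutte : (M : RootedMap) (x y : ℤ) → List (HSet M) → ℤ
  partialTutte = _

  tutte≡partial : ∀ M x y → ∃ λ Ss → tutte M x y ≡ partialTutte M x y Ss × Ss ≡ allSubsets (RootedMap.n M)
  tutte≡partial M x y with allSubsets (RootedMap.n M)
  ... | Ss = Ss , refl , refl

tutteTerm : (M : RootedMap) (x y : ℤ) → HSet M → ℤ
tutteTerm M x y S = ((x ℤ.- + 1) ℤ.^ (numComp M S ∸ 1)) ℤ.* ((y ℤ.- + 1) ℤ.^ (size M S + numComp M S ∸ numV M))

tutte≡ΣV : ∀ M x y → tutte M x y ≡ ΣV (λ S → if isSubgraphB M S then tutteTerm M x y S else + 0)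
tutte≡ΣV M x y = let Ss , e , e′ = tutte≡partial M x y in
    trans e (trans (expand Ss) (trans (cong (sumℤ ∘ L.map summand) e′) (sumℤ-allSubsets _ summand)))
  where
  summand : HSet M → ℤ
  summand S = if isSubgraphB M S then tutteTerm M x y S else + 0
  expand : ∀ Ss → partialTutte M x y Ss ≡ sumℤ (L.map summand Ss)
  expand [] = refl
  expand (S ∷ Ss) with isSubgraphB M S
  ... | true  = cong (λ s → tutteTerm M x y S ℤ.+ s) (expand Ss)
  ... | false = trans (expand Ss) (sym (ℤP.+-identityˡ _))

-- Bijectivity of Φ and its consequences

module Bijections (M : RootedMap) where
  open Covering M public

  subgraph? : ∀ S → IsSubgraph M S ⊎ isSubgraphB M S ≡ false
  subgraph? S with bool-cases (isSubgraphB M S)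
  ... | inj₁ t = inj₁ (subgraphB⁻ S t)
  ... | inj₂ f = inj₂ f

  abstract
    private
      choose : ∀ S → ∃ λ T → IsSubgraph M S → Interval T S
      choose S = case subgraph? S of λ where
        (inj₁ sub) → let T , I = interval-of {S} sub in T , λ _ → I
        (inj₂ f)   → S , λ sub → clash (subgraphB⁺ S sub) f

    -- junk if S is not a subgraph
    treeOf : HSet M → HSet M
    treeOf S = proj₁ (choose S)

    interval : ∀ {S} → IsSubgraph M S → Interval (treeOf S) S
    interval {S} = proj₂ (choose S)

  Φ : HSet M → HSet M
  Φ S = phi M (treeOf S) S

  Φ-orientation : ∀ {S} → IsSubgraph M S → IsOrientation M (Φ S)
  Φ-orientation {S} sub = Phi.orientation (interval {S} sub)

  Φ-injective : ∀ {S S′} → IsSubgraph M S → IsSubgraph M S′ → Φ S ≡ Φ S′ → S ≡ S′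
  Φ-injective {S} {S′} sub sub′ e = proj₂ (phi-injective (interval {S} sub) (interval {S′} sub′) e)

  isEdgeRep-α : ∀ h → isEdgeRep M (α h) ≡ not (isEdgeRep M h)
  isEdgeRep-α h with <-cmp (toℕ h) (toℕ (α h))
  ... | tri≈ _ e _  = ⊥-elim (α-fpf h (sym (FP.toℕ-injective e)))
  ... | tri< lt _ _ = trans (≢true⇒false λ q → <-asym lt (subst (λ x → toℕ (α h) < toℕ x) (αα h) (<ᵇ⁻ q))) (sym (cong not (<ᵇ⁺ lt)))
  ... | tri> ne _ gt = trans (<ᵇ⁺ (subst (λ x → toℕ (α h) < toℕ x) (sym (αα h)) gt)) (sym (cong not (≢true⇒false (ne ∘ <ᵇ⁻))))

  -- Flipping one half-edge of each edge turns orientations into subgraphs.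
  twist : HSet M → HSet M
  twist S = tabulate (λ h → lookup S h xor isEdgeRep M h)

  lookup-twist : ∀ S h → lookup (twist S) h ≡ lookup S h xor isEdgeRep M h
  lookup-twist S = VP.lookup∘tabulate (λ h → lookup S h xor isEdgeRep M h)

  twist-injective : ∀ {S S′} → twist S ≡ twist S′ → S ≡ S′
  twist-injective {S} {S′} e = vec-ext λ h → cancel (lookup S h) (lookup S′ h) (isEdgeRep M h)
      (trans (sym (lookup-twist S h)) (trans (cong (λ R → lookup R h) e) (lookup-twist S′ h)))
    where
    cancel : ∀ a b c → a xor c ≡ b xor c → a ≡ b
    cancel true  true  c     e  = refl
    cancel false false c     e  = refl
    cancel true  false true  ()
    cancel true  false false ()
    cancel false true  true  ()
    cancel false true  false ()

  twist-subgraph : ∀ {O} → IsOrientation M O → IsSubgraph M (twist O)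
  twist-subgraph {O} or h = trans (lookup-twist O h) (trans (pt (or h))
      (sym (trans (lookup-twist O (α h)) (cong (lookup O (α h) xor_) (isEdgeRep-α h)))))
    where
    pt : lookup O h ≡ not (lookup O (α h)) → lookup O h xor isEdgeRep M h ≡ lookup O (α h) xor not (isEdgeRep M h)
    pt e rewrite e with lookup O (α h) | isEdgeRep M h
    ... | true  | true  = refl
    ... | true  | false = refl
    ... | false | true  = refl
    ... | false | false = refl

  -- There are as many orientations as subgraphs, so the injection Φ is onto.
  private
    onto : ∀ {O} → IsOrientation M O → ∃ λ S → IsSubgraph M S × Φ S ≡ O
    onto {O} or = let S , e = injective⇒surjective G G-injective (twist O) in
        case subgraph? S of λ where
          (inj₁ sub) → S , sub , twist-injective (trans (sym (G-sub sub)) e)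
          (inj₂ f)   → clash (trans (cong (isSubgraphB M) (trans (sym (G-non f)) e)) (subgraphB⁺ (twist O) (twist-subgraph {O} or))) f
      where
      -- Being the identity off the subgraphs makes `G` a self-map of all half-edge sets. Its two
      -- parts do not collide because `twist` takes orientations to subgraphs.
      G : HSet M → HSet M
      G S = if isSubgraphB M S then twist (Φ S) else S
      G-sub : ∀ {S} → IsSubgraph M S → G S ≡ twist (Φ S)
      G-sub {S} sub = cong (if_then twist (Φ S) else S) (subgraphB⁺ S sub)
      G-non : ∀ {S} → isSubgraphB M S ≡ false → G S ≡ S
      G-non {S} f = cong (if_then twist (Φ S) else S) f
      mixed : ∀ {S S′} → IsSubgraph M S → isSubgraphB M S′ ≡ false → G S ≢ G S′
      mixed {S} {S′} sub f e = clash (subgraphB⁺ S′ (subst (IsSubgraph M) (trans (sym (G-sub sub)) (trans e (G-non f)))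
        (twist-subgraph {Φ S} (Φ-orientation {S} sub)))) f
      G-injective : ∀ {S S′} → G S ≡ G S′ → S ≡ S′
      G-injective {S} {S′} e with subgraph? S | subgraph? S′
      ... | inj₁ sub | inj₁ sub′ = Φ-injective {S} {S′} sub sub′ (twist-injective (trans (sym (G-sub sub)) (trans e (G-sub sub′))))
      ... | inj₂ f   | inj₂ f′   = trans (sym (G-non f)) (trans e (G-non f′))
      ... | inj₁ sub | inj₂ f′   = ⊥-elim (mixed {S} {S′} sub f′ e)
      ... | inj₂ f   | inj₁ sub′ = ⊥-elim (mixed {S′} {S} sub′ f (sym e))

  abstract
    Φ-surjective : ∀ {O} → IsOrientation M O → ∃ λ S → IsSubgraph M S × Φ S ≡ O
    Φ-surjective {O} = onto {O}

  -- The image of the pair `T`, `S` is also the image of some `S′` with its chosen tree; injectivity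
  -- on pairs identifies both components.
  interval-unique : ∀ {T S} → Interval T S → T ≡ treeOf S
  interval-unique {T} {S} I with Φ-surjective (Phi.orientation I)
  ... | S′ , sub′ , e with phi-injective (interval {S′} sub′) I e
  ...   | eT , eS = trans (sym eT) (cong treeOf eS)

  module _ {T S : HSet M} (I : Interval T S) where
    open Phi I

    -- No edge of `S` leaves the subtree: `g` is gone, an external edge larger than `g` would have
    -- been added against its minimality, and a smaller one contradicts activity of `g`.
    removed-separates : ∀ {g} → g ∈ₕ T → First g → g ∉ₕ S → ∀ {x y} → Conn S x y → subtree g x ≡ subtree g y
    removed-separates {g} gT fg gS c = bool-ext (closed-reaches (subtree-vertexSet gT fg) closed c)
        (closed-reaches (subtree-vertexSet gT fg) closed (conn-sym S subS c))
      where
      closed : ClosedUnder (lookup S) (subtree g)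
      closed h in′ hS = ≢false⇒true λ out → case bool-cases (lookup T h) of λ where
        (inj₁ hT) → clash in′ (trans (sym (subtree-internal gT fg hT (≢true⇒false λ on →
                      clash hS (trans (onEdge-∈ {S} subS on) gS)))) out)
        (inj₂ hT) → case leaving gT fg hT in′ out of λ where
          (inj₁ (fh , c)) → added-minimal hT fh hS gT fg c
          (inj₂ (fh , c)) → removed-minimal gT fg gS (∉-α hT) fh c

    removed-disconnects : ∀ {g} → g ∈ₕ T → g ∉ₕ S → ¬ Conn S g (α g)
    removed-disconnects {g} gT gS c = case first-or g of λ where
      (inj₁ fg) → clash (trans (removed-separates gT fg gS c) (subtree-α fg)) (subtree-self g)
      (inj₂ fg) → clash (trans (sym (removed-separates (∈-α gT) fg (trans (sym (subS g)) gS) c))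
                    (trans (cong (subtree (α g)) (sym (αα g))) (subtree-α fg))) (subtree-self (α g))

    connected⇒T⊆S : Connected S → T⊆S
    connected⇒T⊆S con g gT = ≢false⇒true λ gS → removed-disconnects gT gS (con g (α g))

    T⊆S⇒connected : T⊆S → Connected S
    T⊆S⇒connected sub x y = reaches-mono sub (connected x y)

    -- The tree path between the ends of `f` survives in `S`: its edges are larger than the active
    -- `f`, so none of them is active, as a removed edge must be.
    added-connects : ∀ {f} → f ∉ₕ T → f ∈ₕ S → Conn (removeEdge M S f) f (α f)
    added-connects {f} fT fS = case first-or f of λ where
        (inj₁ ff) → path fT ff fS
        (inj₂ ff) → subst₂ (λ R x → Conn R f x) (remove-comm-α S f) refl (conn-sym (removeEdge M S (α f))
          (remove-subgraph {S} (α f) subS) (subst (Conn (removeEdge M S (α f)) (α f)) (αα f) (path (∉-α fT) ff (trans (sym (subS f)) fS))))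
      where
      path : ∀ {f} → f ∉ₕ T → First f → f ∈ₕ S → Conn (removeEdge M S f) f (α f)
      path {f} fT ff fS = downward-path fT ff (added-minimal fT ff fS) λ g gT fg c →
        ∈-remove⁺ S f g (≢true⇒false λ on → clash (trans (sym (onEdge-∈ {T} subgraph on)) gT) fT)
          (≢false⇒true λ gS → removed-minimal gT fg gS fT ff c)

    forest⇒S⊆T : Forest S → S⊆T
    forest⇒S⊆T F f fS = ≢false⇒true λ fT → F f fS (added-connects fT fS)

    S⊆T⇒forest : S⊆T → Forest S
    S⊆T⇒forest sub = forest-sub {S} {T} sub forest

  externalTree⁻ : ∀ T → externalTreeB M T ≡ true → ∀ e → e ∈ₕ T → activeB M T e ≡ false
  externalTree⁻ T q e eT = not-true⁻ ([ (λ a → clash eT (not-true⁻ a)) , id ]′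
    (∨-true⁻ {not (lookup T e)} (allF⁻ (λ e → not (lookup T e) ∨ not (activeB M T e)) q e)))

  externalTree⁺ : ∀ T → (∀ e → e ∈ₕ T → activeB M T e ≡ false) → externalTreeB M T ≡ true
  externalTree⁺ T k = allF⁺ (λ e → not (lookup T e) ∨ not (activeB M T e)) λ e →
    [ (λ t → ∨-trueʳ {not (lookup T e)} (not-true⁺ (k e t))) , (λ f → ∨-trueˡ (not-true⁺ f)) ]′ (bool-cases (lookup T e))

  internalTree⁻ : ∀ T → internalTreeB M T ≡ true → ∀ e → e ∉ₕ T → activeB M T e ≡ false
  internalTree⁻ T q e eT = not-true⁻ ([ (λ a → clash a eT) , id ]′
    (∨-true⁻ {lookup T e} (allF⁻ (λ e → lookup T e ∨ not (activeB M T e)) q e)))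

  internalTree⁺ : ∀ T → (∀ e → e ∉ₕ T → activeB M T e ≡ false) → internalTreeB M T ≡ true
  internalTree⁺ T k = allF⁺ (λ e → lookup T e ∨ not (activeB M T e)) λ e →
    [ ∨-trueˡ , (λ f → ∨-trueʳ {lookup T e} (not-true⁺ (k e f))) ]′ (bool-cases (lookup T e))

  isExternal⁻ : ∀ {S} → IsExternal M S → externalTreeB M (treeOf S) ≡ true
  isExternal⁻ {S} (T , I , e) = subst (λ T → externalTreeB M T ≡ true) (interval-unique (interval⁻ {T} {S} I)) e

  isExternal⁺ : ∀ {S} → IsSubgraph M S → externalTreeB M (treeOf S) ≡ true → IsExternal M S
  isExternal⁺ {S} sub e = treeOf S , interval⁺ (interval {S} sub) , e

  isInternal⁻ : ∀ {S} → IsInternal M S → internalTreeB M (treeOf S) ≡ true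
  isInternal⁻ {S} (T , I , e) = subst (λ T → internalTreeB M T ≡ true) (interval-unique (interval⁻ {T} {S} I)) e

  isInternal⁺ : ∀ {S} → IsSubgraph M S → internalTreeB M (treeOf S) ≡ true → IsInternal M S
  isInternal⁺ {S} sub e = treeOf S , interval⁺ (interval {S} sub) , e

  Φ-bijection : {P Q : HSet M → Set} → (∀ {O} → P O → IsOrientation M O) → (∀ {S} → Q S → IsSubgraph M S) →
                (∀ {S} → Q S → P (Φ S)) → (∀ {S} → IsSubgraph M S → P (Φ S) → Q S) → P ⟷ Q
  Φ-bijection {P} {Q} or sub Q⇒P P⇒Q = record
    { to       = pre
    ; to-ok    = pre-ok
    ; to-irr   = λ p p′ → Φ-injective (sub (pre-ok p)) (sub (pre-ok p′)) (trans (Φ-pre p) (sym (Φ-pre p′)))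
    ; from     = λ {S} _ → Φ S
    ; from-ok  = Q⇒P
    ; from-irr = λ _ _ → refl
    ; from∘to  = Φ-pre
    ; to∘from  = λ q → Φ-injective (sub (pre-ok (Q⇒P q))) (sub q) (Φ-pre (Q⇒P q))
    }
    where
    pre : ∀ {O} → P O → HSet M
    pre p = proj₁ (Φ-surjective (or p))
    Φ-pre : ∀ {O} (p : P O) → Φ (pre p) ≡ O
    Φ-pre p = proj₂ (proj₂ (Φ-surjective (or p)))
    pre-ok : ∀ {O} (p : P O) → Q (pre p)
    pre-ok p = P⇒Q (proj₁ (proj₂ (Φ-surjective (or p)))) (subst P (sym (Φ-pre p)) p)

  -- Minimal orientations and outdegree sequences

  minimal-unique′ : ∀ {O O′} → IsOrientation M O → IsOrientation M O′ → outdeg M O ≡ outdeg M O′ →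
                    Minimal M O → Minimal M O′ → O ≡ O′
  minimal-unique′ or or′ eq min min′ =
    let S , sub , e = Φ-surjective or
        S′ , sub′ , e′ = Φ-surjective or′
    in trans (sym e) (trans (minimal-unique (interval {S} sub) (interval {S′} sub′)
         (trans (cong (outdeg M) e) (trans eq (cong (outdeg M) (sym e′))))
         (subst (Minimal M) (sym e) min) (subst (Minimal M) (sym e′) min′)) e′)

  MinimalLike : HSet M → Set
  MinimalLike O = ∃ λ O′ → IsOrientation M O′ × outdeg M O′ ≡ outdeg M O × Minimal M O′

  minimal-exists : ∀ {O} → IsOrientation M O → MinimalLike O
  minimal-exists {O} or = let S , sub , e = Φ-surjective {O} or in
      subst MinimalLike e (go (suc (code (interval {S} sub))) sub ≤-refl)
    where
    go : ∀ k {S} (sub : IsSubgraph M S) → code (interval {S} sub) < k → MinimalLike (Φ S)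
    go (suc k) {S} sub (s≤s le) = [ reverse , done ]′ (search (λ f → lookup S f ∧ not (lookup (treeOf S) f)))
      where
      I = interval {S} sub
      open Phi I
      done : (∀ f → lookup S f ∧ not (lookup (treeOf S) f) ≡ false) → MinimalLike (Φ S)
      done none = Φ S , orientation , refl , minimal-of-forest I λ f fS → ≢false⇒true λ fT →
        clash (∧-true⁺ fS (not-true⁺ fT)) (none f)
      descend : (∃ λ O′ → IsOrientation M O′ × outdeg M O′ ≡ outdeg M (Φ S)
                   × (∀ {T′ S′} (I′ : Interval T′ S′) → phi M T′ S′ ≡ O′ → code I′ < code I)) → MinimalLike (Φ S)
      descend (O′ , or′ , deg , lower) = again (Φ-surjective or′)
        where
        again : (∃ λ S′ → IsSubgraph M S′ × Φ S′ ≡ O′) → MinimalLike (Φ S)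
        again (S′ , sub′ , e) =
          let O″ , or″ , deg′ , min = go k {S′} sub′ (<-≤-trans (lower (interval {S′} sub′) e) le)
          in O″ , or″ , trans deg′ (trans (cong (outdeg M) e) deg) , min
      reverse : (∃ λ f → lookup S f ∧ not (lookup (treeOf S) f) ≡ true) → MinimalLike (Φ S)
      reverse (f , q) =
        let fS , fT = ∧-true⁻ {lookup S f} q
            r , fr , same , _ = first-of f
        in descend (improve I (r , trans (same (treeOf S) subgraph) (not-true⁻ fT) , fr , trans (same S sub) fS))

  -- A sequence is sent to its minimal orientation, whose uniqueness makes the choice independent of
  -- the proof.
  outdeg-bijection : {D : Vec ℕ n → Set} {P : HSet M → Set} → (∀ {d} → D d → IsOutdegSeq M d) →
    (∀ {d O} → D d → IsOrientation M O → outdeg M O ≡ d → Minimal M O → P O) →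
    (∀ {O} → P O → IsOrientation M O) → (∀ {O} → P O → Minimal M O) → (∀ {O} → P O → D (outdeg M O)) → D ⟷ P
  outdeg-bijection {D} {P} seq mk or min deg = record
    { to       = λ p → proj₁ (rep (seq p))
    ; to-ok    = λ p → let _ , o , e , m = rep (seq p) in mk p o e m
    ; to-irr   = λ p p′ → let _ , o , e , m = rep (seq p)
                              _ , o′ , e′ , m′ = rep (seq p′)
                          in minimal-unique′ o o′ (trans e (sym e′)) m m′
    ; from     = λ {O} _ → outdeg M O
    ; from-ok  = deg
    ; from-irr = λ _ _ → refl
    ; from∘to  = λ p → proj₁ (proj₂ (proj₂ (rep (seq p))))
    ; to∘from  = λ p → let _ , o , e , m = rep (seq (deg p)) in minimal-unique′ o (or p) e m (min p)
    }
    where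
    rep : ∀ {d} → IsOutdegSeq M d → ∃ λ O → IsOrientation M O × outdeg M O ≡ d × Minimal M O
    rep (O , or , refl) = minimal-exists {O} or

  V0-outdeg : ∀ {O O′} → IsOrientation M O → IsOrientation M O′ → outdeg M O ≡ outdeg M O′ → V0Connected M O → V0Connected M O′
  V0-outdeg {O} {O′} or or′ eq v0 h = reachSet⁺ (lookup O′) (reaches-outdeg {O′} {O} or′ or (sym eq) (reachSet⁻ (lookup O) h₀ h (v0 h)))

  strong-outdeg : ∀ {O O′} → IsOrientation M O → IsOrientation M O′ → outdeg M O ≡ outdeg M O′ →
                  StronglyConnected M O → StronglyConnected M O′
  strong-outdeg {O} {O′} or or′ eq sc x y =
    reachSet⁺ (lookup O′) (reaches-outdeg {O′} {O} or′ or (sym eq) (reachSet⁻ (lookup O) x y (sc x y)))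

-- Toggling active edges and the signs of the Tutte terms

one^ : ∀ k → (+ 1) ℤ.^ k ≡ + 1
one^ zero    = refl
one^ (suc k) = trans (ℤP.*-identityˡ ((+ 1) ℤ.^ k)) (one^ k)

zero^ : ∀ {k} → 0 < k → (+ 0) ℤ.^ k ≡ + 0
zero^ {suc k} _ = ℤP.*-zeroˡ ((+ 0) ℤ.^ k)

minus-one^ : ∀ k → -[1+ 0 ] ℤ.^ suc k ≡ ℤ.- (-[1+ 0 ] ℤ.^ k)
minus-one^ k = ℤP.-1*i≡-i (-[1+ 0 ] ℤ.^ k)

module Counting (M : RootedMap) where
  open Bijections M public

  corank nullity : HSet M → ℕ
  corank S  = numComp M S ∸ 1
  nullity S = size M S + numComp M S ∸ numV M

  module _ {S : HSet M} (sub : IsSubgraph M S) where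

    corank-connected : Connected S → corank S ≡ 0
    corank-connected c = cong (_∸ 1) (numComp-connected {S} sub c)

    corank-disconnected : connectedB M S ≡ false → 0 < corank S
    corank-disconnected e = let x , y , nc = connectedB-false S e in
      ∸-monoˡ-≤ 1 (numComp-disconnected {S} {x} {y} sub nc)

    nullity-forest : Forest S → nullity S ≡ 0
    nullity-forest F = case rank {S} sub of λ where
      (inj₁ (_ , e)) → trans (cong (_∸ numV M) e) (n∸n≡0 (numV M))
      (inj₂ (nF , _)) → ⊥-elim (nF F)

    nullity-cyclic : forestB M S ≡ false → 0 < nullity S
    nullity-cyclic e = case rank {S} sub of λ where
      (inj₁ (F , _)) → clash (forestB⁺ S F) e
      (inj₂ (_ , lt)) → m<n⇒0<n∸m lt

    numV≤ : numV M ≤ size M S + numComp M S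
    numV≤ = case rank {S} sub of λ where
      (inj₁ (_ , e)) → ≤-reflexive (sym e)
      (inj₂ (_ , lt)) → <⇒≤ lt

    corank-separated : ∀ {e} → ¬ Conn S e (α e) → corank S ≡ suc (corank (addEdge M S e))
    corank-separated {e} nc = trans (cong (_∸ 1) (numComp-add-separated {S} sub nc)) (sym (m+[n∸m]≡n positive))
      where
      -- A component exists because the map has a root; this lets the truncated `∸ 1` commute with
      -- `suc`.
      positive : 1 ≤ numComp M (addEdge M S e)
      positive = let h , _ , r = leader (addEdge M S e) h₀ in
        ≤-trans (≤-reflexive (sym (countF-single h))) (countF-mono {p = h ==_} {isRep (addEdge M S e)}
          λ x q → subst (λ y → isRep (addEdge M S e) y ≡ true) (==⁻ h x q) r)

    nullity-separated : ∀ {e} → e ∉ₕ S → ¬ Conn S e (α e) → nullity S ≡ nullity (addEdge M S e)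
    nullity-separated {e} e∉ nc = cong (_∸ numV M) (trans (cong (λ c → size M S + c) (numComp-add-separated {S} sub nc))
      (trans (+-suc (size M S) _) (cong (_+ numComp M (addEdge M S e)) (sym (size-add {S} sub e∉)))))

    corank-joined : ∀ {e} → Conn S e (α e) → corank (addEdge M S e) ≡ corank S
    corank-joined c = cong (_∸ 1) (numComp-add-connected {S} sub c)

    nullity-joined : ∀ {e} → e ∉ₕ S → Conn S e (α e) → nullity (addEdge M S e) ≡ suc (nullity S)
    nullity-joined {e} e∉ c = trans (cong (_∸ numV M) (cong₂ _+_ (size-add {S} sub e∉) (numComp-add-connected {S} sub c)))
      (+-∸-assoc 1 numV≤)

  toggle : Fin n → HSet M → HSet M
  toggle e S = if lookup S e then removeEdge M S e else addEdge M S e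

  toggle-in : ∀ {e S} → e ∈ₕ S → toggle e S ≡ removeEdge M S e
  toggle-in {e} {S} q = cong (if_then removeEdge M S e else addEdge M S e) q

  toggle-out : ∀ {e S} → e ∉ₕ S → toggle e S ≡ addEdge M S e
  toggle-out {e} {S} q = cong (if_then removeEdge M S e else addEdge M S e) q

  toggle-involutive : ∀ {e S} → IsSubgraph M S → toggle e (toggle e S) ≡ S
  toggle-involutive {e} {S} sub with bool-cases (lookup S e)
  ... | inj₁ t = trans (cong (toggle e) (toggle-in {e} {S} t))
                   (trans (toggle-out {e} {removeEdge M S e} (remove-∉ S e)) (add-remove {S} sub t))
  ... | inj₂ f = trans (cong (toggle e) (toggle-out {e} {S} f))
                   (trans (toggle-in {e} {addEdge M S e} (∈-add-self S e e (onEdge-self e))) (remove-add {S} sub f))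

  lookup-toggle : ∀ e S x → onEdge e x ≡ false → lookup (toggle e S) x ≡ lookup S x
  lookup-toggle e S x off with bool-cases (lookup S e)
  ... | inj₁ t = trans (cong (λ R → lookup R x) (toggle-in {e} {S} t))
                   (trans (lookup-remove S e x) (cong (λ b → not b ∧ lookup S x) off))
  ... | inj₂ f = trans (cong (λ R → lookup R x) (toggle-out {e} {S} f))
                   (trans (lookup-add S e x) (cong (_∨ lookup S x) off))

  toggle-interval : ∀ {T S e} → activeB M T e ≡ true → Interval T S → Interval T (toggle e S)
  toggle-interval {T} {S} {e} active (mkInterval tr sub act) = mkInterval tr sub′ λ x ne → case bool-cases (onEdge e x) of λ where
      (inj₂ off) → act x λ eq → ne (trans (lookup-toggle e S x off) eq)
      (inj₁ on)  → case onEdge⁻ e x on of λ where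
        (inj₁ refl) → active
        (inj₂ refl) → trans (Tree.activeB-α tr e) active
    where
    sub′ : IsSubgraph M (toggle e S)
    sub′ = case bool-cases (lookup S e) of λ where
      (inj₁ t) → subst (IsSubgraph M) (sym (toggle-in {e} {S} t)) (remove-subgraph {S} e sub)
      (inj₂ f) → subst (IsSubgraph M) (sym (toggle-out {e} {S} f)) (add-subgraph {S} e sub)

  -- Toggling the first edge of T passing an activity test is an involution of each tree-interval.
  module Toggling (test : HSet M → Fin n → Bool) (test⇒active : ∀ T e → test T e ≡ true → activeB M T e ≡ true) where

    toggleAt : ∀ T → (∃ λ e → test T e ≡ true) ⊎ (∀ e → test T e ≡ false) → HSet M → HSet M
    toggleAt T (inj₁ (e , _)) S = toggle e S
    toggleAt T (inj₂ _)       S = S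

    ι : HSet M → HSet M
    ι S = if isSubgraphB M S then toggleAt (treeOf S) (search (test (treeOf S))) S else S

    ι-non : ∀ {S} → isSubgraphB M S ≡ false → ι S ≡ S
    ι-non {S} f = cong (if_then toggleAt (treeOf S) (search (test (treeOf S))) S else S) f

    ι-sub : ∀ {S} → IsSubgraph M S → ι S ≡ toggleAt (treeOf S) (search (test (treeOf S))) S
    ι-sub {S} sub = cong (if_then toggleAt (treeOf S) (search (test (treeOf S))) S else S) (subgraphB⁺ S sub)

    toggleAt-interval : ∀ {T S} r → Interval T S → Interval T (toggleAt T r S)
    toggleAt-interval {T} {S} (inj₁ (e , q)) I = toggle-interval {T} {S} {e} (test⇒active T e q) I
    toggleAt-interval (inj₂ _) I = I

    toggleAt-involutive : ∀ {T S} r → IsSubgraph M S → toggleAt T r (toggleAt T r S) ≡ S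
    toggleAt-involutive {T} {S} (inj₁ (e , _)) sub = toggle-involutive {e} {S} sub
    toggleAt-involutive (inj₂ _) sub = refl

    ι-interval : ∀ {S} → IsSubgraph M S → Interval (treeOf S) (ι S)
    ι-interval {S} sub = subst (Interval (treeOf S)) (sym (ι-sub {S} sub))
      (toggleAt-interval (search (test (treeOf S))) (interval {S} sub))

    ι-tree : ∀ {S} → IsSubgraph M S → treeOf (ι S) ≡ treeOf S
    ι-tree {S} sub = sym (interval-unique (ι-interval {S} sub))

    ι-involutive : ∀ S → ι (ι S) ≡ S
    ι-involutive S = case subgraph? S of λ where
      (inj₂ f) → trans (cong ι (ι-non f)) (ι-non f)
      (inj₁ sub) → trans (ι-sub {ι S} (Interval.subS (ι-interval {S} sub)))
        (trans (cong (λ T → toggleAt T (search (test T)) (ι S)) (ι-tree {S} sub))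
        (trans (cong (toggleAt (treeOf S) (search (test (treeOf S)))) (ι-sub {S} sub))
               (toggleAt-involutive (search (test (treeOf S))) sub)))

    ι-Cases : HSet M → Set
    ι-Cases S = (∃ λ e → test (treeOf S) e ≡ true × ι S ≡ toggle e S) ⊎ ((∀ e → test (treeOf S) e ≡ false) × ι S ≡ S)

    ι-cases : ∀ {S} → IsSubgraph M S → ι-Cases S
    ι-cases {S} sub = go (search (test (treeOf S))) (ι-sub {S} sub)
      where
      go : ∀ r → ι S ≡ toggleAt (treeOf S) r S → ι-Cases S
      go (inj₁ (e , q)) eq = inj₁ (e , q , eq)
      go (inj₂ none)    eq = inj₂ (none , eq)

  -- One of `S` and its toggle lacks `e`, so by symmetry it suffices to compare a subgraph without
  -- `e` to the one with `e` added.
  toggle-cases : ∀ {T S e} {R : HSet M → HSet M → Set} → (∀ {a b} → R a b → R b a) → activeB M T e ≡ true → Interval T S →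
                 (∀ {S₀} → Interval T S₀ → Interval T (addEdge M S₀ e) → e ∉ₕ S₀ → R S₀ (addEdge M S₀ e)) → R (toggle e S) S
  toggle-cases {T} {S} {e} {R} R-sym active I k = case bool-cases (lookup S e) of λ where
      (inj₂ f) → subst (λ X → R X S) (sym (toggle-out {e} {S} f))
                   (R-sym (k {S} I (subst (Interval T) (toggle-out {e} {S} f) I′) f))
      (inj₁ t) → subst₂ R (sym (toggle-in {e} {S} t)) (add-remove {S} subS t)
                   (k (subst (Interval T) (toggle-in {e} {S} t) I′) (subst (Interval T) (sym (add-remove {S} subS t)) I) (remove-∉ S e))
    where
    I′ = toggle-interval {T} {S} {e} active I
    open Interval I using (subS)

  Opposite : ℤ → ℤ → HSet M → HSet M → Set
  Opposite x y S S′ = tutteTerm M x y S ≡ ℤ.- tutteTerm M x y S′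

  opposite-sym : ∀ {x y S S′} → Opposite x y S S′ → Opposite x y S′ S
  opposite-sym {x} {y} {S} {S′} e = trans (sym (ℤP.neg-involutive (tutteTerm M x y S′))) (cong ℤ.-_ (sym e))

  -- Without `e` its ends are disconnected, so adding `e` lowers the corank by one and keeps the
  -- nullity; at `x = 0` the base of the first power is -1.
  toggle-internal : ∀ {T S e} y → e ∈ₕ T → activeB M T e ≡ true → Interval T S → Opposite (+ 0) y (toggle e S) S
  toggle-internal {T} {S} {e} y eT active I = toggle-cases {T} {S} {e} {Opposite (+ 0) y}
    (λ {a} {b} → opposite-sym {+ 0} {y} {a} {b}) active I
    λ {S₀} I₀ I₁ e∉ →
      let nc = removed-disconnects I₀ eT e∉
          sub₀ = Interval.subS I₀
          B = (y ℤ.- + 1) ℤ.^ nullity (addEdge M S₀ e)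
          A = -[1+ 0 ] ℤ.^ corank (addEdge M S₀ e)
      in trans (cong₂ (λ c d → -[1+ 0 ] ℤ.^ c ℤ.* (y ℤ.- + 1) ℤ.^ d) (corank-separated {S₀} sub₀ nc) (nullity-separated {S₀} sub₀ e∉ nc))
           (trans (cong (ℤ._* B) (minus-one^ (corank (addEdge M S₀ e)))) (sym (ℤP.neg-distribˡ-* A B)))

  -- Here the ends are connected without `e`, so adding `e` raises the nullity by one and keeps the
  -- corank; at `y = 0` the base of the second power is -1.
  toggle-external : ∀ {T S e} x → e ∉ₕ T → activeB M T e ≡ true → Interval T S → Opposite x (+ 0) (toggle e S) S
  toggle-external {T} {S} {e} x eT active I = toggle-cases {T} {S} {e} {Opposite x (+ 0)}
    (λ {a} {b} → opposite-sym {x} {+ 0} {a} {b}) active I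
    λ {S₀} I₀ I₁ e∉ →
      let sub₀ = Interval.subS I₀
          c = subst (λ R → Conn R e (α e)) (remove-add {S₀} sub₀ e∉)
                (added-connects I₁ eT (∈-add-self S₀ e e (onEdge-self e)))
          A = (x ℤ.- + 1) ℤ.^ corank S₀
          B = -[1+ 0 ] ℤ.^ nullity S₀
      in opposite-sym {x} {+ 0} {addEdge M S₀ e} {S₀}
           (trans (cong₂ (λ c d → (x ℤ.- + 1) ℤ.^ c ℤ.* -[1+ 0 ] ℤ.^ d) (corank-joined {S₀} sub₀ c) (nullity-joined {S₀} sub₀ e∉ c))
             (trans (cong (A ℤ.*_) (minus-one^ (nullity S₀))) (sym (ℤP.neg-distribʳ-* A B))))

-- Evaluations of the Tutte polynomial, and the bijections

module TutteCounts (M : RootedMap) where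
  open Counting M public

  Vanishing : ℤ → ℤ → HSet M → Set
  Vanishing x y S = tutteTerm M x y S ≡ + 0

  vanishing-corank : ∀ {S} y → 0 < corank S → Vanishing (+ 1) y S
  vanishing-corank {S} y lt = trans (cong (ℤ._* (y ℤ.- + 1) ℤ.^ nullity S) (zero^ lt)) (ℤP.*-zeroˡ ((y ℤ.- + 1) ℤ.^ nullity S))

  vanishing-nullity : ∀ {S} x → 0 < nullity S → Vanishing x (+ 1) S
  vanishing-nullity {S} x lt = trans (cong ((x ℤ.- + 1) ℤ.^ corank S ℤ.*_) (zero^ lt)) (ℤP.*-zeroʳ ((x ℤ.- + 1) ℤ.^ corank S))

  vanishing⇒opposite : ∀ {x y S} → Vanishing x y S → Opposite x y S S
  vanishing⇒opposite v = trans v (cong ℤ.-_ (sym v))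

  unit-term : ∀ {x y S} → (x ℤ.- + 1) ℤ.^ corank S ≡ + 1 → (y ℤ.- + 1) ℤ.^ nullity S ≡ + 1 → tutteTerm M x y S ≡ + 1
  unit-term e f = cong₂ ℤ._*_ e f

  ^-zero : ∀ x {k} → k ≡ 0 → x ℤ.^ k ≡ + 1
  ^-zero x refl = refl

  tutte-count : ∀ x y (q : HSet M → Bool) (ι : HSet M → HSet M) → (∀ S → ι (ι S) ≡ S) →
                (∀ {S} → isSubgraphB M S ≡ false → ι S ≡ S) → (∀ S → q S ≡ true → IsSubgraph M S) →
                (∀ S → IsSubgraph M S → q S ≡ true → tutteTerm M x y S ≡ + 1) →
                (∀ S → IsSubgraph M S → q S ≡ false → IsSubgraph M (ι S) × q (ι S) ≡ false × Opposite x y (ι S) S) →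
                tutte M x y ≡ + countV q
  tutte-count x y q ι invol fix q⇒sub one opp = trans (tutte≡ΣV M x y) (sign-reversing q s ι invol
      (λ S e → trans (s-sub {S} (q⇒sub S e)) (one S (q⇒sub S e) e)) cancel)
    where
    s : HSet M → ℤ
    s S = if isSubgraphB M S then tutteTerm M x y S else + 0
    s-sub : ∀ {S} → IsSubgraph M S → s S ≡ tutteTerm M x y S
    s-sub {S} sub = cong (if_then tutteTerm M x y S else + 0) (subgraphB⁺ S sub)
    s-non : ∀ {S} → isSubgraphB M S ≡ false → s S ≡ + 0
    s-non {S} f = cong (if_then tutteTerm M x y S else + 0) f
    cancel : ∀ S → q S ≡ false → q (ι S) ≡ false × s (ι S) ≡ ℤ.- s S
    cancel S e = case subgraph? S of λ where
      (inj₁ sub) → let sub′ , e′ , o = opp S sub e in e′ , trans (s-sub {ι S} sub′) (trans o (cong ℤ.-_ (sym (s-sub {S} sub))))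
      (inj₂ f)   → trans (cong q (fix f)) e , trans (cong s (fix f)) (trans (s-non {S} f) (cong ℤ.-_ (sym (s-non {S} f))))

  plain-count : ∀ x y (q : HSet M → Bool) → (∀ S → q S ≡ true → IsSubgraph M S) →
                (∀ S → IsSubgraph M S → q S ≡ true → tutteTerm M x y S ≡ + 1) →
                (∀ S → IsSubgraph M S → q S ≡ false → Vanishing x y S) → tutte M x y ≡ + countV q
  plain-count x y q q⇒sub one vanish = tutte-count x y q id (λ _ → refl) (λ _ → refl) q⇒sub one
    λ S sub e → sub , e , vanishing⇒opposite {x} {y} {S} (vanish S sub e)

  -- Good trees are those without an edge to toggle.
  module _ (test : HSet M → Fin n → Bool) (test⇒active : ∀ T e → test T e ≡ true → activeB M T e ≡ true)
           (good : HSet M → Bool) (good⁻ : ∀ T → good T ≡ true → ∀ e → test T e ≡ false)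
           (good⁺ : ∀ T → (∀ e → test T e ≡ false) → good T ≡ true) where
    open Toggling test test⇒active

    -- Subgraphs whose tree has an edge to toggle cancel in pairs. On the other trees `ι` is the
    -- identity, and there a subgraph failing `r` must contribute zero by itself.
    toggling-count : ∀ x y → (∀ {T S e} → test T e ≡ true → Interval T S → Opposite x y (toggle e S) S) →
                     ∀ (r : HSet M → Bool) → (∀ S → r S ≡ true → IsSubgraph M S) →
                     (∀ S → IsSubgraph M S → r S ∧ good (treeOf S) ≡ true → tutteTerm M x y S ≡ + 1) →
                     (∀ S → IsSubgraph M S → r S ≡ false → good (treeOf S) ≡ true → Vanishing x y S) →
                     tutte M x y ≡ + countV (λ S → r S ∧ good (treeOf S))
    toggling-count x y flip r r⇒sub one vanish = tutte-count x y (λ S → r S ∧ good (treeOf S)) ι ι-involutive ι-non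
      (λ S e → r⇒sub S (proj₁ (∧-true⁻ e))) one λ S sub e → Interval.subS (ι-interval {S} sub) ,
        (case ι-cases {S} sub of λ where
          (inj₁ (e , q , eq)) →
            trans (cong (r (ι S) ∧_) (trans (cong good (ι-tree {S} sub)) (≢true⇒false λ g →
              clash q (good⁻ (treeOf S) g e)))) (𝔹.∧-zeroʳ (r (ι S))) ,
            subst (λ R → Opposite x y R S) (sym eq) (flip q (interval {S} sub))
          (inj₂ (none , eq)) →
            let g = good⁺ (treeOf S) none
                r≡ = ≢true⇒false λ t → clash (∧-true⁺ t g) e
            in trans (cong (λ S → r S ∧ good (treeOf S)) eq) e ,
               subst (λ R → Opposite x y R S) (sym eq) (vanishing⇒opposite {x} {y} {S} (vanish S sub r≡ g)))

  extB intB : HSet M → Bool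
  extB S = externalTreeB M (treeOf S)
  intB S = internalTreeB M (treeOf S)

  testI testE : HSet M → Fin n → Bool
  testI T e = lookup T e ∧ activeB M T e
  testE T e = not (lookup T e) ∧ activeB M T e

  external-count = λ y → toggling-count testI (λ T e q → proj₂ (∧-true⁻ {lookup T e} q)) (externalTreeB M)
    (λ T g e → ≢true⇒false λ q → let eT , a = ∧-true⁻ {lookup T e} q in clash a (externalTree⁻ T g e eT))
    (λ T none → externalTree⁺ T λ e eT → ≢true⇒false λ a → clash (∧-true⁺ eT a) (none e))
    (+ 0) y (λ {T} {S} {e} q → let eT , a = ∧-true⁻ {lookup T e} q in toggle-internal {T} {S} {e} y eT a)

  internal-count = λ x → toggling-count testE (λ T e q → proj₂ (∧-true⁻ {not (lookup T e)} q)) (internalTreeB M)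
    (λ T g e → ≢true⇒false λ q → let eT , a = ∧-true⁻ {not (lookup T e)} q in clash a (internalTree⁻ T g e (not-true⁻ eT)))
    (λ T none → internalTree⁺ T λ e eT → ≢true⇒false λ a → clash (∧-true⁺ (not-true⁺ eT) a) (none e))
    x (+ 0) (λ {T} {S} {e} q → let eT , a = ∧-true⁻ {not (lookup T e)} q in toggle-external {T} {S} {e} x (not-true⁻ eT) a)

  external⇒connected : ∀ {S} → IsSubgraph M S → extB S ≡ true → Connected S
  external⇒connected {S} sub ext = T⊆S⇒connected I (Phi.no-internal⇒T⊆S I (externalTree⁻ (treeOf S) ext))
    where I = interval {S} sub

  internal⇒forest : ∀ {S} → IsSubgraph M S → intB S ≡ true → Forest S
  internal⇒forest {S} sub int = S⊆T⇒forest I (Phi.no-external⇒S⊆T I (internalTree⁻ (treeOf S) int))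
    where I = interval {S} sub

  connected⇒ : ∀ {S} → IsConnected M S → Connected S
  connected⇒ {S} (_ , c) x y = conn⁻ S x y (c x y)

  count-connected : CountedBy (IsConnected M) (tutte M (+ 1) (+ 2))
  count-connected = counted-by (λ S → isSubgraphB M S ∧ connectedB M S)
    (λ S c → ∧-true⁺ (subgraphB⁺ S (proj₁ c)) (connectedB⁺ S (connected⇒ {S} c)))
    (λ S e → let a , b = ∧-true⁻ {isSubgraphB M S} e in subgraphB⁻ S a , λ x y → conn⁺ S (connectedB⁻ S b x y))
    (plain-count (+ 1) (+ 2) _ (λ S e → subgraphB⁻ S (proj₁ (∧-true⁻ e)))
      (λ S sub e → unit-term {+ 1} {+ 2} {S}
        (^-zero (+ 0) (corank-connected {S} sub (connectedB⁻ S (proj₂ (∧-true⁻ {isSubgraphB M S} e))))) (one^ (nullity S)))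
      (λ S sub e → vanishing-corank {S} (+ 2) (corank-disconnected {S} sub (≢true⇒false λ c → clash (∧-true⁺ (subgraphB⁺ S sub) c) e))))

  count-forest : CountedBy (IsForest M) (tutte M (+ 2) (+ 1))
  count-forest = counted-by (λ S → isSubgraphB M S ∧ forestB M S)
    (λ S (sub , f) → ∧-true⁺ (subgraphB⁺ S sub) f)
    (λ S e → let a , b = ∧-true⁻ {isSubgraphB M S} e in subgraphB⁻ S a , b)
    (plain-count (+ 2) (+ 1) _ (λ S e → subgraphB⁻ S (proj₁ (∧-true⁻ e)))
      (λ S sub e → unit-term {+ 2} {+ 1} {S} (one^ (corank S))
        (^-zero (+ 0) (nullity-forest {S} sub (forestB⁻ S (proj₂ (∧-true⁻ {isSubgraphB M S} e))))))
      (λ S sub e → vanishing-nullity {S} (+ 2) (nullity-cyclic {S} sub (≢true⇒false λ f → clash (∧-true⁺ (subgraphB⁺ S sub) f) e))))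

  tree-corank : ∀ {S} → IsSpanningTree M S → corank S ≡ 0
  tree-corank {S} e = let t = tree⁻ S e in corank-connected {S} (SpanningTree.subgraph t) (SpanningTree.connected t)

  tree-nullity : ∀ {S} → IsSpanningTree M S → nullity S ≡ 0
  tree-nullity {S} e = let t = tree⁻ S e in nullity-forest {S} (SpanningTree.subgraph t) (SpanningTree.forest t)

  tree-sub : ∀ S → IsSpanningTree M S → IsSubgraph M S
  tree-sub S e = SpanningTree.subgraph (tree⁻ S e)

  tree-unit : ∀ x y {S} → IsSpanningTree M S → tutteTerm M x y S ≡ + 1
  tree-unit x y {S} e = unit-term {x} {y} {S} (^-zero (x ℤ.- + 1) (tree-corank {S} e)) (^-zero (y ℤ.- + 1) (tree-nullity {S} e))

  not-forest : ∀ {S} → IsSubgraph M S → Connected S → spanningTreeB M S ≡ false → forestB M S ≡ false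
  not-forest {S} sub c e = ≢true⇒false λ f → clash (∧-true⁺ (subgraphB⁺ S sub) (∧-true⁺ f (connectedB⁺ S c))) e

  not-connected : ∀ {S} → IsSubgraph M S → Forest S → spanningTreeB M S ≡ false → connectedB M S ≡ false
  not-connected {S} sub F e = ≢true⇒false λ c → clash (∧-true⁺ (subgraphB⁺ S sub) (∧-true⁺ (forestB⁺ S F) c)) e

  count-tree : CountedBy (IsSpanningTree M) (tutte M (+ 1) (+ 1))
  count-tree = counted-by (spanningTreeB M) (λ S e → e) (λ S e → e)
    (plain-count (+ 1) (+ 1) _ tree-sub (λ S sub e → tree-unit (+ 1) (+ 1) {S} e) λ S sub e →
      case bool-cases (connectedB M S) of λ where
        (inj₁ c) → vanishing-nullity {S} (+ 1) (nullity-cyclic {S} sub (not-forest {S} sub (connectedB⁻ S c) e))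
        (inj₂ f) → vanishing-corank {S} (+ 1) (corank-disconnected {S} sub f))

  count-external : CountedBy (λ S → IsSubgraph M S × IsExternal M S) (tutte M (+ 0) (+ 2))
  count-external = counted-by (λ S → isSubgraphB M S ∧ extB S)
    (λ S (sub , ext) → ∧-true⁺ (subgraphB⁺ S sub) (isExternal⁻ {S} ext))
    (λ S e → let a , b = ∧-true⁻ {isSubgraphB M S} e in subgraphB⁻ S a , isExternal⁺ {S} (subgraphB⁻ S a) b)
    (external-count (+ 2) (isSubgraphB M) subgraphB⁻
      (λ S sub e → unit-term {+ 0} {+ 2} {S} (^-zero -[1+ 0 ] (corank-connected {S} sub
        (external⇒connected {S} sub (proj₂ (∧-true⁻ {isSubgraphB M S} e))))) (one^ (nullity S)))
      (λ S sub e _ → clash (subgraphB⁺ S sub) e))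

  count-external-tree : CountedBy (λ S → IsSpanningTree M S × IsExternal M S) (tutte M (+ 0) (+ 1))
  count-external-tree = counted-by (λ S → spanningTreeB M S ∧ extB S)
    (λ S (t , ext) → ∧-true⁺ t (isExternal⁻ {S} ext))
    (λ S e → let a , b = ∧-true⁻ {spanningTreeB M S} e in a , isExternal⁺ {S} (tree-sub S a) b)
    (external-count (+ 1) (spanningTreeB M) tree-sub
      (λ S sub e → tree-unit (+ 0) (+ 1) {S} (proj₁ (∧-true⁻ {spanningTreeB M S} e)))
      -- An external subgraph is connected; if it is not a tree, it has positive nullity, and at
      -- `y = 1` a factor 0.
      (λ S sub e ext → vanishing-nullity {S} (+ 0) (nullity-cyclic {S} sub (not-forest {S} sub (external⇒connected {S} sub ext) e))))

  count-internal-forest : CountedBy (λ S → IsForest M S × IsInternal M S) (tutte M (+ 2) (+ 0))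
  count-internal-forest = counted-by (λ S → isSubgraphB M S ∧ intB S)
    (λ S ((sub , _) , int) → ∧-true⁺ (subgraphB⁺ S sub) (isInternal⁻ {S} int))
    (λ S e → let a , b = ∧-true⁻ {isSubgraphB M S} e
                 sub = subgraphB⁻ S a
             in (sub , forestB⁺ S (internal⇒forest {S} sub b)) , isInternal⁺ {S} sub b)
    (internal-count (+ 2) (isSubgraphB M) subgraphB⁻
      (λ S sub e → unit-term {+ 2} {+ 0} {S} (one^ (corank S)) (^-zero -[1+ 0 ] (nullity-forest {S} sub
        (internal⇒forest {S} sub (proj₂ (∧-true⁻ {isSubgraphB M S} e))))))
      (λ S sub e _ → clash (subgraphB⁺ S sub) e))

  count-internal-tree : CountedBy (λ S → IsSpanningTree M S × IsInternal M S) (tutte M (+ 1) (+ 0))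
  count-internal-tree = counted-by (λ S → spanningTreeB M S ∧ intB S)
    (λ S (t , int) → ∧-true⁺ t (isInternal⁻ {S} int))
    (λ S e → let a , b = ∧-true⁻ {spanningTreeB M S} e in a , isInternal⁺ {S} (tree-sub S a) b)
    (internal-count (+ 1) (spanningTreeB M) tree-sub
      (λ S sub e → tree-unit (+ 1) (+ 0) {S} (proj₁ (∧-true⁻ {spanningTreeB M S} e)))
      -- An internal subgraph is a forest; if it is not a tree, it is disconnected, and at `x = 1`
      -- the corank gives a factor 0.
      (λ S sub e int → vanishing-corank {S} (+ 0) (corank-disconnected {S} sub (not-connected {S} sub (internal⇒forest {S} sub int) e))))

  module _ {S : HSet M} (sub : IsSubgraph M S) where
    private
      I = interval {S} sub

    connected⇒V0 : Connected S → V0Connected M (Φ S)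
    connected⇒V0 c = Phi.T⊆S⇒V0 I (connected⇒T⊆S I c)

    V0⇒connected : V0Connected M (Φ S) → Connected S
    V0⇒connected v = T⊆S⇒connected I (Phi.V0⇒T⊆S I v)

    forest⇒minimal : Forest S → Minimal M (Φ S)
    forest⇒minimal F = minimal-of-forest I (forest⇒S⊆T I F)

    minimal⇒forest : Minimal M (Φ S) → Forest S
    minimal⇒forest m = S⊆T⇒forest I (PhiCycles.minimal⇒S⊆T I m)

    external⇒strong : IsExternal M S → StronglyConnected M (Φ S)
    external⇒strong ext = Phi.no-internal⇒strong I (externalTree⁻ (treeOf S) (isExternal⁻ {S} ext))

    strong⇒external : StronglyConnected M (Φ S) → IsExternal M S
    strong⇒external s = isExternal⁺ {S} sub (externalTree⁺ (treeOf S) (Phi.strong⇒no-internal I s))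

    internal⇒acyclic : IsInternal M S → Acyclic M (Φ S)
    internal⇒acyclic int = PhiCycles.no-external⇒acyclic I (internalTree⁻ (treeOf S) (isInternal⁻ {S} int))

    acyclic⇒internal : Acyclic M (Φ S) → IsInternal M S
    acyclic⇒internal a = isInternal⁺ {S} sub (internalTree⁺ (treeOf S) (PhiCycles.acyclic⇒no-external I a))

    acyclic⇒forest : Acyclic M (Φ S) → Forest S
    acyclic⇒forest a = S⊆T⇒forest I (PhiCycles.acyclic⇒S⊆T I a)

    strong⇒V0 : StronglyConnected M (Φ S) → V0Connected M (Φ S)
    strong⇒V0 s h = s h₀ h

  module _ {S : HSet M} (t : IsSpanningTree M S) where
    private
      open module T = SpanningTree (tree⁻ S t)

    tree-V0 : V0Connected M (Φ S)
    tree-V0 = connected⇒V0 {S} T.subgraph T.connected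

    tree-minimal : Minimal M (Φ S)
    tree-minimal = forest⇒minimal {S} T.subgraph T.forest

  bijection₁ : (λ O → IsOrientation M O × V0Connected M O) ⟷ IsConnected M
  bijection₁ = Φ-bijection proj₁ proj₁
    (λ {S} (sub , c) → Φ-orientation {S} sub , connected⇒V0 {S} sub (connected⇒ {S} (sub , c)))
    (λ {S} sub (_ , v) → sub , λ x y → conn⁺ S (V0⇒connected {S} sub v x y))

  bijection₂ : (λ O → IsOrientation M O × StronglyConnected M O) ⟷ (λ S → IsSubgraph M S × IsExternal M S)
  bijection₂ = Φ-bijection proj₁ proj₁ (λ {S} (sub , ext) → Φ-orientation {S} sub , external⇒strong {S} sub ext)
    (λ {S} sub (_ , s) → sub , strong⇒external {S} sub s)

  bijection₃ : (λ O → IsOrientation M O × Minimal M O) ⟷ IsForest M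
  bijection₃ = Φ-bijection proj₁ proj₁ (λ {S} (sub , f) → Φ-orientation {S} sub , forest⇒minimal {S} sub (forestB⁻ S f))
    (λ {S} sub (_ , m) → sub , forestB⁺ S (minimal⇒forest {S} sub m))

  bijection₄ : (λ O → IsOrientation M O × Acyclic M O) ⟷ (λ S → IsForest M S × IsInternal M S)
  bijection₄ = Φ-bijection proj₁ (proj₁ ∘ proj₁)
    (λ {S} ((sub , _) , int) → Φ-orientation {S} sub , internal⇒acyclic {S} sub int)
    (λ {S} sub (_ , a) → (sub , forestB⁺ S (acyclic⇒forest {S} sub a)) , acyclic⇒internal {S} sub a)

  bijection₅ : (λ O → IsOrientation M O × V0Connected M O × Minimal M O) ⟷ IsSpanningTree M
  bijection₅ = Φ-bijection proj₁ (λ {S} → tree-sub S)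
    (λ {S} t → Φ-orientation {S} (tree-sub S t) , tree-V0 {S} t , tree-minimal {S} t)
    (λ {S} sub (_ , v , m) → tree⁺ {S} (mkTree sub (minimal⇒forest {S} sub m) (V0⇒connected {S} sub v)))

  bijection₆ : (λ O → IsOrientation M O × StronglyConnected M O × Minimal M O) ⟷ (λ S → IsSpanningTree M S × IsExternal M S)
  bijection₆ = Φ-bijection proj₁ (λ {S} (t , _) → tree-sub S t)
    (λ {S} (t , ext) → let sub = tree-sub S t in Φ-orientation {S} sub , external⇒strong {S} sub ext , tree-minimal {S} t)
    (λ {S} sub (_ , s , m) → tree⁺ {S} (mkTree sub (minimal⇒forest {S} sub m) (V0⇒connected {S} sub (strong⇒V0 {S} sub s))) ,
                             strong⇒external {S} sub s)

  bijection₇ : (λ O → IsOrientation M O × V0Connected M O × Acyclic M O) ⟷ (λ S → IsSpanningTree M S × IsInternal M S)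
  bijection₇ = Φ-bijection proj₁ (λ {S} (t , _) → tree-sub S t)
    (λ {S} (t , int) → let sub = tree-sub S t in Φ-orientation {S} sub , tree-V0 {S} t , internal⇒acyclic {S} sub int)
    (λ {S} sub (_ , v , a) → tree⁺ {S} (mkTree sub (acyclic⇒forest {S} sub a) (V0⇒connected {S} sub v)) , acyclic⇒internal {S} sub a)

  outdegree₃ : IsOutdegSeq M ⟷ (λ O → IsOrientation M O × Minimal M O)
  outdegree₃ = outdeg-bijection id (λ _ or _ m → or , m) proj₁ proj₂ (λ {O} (or , _) → O , or , refl)

  outdegree₅ : V0ConnectedSeq M ⟷ (λ O → IsOrientation M O × V0Connected M O × Minimal M O)
  outdegree₅ = outdeg-bijection proj₁ (λ {d} {O} (_ , v) or e m → or , v O or e , m) proj₁ (proj₂ ∘ proj₂)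
    (λ {O} (or , v , _) → (O , or , refl) , λ O′ or′ e → V0-outdeg {O} {O′} or or′ (sym e) v)

  outdegree₆ : StronglyConnectedSeq M ⟷ (λ O → IsOrientation M O × StronglyConnected M O × Minimal M O)
  outdegree₆ = outdeg-bijection proj₁ (λ {d} {O} (_ , s) or e m → or , s O or e , m) proj₁ (proj₂ ∘ proj₂)
    (λ {O} (or , s , _) → (O , or , refl) , λ O′ or′ e → strong-outdeg {O} {O′} or or′ (sym e) s)

theorem46 :
  (M : RootedMap) → 0 < numE M →
  -- 1. v₀-connected orientations ↔ connected subgraphs, counted by T(1,2)
  (((λ O → IsOrientation M O × V0Connected M O) ⟷ IsConnected M)
    × CountedBy (IsConnected M) (tutte M (+ 1) (+ 2)))
  -- 2. strongly connected orientations ↔ external subgraphs, counted by T(0,2)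
  × (((λ O → IsOrientation M O × StronglyConnected M O)
        ⟷ (λ S → IsSubgraph M S × IsExternal M S))
    × CountedBy (λ S → IsSubgraph M S × IsExternal M S) (tutte M (+ 0) (+ 2)))
  -- 3. outdegree sequences ↔ minimal orientations ↔ forests, counted by T(2,1)
  × ((IsOutdegSeq M ⟷ (λ O → IsOrientation M O × Minimal M O))
    × ((λ O → IsOrientation M O × Minimal M O) ⟷ IsForest M)
    × CountedBy (IsForest M) (tutte M (+ 2) (+ 1)))
  -- 4. acyclic orientations ↔ internal forests, counted by T(2,0)
  × (((λ O → IsOrientation M O × Acyclic M O)
        ⟷ (λ S → IsForest M S × IsInternal M S))
    × CountedBy (λ S → IsForest M S × IsInternal M S) (tutte M (+ 2) (+ 0)))
  -- 5. v₀-connected outdegree sequences ↔ v₀-connected minimal orientations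
  --    ↔ spanning trees, counted by T(1,1)
  × ((V0ConnectedSeq M
        ⟷ (λ O → IsOrientation M O × V0Connected M O × Minimal M O))
    × ((λ O → IsOrientation M O × V0Connected M O × Minimal M O)
        ⟷ IsSpanningTree M)
    × CountedBy (IsSpanningTree M) (tutte M (+ 1) (+ 1)))
  -- 6. strongly connected outdegree sequences ↔ strongly connected minimal
  --    orientations ↔ external spanning trees, counted by T(0,1)
  × ((StronglyConnectedSeq M
        ⟷ (λ O → IsOrientation M O × StronglyConnected M O × Minimal M O))
    × ((λ O → IsOrientation M O × StronglyConnected M O × Minimal M O)
        ⟷ (λ S → IsSpanningTree M S × IsExternal M S))
    × CountedBy (λ S → IsSpanningTree M S × IsExternal M S) (tutte M (+ 0) (+ 1)))
  -- 7. v₀-connected acyclic orientations ↔ internal spanning trees,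
  --    counted by T(1,0)
  × (((λ O → IsOrientation M O × V0Connected M O × Acyclic M O)
        ⟷ (λ S → IsSpanningTree M S × IsInternal M S))
    × CountedBy (λ S → IsSpanningTree M S × IsInternal M S) (tutte M (+ 1) (+ 0)))
theorem46 M _ =
    (bijection₁ , count-connected)
  , (bijection₂ , count-external)
  , (outdegree₃ , bijection₃ , count-forest)
  , (bijection₄ , count-internal-forest)
  , (outdegree₅ , bijection₅ , count-tree)
  , (outdegree₆ , bijection₆ , count-external-tree)
  , (bijection₇ , count-internal-tree)
  where open TutteCounts M
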